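{- Assume the continuum hypothesis (CH), and let $n\ge 1$. Let $$K_n=\{(\mathbb{R},<,Q_1,\ldots,Q_n): Q_1,\dots,Q_n\subseteq \mathbb{R}\}.$$ The monadic theory of $K_n$, where the set quantifiers range over countable subsets of $\mathbb{R}$, is undecidable. Moreover, the same is true when the set quantifiers range only over sets of rationals.
   Context: Monadic logic is first-order logic augmented by set variables and quantification over them; ordinarily these range over all subsets of the universe, but here they are restricted to the indicated family of subsets. The language of $K_n$ consists of $<$ and $n$ one-place predicates. The monadic theory of a class $K$ of structures is the set of all monadic sentences true (under the indicated interpretation of the set quantifiers) in every member of $K$. -}

module Defs where

open import Data.Bool using (Bool; T)
open import Data.Fin using (Fin; toℕ)
open import Data.Nat as ℕ using (ℕ; zero; suc)
open import Data.Product using (_×_; _,_; ∃)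
open import Data.Rational as ℚ using (ℚ; 1ℚ)
import Data.Rational.Properties as ℚ
open import Data.Sum using (_⊎_)
open import Data.Vec using (Vec; []; _∷_; lookup)
open import Function.Bundles using (_↣_; _⤖_)
open import Relation.Binary.PropositionalEquality using (_≡_; refl; subst)
open import Relation.Nullary using (¬_)
open import Relation.Nullary.Decidable using (⌊_⌋; toWitness; fromWitness)

-- Classical mathematics is expressed by assuming ExcludedMiddle and Extensionality (both at
-- level 0).  Under these every predicate on A : Set is the truth set of a
-- unique Boolean function, so that Subset A is the full power set of A and
-- _≡_ on it is extensional equality.  Since ExcludedMiddle yields an actual
-- Dec, it also selects an element of every nonempty A : Set; with the
-- extensionality of subsets this gives the usual axiom of choice.

Subset : Set → Set
Subset A = A → Bool

infix 4 _∈_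
_∈_ : ∀ {A} → A → Subset A → Set
x ∈ X = T (X x)

Element : ∀ {A} → Subset A → Set
Element X = ∃ λ x → x ∈ X

-- Finite subsets, including the empty one, count as countable.
Countable : ∀ {A} → Subset A → Set
Countable X = Element X ↣ ℕ

-- Reals are the lower halves of Dedekind cuts without a largest element.  The
-- proofs are irrelevant, so reals are equal as soon as their cuts are; they
-- can be recovered where needed by recompute, given ExcludedMiddle.
record ℝ : Set where
  constructor mkℝ
  field
    lower      : Subset ℚ
    .inhabited : ∃ λ q → q ∈ lower
    .bounded   : ∃ λ q → ¬ q ∈ lower
    .downward  : ∀ {p q} → p ℚ.< q → q ∈ lower → p ∈ lower
    .rounded   : ∀ {p} → p ∈ lower → ∃ λ q → p ℚ.< q × q ∈ lower

open ℝ public using (lower)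

infix 4 _<ᴿ_
_<ᴿ_ : ℝ → ℝ → Set
x <ᴿ y = ∃ λ q → (¬ q ∈ lower x) × q ∈ lower y

fromℚ : ℚ → ℝ
fromℚ r = mkℝ (λ q → ⌊ q ℚ.<? r ⌋)
  (r ℚ.- 1ℚ , fromWitness r-1<r)
  (r , λ r<r → ℚ.<-irrefl refl (toWitness {a? = r ℚ.<? r} r<r))
  (λ {p} {q} p<q q<r →
    fromWitness (ℚ.<-trans p<q (toWitness {a? = q ℚ.<? r} q<r)))
  (λ {p} p<r → let m , p<m , m<r = ℚ.<-dense (toWitness {a? = p ℚ.<? r} p<r)
               in m , p<m , fromWitness m<r)
  where
  r-1<r : r ℚ.- 1ℚ ℚ.< r
  r-1<r = subst (r ℚ.- 1ℚ ℚ.<_) (ℚ.+-identityʳ r)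
            (ℚ.+-monoʳ-< r (ℚ.negative⁻¹ (ℚ.- 1ℚ)))

OfRationals : Subset ℝ → Set
OfRationals X = ∀ x → x ∈ X → ∃ λ q → x ≡ fromℚ q

ContinuumHypothesis : Set
ContinuumHypothesis = ∀ (X : Subset ℝ) → Countable X ⊎ (Element X ⤖ ℝ)

-- Monadic formulas over < and n one-place predicates, with e free element
-- variables and s free set variables (de Bruijn indices, counted separately
-- for the two sorts).  The remaining connectives and the universal
-- quantifiers are the usual classical abbreviations.
data Formula (n e s : ℕ) : Set where
  less  : Fin e → Fin e → Formula n e s
  equal : Fin e → Fin e → Formula n e s
  pred  : Fin n → Fin e → Formula n e s
  mem   : Fin e → Fin s → Formula n e s
  neg   : Formula n e s → Formula n e s
  and   : Formula n e s → Formula n e s → Formula n e s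
  exEl  : Formula n (suc e) s → Formula n e s
  exSet : Formula n e (suc s) → Formula n e s

Sentence : ℕ → Set
Sentence n = Formula n 0 0

record Structure (n : ℕ) : Set₁ where
  field
    Carrier : Set
    _<_     : Carrier → Carrier → Set
    Q       : Fin n → Subset Carrier

-- Satisfaction when the set quantifiers range over the subsets in 𝓕.
module Satisfaction {n} (M : Structure n)
                    (𝓕 : Subset (Structure.Carrier M) → Set) where
  open Structure M

  Sat : ∀ {e s} → Vec Carrier e → Vec (Subset Carrier) s → Formula n e s → Set
  Sat ρ σ (less i j)  = lookup ρ i < lookup ρ j
  Sat ρ σ (equal i j) = lookup ρ i ≡ lookup ρ j
  Sat ρ σ (pred k i)  = lookup ρ i ∈ Q k
  Sat ρ σ (mem i j)   = lookup ρ i ∈ lookup σ j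
  Sat ρ σ (neg φ)     = ¬ Sat ρ σ φ
  Sat ρ σ (and φ ψ)   = Sat ρ σ φ × Sat ρ σ ψ
  Sat ρ σ (exEl φ)    = ∃ λ a → Sat (a ∷ ρ) σ φ
  Sat ρ σ (exSet φ)   = ∃ λ X → 𝓕 X × Sat ρ (X ∷ σ) φ

  True : Sentence n → Set
  True = Sat [] []

-- The class Kₙ, indexed by the interpretations of the predicates.
K : ∀ n → (Fin n → Subset ℝ) → Structure n
K n Q = record { Carrier = ℝ ; _<_ = _<ᴿ_ ; Q = Q }

MonadicTheory : ∀ n → (Subset ℝ → Set) → Sentence n → Set
MonadicTheory n 𝓕 φ = ∀ Q → Satisfaction.True (K n Q) 𝓕 φ

-- Partial recursive functions of a given arity.
data Rec : ℕ → Set where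
  zeroᴿ : Rec 0
  sucᴿ  : Rec 1
  proj  : ∀ {k} → Fin k → Rec k
  comp  : ∀ {k m} → Rec m → Vec (Rec k) m → Rec k
  prim  : ∀ {k} → Rec k → Rec (suc (suc k)) → Rec (suc k)
  mu    : ∀ {k} → Rec (suc k) → Rec k

-- f [ xs ]⇓ y : the computation of f on xs halts with value y.
infix 4 _[_]⇓_
data _[_]⇓_ : ∀ {k} → Rec k → Vec ℕ k → ℕ → Set where
  zero⇓ : zeroᴿ [ [] ]⇓ 0
  suc⇓  : ∀ {x} → sucᴿ [ x ∷ [] ]⇓ suc x
  proj⇓ : ∀ {k} {i : Fin k} {xs} → proj i [ xs ]⇓ lookup xs i
  comp⇓ : ∀ {k m} {f : Rec m} {gs : Vec (Rec k) m} {xs y} (ys : Vec ℕ m) →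
          (∀ i → lookup gs i [ xs ]⇓ lookup ys i) →
          f [ ys ]⇓ y → comp f gs [ xs ]⇓ y
  prim⇓-zero : ∀ {k} {f : Rec k} {g xs y} →
               f [ xs ]⇓ y → prim f g [ 0 ∷ xs ]⇓ y
  prim⇓-suc  : ∀ {k} {f : Rec k} {g xs m y z} →
               prim f g [ m ∷ xs ]⇓ y → g [ m ∷ y ∷ xs ]⇓ z →
               prim f g [ suc m ∷ xs ]⇓ z
  mu⇓ : ∀ {k} {f : Rec (suc k)} {xs y} →
        f [ y ∷ xs ]⇓ 0 →
        (∀ z → z ℕ.< y → ∃ λ v → f [ z ∷ xs ]⇓ suc v) →
        mu f [ xs ]⇓ y

triangle : ℕ → ℕ
triangle zero    = 0
triangle (suc n) = suc n ℕ.+ triangle n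

-- Cantor's bijection ℕ × ℕ → ℕ.
pair : ℕ → ℕ → ℕ
pair a b = triangle (a ℕ.+ b) ℕ.+ b

-- Gödel numbers; injective for fixed n, e, s.
code : ∀ {n e s} → Formula n e s → ℕ
code (less i j)  = pair 0 (pair (toℕ i) (toℕ j))
code (equal i j) = pair 1 (pair (toℕ i) (toℕ j))
code (pred k i)  = pair 2 (pair (toℕ k) (toℕ i))
code (mem i j)   = pair 3 (pair (toℕ i) (toℕ j))
code (neg φ)     = pair 4 (code φ)
code (and φ ψ)   = pair 5 (pair (code φ) (code ψ))
code (exEl φ)    = pair 6 (code φ)
code (exSet φ)   = pair 7 (code φ)

-- Only the values on codes of sentences matter: the set of these codes is
-- itself recursive.
Decidable : ∀ {n} → (Sentence n → Set) → Set
Decidable Th = ∃ λ (f : Rec 1) → ∀ φ →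
  (Th φ → f [ code φ ∷ [] ]⇓ 1) × (¬ Th φ → f [ code φ ∷ [] ]⇓ 0)

Undecidable : ∀ {n} → (Sentence n → Set) → Set
Undecidable Th = ¬ Decidable Th

{-# OPTIONS --safe #-}
module Submission where

-- The set quantifiers see a set Q of irrationals through its behaviour on sets of
-- rationals: for A₁, …, A₄ ⊆ ℚ one can say that every interval I contains a nonempty
-- Y ⊆ I in which all Aⱼ are dense and whose closure misses Q.  Colour ℚ with countably
-- many colours, all dense, and call certain sets of at most four colours facets.  Under
-- CH a recursion of length ω₁ over all subsets of ℚ yields a Q such that such Y exist
-- whenever the Aⱼ use the colours of one facet only, whereas the closure of a set
-- without isolated points that nowhere keeps to one facet meets Q (by Baire category,
-- its closure is not covered by countably many closures promised to miss Q).  Taking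
-- for the facets the instances of a relation on trees, Q codes this relation.
--
-- A tree is represented by the set of its colour, and a definable class of sets
-- represents trees locally: any member of the class agrees, on a dense set of intervals,
-- with the set of one tree.  Hence first-order truth in the structure of trees is
-- expressed by a forcing relation whose conditions are intervals.  The trees carry a
-- predicate, given by a logic program, for the evaluation of recursive functions.
-- A finite theory τ (totality and congruence of the tree constructors, and the clauses
-- of the program) holds in this structure, and in every model in which τ is forced,
-- derivable facts are forced.  So "τ forces that g halts on m with value 0"
-- belongs to the monadic theory iff this is so, and diagonalising against a decision
-- procedure yields a contradiction.

open import Defs
open import Axiom.ExcludedMiddle using (ExcludedMiddle)
open import Axiom.Extensionality.Propositional using (Extensionality)
open import Data.Bool using (Bool; true; false; T)
import Data.Bool.Properties as Bool
open import Data.Empty using (⊥; ⊥-elim)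
open import Data.Fin as Fin using (Fin; zero; suc; toℕ; _↑ˡ_; _↑ʳ_)
import Data.Fin.Properties as Fin
open import Data.Fin.Patterns using (0F; 1F; 2F; 3F; 4F; 5F; 6F; 7F; 8F; 9F)
open import Data.Integer as ℤ using (ℤ)
open import Data.List using (List; []; _∷_)
import Data.List
open import Data.List.Membership.Propositional using () renaming (_∈_ to _∈ᴸ_)
open import Data.List.Relation.Unary.All as All using (All; []; _∷_)
open import Data.List.Relation.Unary.Any using (here; there)
open import Data.Maybe using (Maybe; just; nothing)
open import Data.Maybe.Properties using (just-injective)
open import Data.Nat as ℕ using (ℕ; zero; suc; _≤_; s≤s; z≤n)
import Data.Nat.Properties as ℕ
open import Data.Product using (_×_; _,_; proj₁; proj₂; ∃; ∃₂)
open import Data.Rational as ℚ using (ℚ; mkℚ; 0ℚ; 1ℚ)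
import Data.Rational.Properties as ℚ
open import Data.Sum as Sum using (_⊎_; inj₁; inj₂; [_,_])
open import Data.Unit using (⊤; tt)
open import Data.Vec as Vec using (Vec; []; _∷_; lookup; _++_)
import Data.Vec.Properties as Vec
open import Function using (_∘_; id; case_of_)
open import Function.Bundles using (Injection; _↣_; Bijection)
open import Induction.WellFounded using (WellFounded; Acc; acc; module FixPoint; module All)
open import Level using (0ℓ)
open import Relation.Binary.Definitions using (tri<; tri≈; tri>)
open import Relation.Binary.PropositionalEquality using (_≡_; _≢_; refl; sym; trans; cong; cong₂; subst; subst₂)
open import Relation.Nullary using (¬_; yes; no; contradiction)
open import Relation.Nullary.Decidable using (⌊_⌋; toWitness; fromWitness; decidable-stable; recompute)

-- Trees, logic programs and the language of trees

-- A facet is a set of colours and carries no order; hence a tree has a separate colour for each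
-- argument place. The fourth colour of a facet tells which relation is meant, so four sets Aⱼ
-- suffice.
--
-- CH enters through the countability of initial segments: a stage of the recursion has to respect
-- only countably many earlier points and promises, which finite approximation and a category
-- argument can do.
--
-- The obstacle is that a set of rationals may mix colours of many trees. A set in which every
-- colour is nowhere dense can be split into two dense parts with no colour in common; names are
-- defined so as to exclude such pairs. What is left determines one tree, but only on a dense set of
-- intervals, and this is why truth has to be replaced by forcing.
--
-- τ says only that derivations preserve truth. An underivable fact needs just one structure in
-- which it fails, and the one built from CH serves, so τ does not have to characterise the trees.
-- Both assertions are instances of one statement about any family 𝓕 that contains all sets of
-- rationals.

data Tree : Set where
  leaf : Tree
  node : Tree → Tree → Tree

Sort Tag : Set
Sort = Fin 3
Tag  = Fin 4

pattern eqᵗ   = 0F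
pattern leafᵗ = 1F
pattern nodeᵗ = 2F
pattern holds = 3F

-- Atoms are uniformly ternary, so that one kind of facet, with three argument places and a tag,
-- codes them all. Relations of smaller arity repeat an argument.
data L (k : ℕ) : Set where
  rel     : Tag → Fin k → Fin k → Fin k → L k
  _&_ _⇒_ : L k → L k → L k
  all ex  : L (suc k) → L k

infixr 6 _&_
infixr 5 _⇒_

module Trees (Holds : Tree → Set) where

  Rel : Tag → Tree → Tree → Tree → Set
  Rel eqᵗ   i j k = i ≡ j × j ≡ k
  Rel leafᵗ i j k = i ≡ leaf
  Rel nodeᵗ i j k = k ≡ node i j
  Rel holds i j k = Holds i

  Models : ∀ {k} → Vec Tree k → L k → Set
  Models os (rel t x y z) = Rel t (lookup os x) (lookup os y) (lookup os z)
  Models os (φ & ψ)       = Models os φ × Models os ψ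
  Models os (φ ⇒ ψ)       = Models os φ → Models os ψ
  Models os (all φ)       = ∀ o → Models (o ∷ os) φ
  Models os (ex φ)        = ∃ λ o → Models (o ∷ os) φ

data Pattern (k : ℕ) : Set where
  var   : Fin k → Pattern k
  leafᵖ : Pattern k
  nodeᵖ : Pattern k → Pattern k → Pattern k

inst : ∀ {k} → Vec Tree k → Pattern k → Tree
inst os (var i)     = lookup os i
inst os leafᵖ       = leaf
inst os (nodeᵖ p q) = node (inst os p) (inst os q)

embed : ∀ {k} → Tree → Pattern k
embed leaf       = leafᵖ
embed (node s t) = nodeᵖ (embed s) (embed t)

inst-embed : ∀ {k} (os : Vec Tree k) t → inst os (embed t) ≡ t
inst-embed os leaf       = refl
inst-embed os (node s t) = cong₂ node (inst-embed os s) (inst-embed os t)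

record Rule : Set where
  field
    {vars}     : ℕ
    premises   : List (Pattern vars)
    conclusion : Pattern vars

open Rule

data Derivable {n} (program : Vec Rule n) : Tree → Set where
  derive : ∀ i (os : Vec Tree (vars (lookup program i))) →
           All (Derivable program ∘ inst os) (premises (lookup program i)) →
           Derivable program (inst os (conclusion (lookup program i)))

eqᴸ : ∀ {k} → Fin k → Fin k → L k
eqᴸ x y = rel eqᵗ x y y

leafᴸ holdsᴸ : ∀ {k} → Fin k → L k
leafᴸ x  = rel leafᵗ x x x
holdsᴸ x = rel holds x x x

-- The language has relations but no function symbols, so a compound pattern is unnested: its parts
-- are introduced by quantifiers.
match : ∀ {k m} → (Fin k → Fin m) → Pattern k → Fin m → L m
match ν (var i)     z = eqᴸ (ν i) z
match ν leafᵖ       z = leafᴸ z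
match ν (nodeᵖ p q) z = ex (ex (match (λ i → suc (suc (ν i))) p 1F & match (λ i → suc (suc (ν i))) q 0F &
                                rel nodeᵗ 1F 0F (suc (suc z))))

instance-holds : ∀ {k m} → (Fin k → Fin m) → Pattern k → L m
instance-holds ν p = ex (match (λ i → suc (ν i)) p 0F & holdsᴸ 0F)

closeAll : ∀ k → L k → L 0
closeAll zero    φ = φ
closeAll (suc k) φ = closeAll k (all φ)

infixr 5 _⇒*_
_⇒*_ : ∀ {m} → List (L m) → L m → L m
[]       ⇒* ψ = ψ
(φ ∷ φs) ⇒* ψ = φ ⇒ (φs ⇒* ψ)

-- The conclusion is a hypothesis on a variable instead of an object asserted to exist. The rule
-- thus applies to every set that denotes the conclusion, which does the work of a congruence axiom
-- for `holds`.
ruleᴸ : Rule → L 0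
ruleᴸ r = closeAll (suc (vars r)) (match suc (conclusion r) 0F ⇒
            (Data.List.map (instance-holds suc) (premises r) ⇒* holdsᴸ 0F))

-- By induction on a tree, these four give existence and uniqueness, up to `eqᵗ`, of what denotes
-- it.
leaf-total node-total leaf-unique node-congruent : L 0
leaf-total     = closeAll 0 (ex (leafᴸ 0F))
node-total     = closeAll 2 (ex (rel nodeᵗ 2F 1F 0F))
leaf-unique    = closeAll 2 (leafᴸ 1F & leafᴸ 0F ⇒ eqᴸ 1F 0F)
node-congruent = closeAll 6 (rel nodeᵗ 5F 4F 3F & rel nodeᵗ 2F 1F 0F & eqᴸ 5F 2F & eqᴸ 4F 1F ⇒
                             eqᴸ 3F 0F)

rulesᴸ : ∀ {n} → Vec Rule n → L 0
-- `L` has no constant for truth; an axiom already present in `theory` takes its place.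
rulesᴸ []       = leaf-total
rulesᴸ (r ∷ rs) = ruleᴸ r & rulesᴸ rs

theory : ∀ {n} → Vec Rule n → L 0
theory program = leaf-total & node-total & leaf-unique & node-congruent & rulesᴸ program

-- Evaluation of recursive functions as a logic program

vec-ext : ∀ {A : Set} {k} (xs ys : Vec A k) → (∀ i → lookup xs i ≡ lookup ys i) → xs ≡ ys
vec-ext []       []       _  = refl
vec-ext (x ∷ xs) (y ∷ ys) eq = cong₂ _∷_ (eq zero) (vec-ext xs ys (λ i → eq (suc i)))

numᵗ : ℕ → Tree
numᵗ zero    = leaf
numᵗ (suc n) = node leaf (numᵗ n)

vecᵗ : ∀ {k} → Vec ℕ k → Tree
vecᵗ []       = leaf
vecᵗ (x ∷ xs) = node (numᵗ x) (vecᵗ xs)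

-- The operation codes are 0 to 5 for the constructors of `Rec`, 6 and 7 for lists of functions, and
-- 8 for the auxiliary search.
opᵗ : ℕ → Tree → Tree → Tree
opᵗ n s t = node (numᵗ n) (node s t)

mutual
  recᵗ : ∀ {k} → Rec k → Tree
  recᵗ zeroᴿ       = opᵗ 0 leaf leaf
  recᵗ sucᴿ        = opᵗ 1 leaf leaf
  recᵗ (proj i)    = opᵗ 2 (numᵗ (toℕ i)) leaf
  recᵗ (comp f gs) = opᵗ 3 (recᵗ f) (recsᵗ gs)
  recᵗ (prim f g)  = opᵗ 4 (recᵗ f) (recᵗ g)
  recᵗ (mu f)      = opᵗ 5 (recᵗ f) leaf

  recsᵗ : ∀ {k m} → Vec (Rec k) m → Tree
  recsᵗ []       = opᵗ 6 leaf leaf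
  recsᵗ (g ∷ gs) = opᵗ 7 (recᵗ g) (recsᵗ gs)

searchᵗ : Tree → Tree
searchᵗ f = opᵗ 8 f leaf

-- On the input z ∷ xs, the program searchᵗ f returns the least y ≥ z with
-- f (y ∷ xs) ≡ 0.
data Ev : Tree → Tree → Tree → Set where
  ev-zero    : ∀ {x} → Ev (opᵗ 0 leaf leaf) x leaf
  ev-suc     : ∀ {x} → Ev (opᵗ 1 leaf leaf) (node x leaf) (node leaf x)
  ev-proj₀   : ∀ {x xs} → Ev (opᵗ 2 leaf leaf) (node x xs) x
  ev-projₛ   : ∀ {i x xs y} → Ev (opᵗ 2 i leaf) xs y → Ev (opᵗ 2 (node leaf i) leaf) (node x xs) y
  ev-comp    : ∀ {f gs xs ys y} → Ev gs xs ys → Ev f ys y → Ev (opᵗ 3 f gs) xs y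
  ev-prim₀   : ∀ {f g xs y} → Ev f xs y → Ev (opᵗ 4 f g) (node leaf xs) y
  ev-primₛ   : ∀ {f g m xs y z} → Ev (opᵗ 4 f g) (node m xs) y → Ev g (node m (node y xs)) z →
               Ev (opᵗ 4 f g) (node (node leaf m) xs) z
  ev-mu      : ∀ {f xs y} → Ev (searchᵗ f) (node leaf xs) y → Ev (opᵗ 5 f leaf) xs y
  ev-nil     : ∀ {xs} → Ev (opᵗ 6 leaf leaf) xs leaf
  ev-cons    : ∀ {g gs xs y ys} → Ev g xs y → Ev gs xs ys → Ev (opᵗ 7 g gs) xs (node y ys)
  ev-found   : ∀ {f z xs} → Ev f (node z xs) leaf → Ev (searchᵗ f) (node z xs) z
  ev-search  : ∀ {f z xs v y} → Ev f (node z xs) (node leaf v) → Ev (searchᵗ f) (node (node leaf z) xs) y →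
               Ev (searchᵗ f) (node z xs) y

mutual
  -- The output z is an arbitrary tree, because about the intermediate outputs in a derivation
  -- nothing is known until the induction shows them to be numerals.
  ev-sound : ∀ {k} (f : Rec k) xs {z} → Ev (recᵗ f) (vecᵗ xs) z → ∃ λ y → z ≡ numᵗ y × f [ xs ]⇓ y
  ev-sound zeroᴿ [] ev-zero = 0 , refl , zero⇓
  ev-sound sucᴿ (x ∷ []) ev-suc = suc x , refl , suc⇓
  ev-sound (proj i) xs e = lookup xs i , ev-proj-sound i xs e , proj⇓
  ev-sound (comp f gs) xs (ev-comp e e′) with evs-sound gs xs e
  ... | ys , refl , ds with ev-sound f ys e′
  ... | y , eq , d = y , eq , comp⇓ ys ds d
  ev-sound (prim f g) (zero ∷ xs) (ev-prim₀ e) =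
    let y , eq , d = ev-sound f xs e in y , eq , prim⇓-zero d
  ev-sound (prim f g) (suc m ∷ xs) (ev-primₛ e e′) with ev-sound (prim f g) (m ∷ xs) e
  ... | y , refl , d with ev-sound g (m ∷ y ∷ xs) e′
  ... | z , eq , d′ = z , eq , prim⇓-suc d d′
  ev-sound (mu f) xs (ev-mu e) =
    let y , eq , _ , d , below = ev-search-sound f 0 xs e in y , eq , mu⇓ d (λ z → below z z≤n)

  ev-proj-sound : ∀ {k} (i : Fin k) xs {z} → Ev (opᵗ 2 (numᵗ (toℕ i)) leaf) (vecᵗ xs) z →
                  z ≡ numᵗ (lookup xs i)
  ev-proj-sound zero    (x ∷ xs) ev-proj₀     = refl
  ev-proj-sound (suc i) (x ∷ xs) (ev-projₛ e) = ev-proj-sound i xs e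

  evs-sound : ∀ {k m} (gs : Vec (Rec k) m) xs {z} → Ev (recsᵗ gs) (vecᵗ xs) z →
              ∃ λ ys → z ≡ vecᵗ ys × (∀ i → lookup gs i [ xs ]⇓ lookup ys i)
  evs-sound []       xs ev-nil         = [] , refl , λ ()
  evs-sound (g ∷ gs) xs (ev-cons e es) with ev-sound g xs e | evs-sound gs xs es
  ... | y , refl , d | ys , refl , ds = y ∷ ys , refl , λ { zero → d ; (suc i) → ds i }

  -- The starting point n is general because each unsuccessful trial raises it; `mu` uses n = 0.
  ev-search-sound : ∀ {k} (f : Rec (suc k)) n xs {z} → Ev (searchᵗ (recᵗ f)) (node (numᵗ n) (vecᵗ xs)) z →
    ∃ λ y → z ≡ numᵗ y × n ≤ y × f [ y ∷ xs ]⇓ 0 ×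
            (∀ m → n ≤ m → m ℕ.< y → ∃ λ v → f [ m ∷ xs ]⇓ suc v)
  ev-search-sound f n xs (ev-found e) with ev-sound f (n ∷ xs) e
  ... | zero , refl , d = n , refl , ℕ.≤-refl , d , λ m n≤m m<n → contradiction n≤m (ℕ.<⇒≱ m<n)
  ev-search-sound f n xs (ev-search e e′) with ev-sound f (n ∷ xs) e | ev-search-sound f (suc n) xs e′
  ... | suc v , refl , d | y , eq , n<y , d′ , below = y , eq , ℕ.<⇒≤ n<y , d′ , λ m n≤m m<y →
    case ℕ.m≤n⇒m<n∨m≡n n≤m of λ where
      (inj₁ n<m)  → below m n<m m<y
      (inj₂ refl) → v , d

judgement : Tree → Tree → Tree → Tree
judgement p x y = node p (node x y)

numᵖ : ∀ {k} → ℕ → Pattern k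
numᵖ zero    = leafᵖ
numᵖ (suc n) = nodeᵖ leafᵖ (numᵖ n)

opᵖ : ∀ {k} → ℕ → Pattern k → Pattern k → Pattern k
opᵖ n p q = nodeᵖ (numᵖ n) (nodeᵖ p q)

judgementᵖ : ∀ {k} → Pattern k → Pattern k → Pattern k → Pattern k
judgementᵖ p x y = nodeᵖ p (nodeᵖ x y)

-- These are the constructors of `Ev`, in the same order, turned into data so that a formula can
-- state them.
evaluation : Vec Rule 12
evaluation =
  record { vars = 1 ; premises = [] ; conclusion = judgementᵖ (opᵖ 0 leafᵖ leafᵖ) (var 0F) leafᵖ } ∷
  record { vars = 1 ; premises = []
         ; conclusion = judgementᵖ (opᵖ 1 leafᵖ leafᵖ) (nodeᵖ (var 0F) leafᵖ) (nodeᵖ leafᵖ (var 0F)) } ∷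
  record { vars = 2 ; premises = []
         ; conclusion = judgementᵖ (opᵖ 2 leafᵖ leafᵖ) (nodeᵖ (var 0F) (var 1F)) (var 0F) } ∷
  record { vars = 4 ; premises = judgementᵖ (opᵖ 2 (var 0F) leafᵖ) (var 2F) (var 3F) ∷ []
         ; conclusion = judgementᵖ (opᵖ 2 (nodeᵖ leafᵖ (var 0F)) leafᵖ) (nodeᵖ (var 1F) (var 2F)) (var 3F) } ∷
  record { vars = 5
         ; premises = judgementᵖ (var 1F) (var 2F) (var 3F) ∷ judgementᵖ (var 0F) (var 3F) (var 4F) ∷ []
         ; conclusion = judgementᵖ (opᵖ 3 (var 0F) (var 1F)) (var 2F) (var 4F) } ∷
  record { vars = 4 ; premises = judgementᵖ (var 0F) (var 2F) (var 3F) ∷ []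
         ; conclusion = judgementᵖ (opᵖ 4 (var 0F) (var 1F)) (nodeᵖ leafᵖ (var 2F)) (var 3F) } ∷
  record { vars = 6
         ; premises = judgementᵖ (opᵖ 4 (var 0F) (var 1F)) (nodeᵖ (var 2F) (var 3F)) (var 4F) ∷
                      judgementᵖ (var 1F) (nodeᵖ (var 2F) (nodeᵖ (var 4F) (var 3F))) (var 5F) ∷ []
         ; conclusion = judgementᵖ (opᵖ 4 (var 0F) (var 1F)) (nodeᵖ (nodeᵖ leafᵖ (var 2F)) (var 3F)) (var 5F) } ∷
  record { vars = 3 ; premises = judgementᵖ (opᵖ 8 (var 0F) leafᵖ) (nodeᵖ leafᵖ (var 1F)) (var 2F) ∷ []
         ; conclusion = judgementᵖ (opᵖ 5 (var 0F) leafᵖ) (var 1F) (var 2F) } ∷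
  record { vars = 1 ; premises = [] ; conclusion = judgementᵖ (opᵖ 6 leafᵖ leafᵖ) (var 0F) leafᵖ } ∷
  record { vars = 5
         ; premises = judgementᵖ (var 0F) (var 2F) (var 3F) ∷ judgementᵖ (var 1F) (var 2F) (var 4F) ∷ []
         ; conclusion = judgementᵖ (opᵖ 7 (var 0F) (var 1F)) (var 2F) (nodeᵖ (var 3F) (var 4F)) } ∷
  record { vars = 3 ; premises = judgementᵖ (var 0F) (nodeᵖ (var 1F) (var 2F)) leafᵖ ∷ []
         ; conclusion = judgementᵖ (opᵖ 8 (var 0F) leafᵖ) (nodeᵖ (var 1F) (var 2F)) (var 1F) } ∷
  record { vars = 5
         ; premises = judgementᵖ (var 0F) (nodeᵖ (var 1F) (var 2F)) (nodeᵖ leafᵖ (var 3F)) ∷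
                      judgementᵖ (opᵖ 8 (var 0F) leafᵖ) (nodeᵖ (nodeᵖ leafᵖ (var 1F)) (var 2F)) (var 4F) ∷ []
         ; conclusion = judgementᵖ (opᵖ 8 (var 0F) leafᵖ) (nodeᵖ (var 1F) (var 2F)) (var 4F) } ∷ []

-- Every conclusion of a rule has the form `judgement p x y`; on other trees the invariant is made
-- vacuous.
Valid : Tree → Set
Valid (node p (node x y)) = Ev p x y
Valid _                   = ⊤

pattern 10F = suc 9F
pattern 11F = suc 10F

mutual
  derivable-valid : ∀ {t} → Derivable evaluation t → Valid t
  derivable-valid (derive i os ds) = rule-valid i os (derivables-valid ds)

  derivables-valid : ∀ {k} {os : Vec Tree k} {ps} → All (Derivable evaluation ∘ inst os) ps → All (Valid ∘ inst os) ps
  derivables-valid []       = []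
  derivables-valid (d ∷ ds) = derivable-valid d ∷ derivables-valid ds

  rule-valid : ∀ i os → All (Valid ∘ inst os) (premises (lookup evaluation i)) →
               Valid (inst os (conclusion (lookup evaluation i)))
  rule-valid 0F  (_ ∷ [])                     []              = ev-zero
  rule-valid 1F  (_ ∷ [])                     []              = ev-suc
  rule-valid 2F  (_ ∷ _ ∷ [])                 []              = ev-proj₀
  rule-valid 3F  (_ ∷ _ ∷ _ ∷ _ ∷ [])         (d ∷ [])        = ev-projₛ d
  rule-valid 4F  (_ ∷ _ ∷ _ ∷ _ ∷ _ ∷ [])     (d ∷ d′ ∷ [])   = ev-comp d d′
  rule-valid 5F  (_ ∷ _ ∷ _ ∷ _ ∷ [])         (d ∷ [])        = ev-prim₀ d
  rule-valid 6F  (_ ∷ _ ∷ _ ∷ _ ∷ _ ∷ _ ∷ []) (d ∷ d′ ∷ [])   = ev-primₛ d d′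
  rule-valid 7F  (_ ∷ _ ∷ _ ∷ [])             (d ∷ [])        = ev-mu d
  rule-valid 8F  (_ ∷ [])                     []              = ev-nil
  rule-valid 9F  (_ ∷ _ ∷ _ ∷ _ ∷ _ ∷ [])     (d ∷ d′ ∷ [])   = ev-cons d d′
  rule-valid 10F (_ ∷ _ ∷ _ ∷ [])             (d ∷ [])        = ev-found d
  rule-valid 11F (_ ∷ _ ∷ _ ∷ _ ∷ _ ∷ [])     (d ∷ d′ ∷ [])   = ev-search d d′

Derivableᴱ : Tree → Tree → Tree → Set
Derivableᴱ p x y = Derivable evaluation (judgement p x y)

proj-derivable : ∀ {k} (i : Fin k) xs → Derivableᴱ (opᵗ 2 (numᵗ (toℕ i)) leaf) (vecᵗ xs) (numᵗ (lookup xs i))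
proj-derivable zero    (x ∷ xs) = derive 2F (numᵗ x ∷ vecᵗ xs ∷ []) []
proj-derivable (suc i) (x ∷ xs) =
  derive 3F (numᵗ (toℕ i) ∷ numᵗ x ∷ vecᵗ xs ∷ numᵗ (lookup xs i) ∷ []) (proj-derivable i xs ∷ [])

recs-derivable : ∀ {k m} (gs : Vec (Rec k) m) {xs : Vec ℕ k} ys →
                 (∀ i → Derivableᴱ (recᵗ (lookup gs i)) (vecᵗ xs) (numᵗ (lookup ys i))) →
                 Derivableᴱ (recsᵗ gs) (vecᵗ xs) (vecᵗ ys)
recs-derivable []       {xs} []       ds = derive 8F (vecᵗ xs ∷ []) []
recs-derivable (g ∷ gs) {xs} (y ∷ ys) ds =
  derive 9F (recᵗ g ∷ recsᵗ gs ∷ vecᵗ xs ∷ numᵗ y ∷ vecᵗ ys ∷ [])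
    (ds zero ∷ recs-derivable gs ys (λ i → ds (suc i)) ∷ [])

⇓-derivable : ∀ {k} {f : Rec k} {xs y} → f [ xs ]⇓ y → Derivableᴱ (recᵗ f) (vecᵗ xs) (numᵗ y)
⇓-derivable zero⇓ = derive 0F (leaf ∷ []) []
⇓-derivable (suc⇓ {x}) = derive 1F (numᵗ x ∷ []) []
⇓-derivable (proj⇓ {i = i} {xs}) = proj-derivable i xs
⇓-derivable (comp⇓ {f = f} {gs} {xs} {y} ys ds d) =
  derive 4F (recᵗ f ∷ recsᵗ gs ∷ vecᵗ xs ∷ vecᵗ ys ∷ numᵗ y ∷ [])
    (recs-derivable gs ys (λ i → ⇓-derivable (ds i)) ∷ ⇓-derivable d ∷ [])
⇓-derivable (prim⇓-zero {f = f} {g} {xs} {y} d) =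
  derive 5F (recᵗ f ∷ recᵗ g ∷ vecᵗ xs ∷ numᵗ y ∷ []) (⇓-derivable d ∷ [])
⇓-derivable (prim⇓-suc {f = f} {g} {xs} {m} {y} {z} d d′) =
  derive 6F (recᵗ f ∷ recᵗ g ∷ numᵗ m ∷ vecᵗ xs ∷ numᵗ y ∷ numᵗ z ∷ [])
    (⇓-derivable d ∷ ⇓-derivable d′ ∷ [])
⇓-derivable (mu⇓ {f = f} {xs} {y} d below) =
  derive 7F (recᵗ f ∷ vecᵗ xs ∷ numᵗ y ∷ []) (search y 0 (ℕ.+-identityʳ y) ∷ [])
  where
  -- k is the distance from z to the least zero y: it decreases while z climbs, and gives the
  -- recursion.
  search : ∀ k z → k ℕ.+ z ≡ y → Derivableᴱ (searchᵗ (recᵗ f)) (node (numᵗ z) (vecᵗ xs)) (numᵗ y)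
  search zero z refl = derive 10F (recᵗ f ∷ numᵗ z ∷ vecᵗ xs ∷ []) (⇓-derivable d ∷ [])
  search (suc k) z eq =
    let v , d′ = below z (subst (z ℕ.<_) eq (s≤s (ℕ.m≤n+m z k))) in
    derive 11F (recᵗ f ∷ numᵗ z ∷ vecᵗ xs ∷ numᵗ v ∷ numᵗ y ∷ [])
      (⇓-derivable d′ ∷ search k (suc z) (trans (ℕ.+-suc k z) eq) ∷ [])

⇓-deterministic : ∀ {k} {f : Rec k} {xs y z} → f [ xs ]⇓ y → f [ xs ]⇓ z → y ≡ z
⇓-deterministic zero⇓ zero⇓ = refl
⇓-deterministic suc⇓ suc⇓ = refl
⇓-deterministic proj⇓ proj⇓ = refl
⇓-deterministic (comp⇓ ys ds d) (comp⇓ zs es e)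
  with refl ← vec-ext ys zs (λ i → ⇓-deterministic (ds i) (es i)) = ⇓-deterministic d e
⇓-deterministic (prim⇓-zero d) (prim⇓-zero e) = ⇓-deterministic d e
⇓-deterministic (prim⇓-suc d d′) (prim⇓-suc e e′) with refl ← ⇓-deterministic d e = ⇓-deterministic d′ e′
⇓-deterministic (mu⇓ {y = y} d below) (mu⇓ {y = z} e below′) with ℕ.<-cmp y z
... | tri≈ _ y≡z _ = y≡z
... | tri< y<z _ _ = case ⇓-deterministic d (proj₂ (below′ y y<z)) of λ ()
... | tri> _ _ z<y = case ⇓-deterministic (proj₂ (below z z<y)) e of λ ()

-- Formulas for forcing and the diagonal sentences

module Formulas {n : ℕ} where

  ItvVar : ℕ → Set
  ItvVar e = Fin e × Fin e

  weaken : ∀ {e} k → ItvVar e → ItvVar (k ℕ.+ e)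
  weaken k (a , b) = k ↑ʳ a , k ↑ʳ b

  -- A pair of set variables stands for an intersection: the sets Aⱼ are the traces of names on the
  -- sorts, and these need no set variables of their own.
  TermVar : ℕ → Set
  TermVar s = Fin s × Fin s

  imp : ∀ {e s} → Formula n e s → Formula n e s → Formula n e s
  imp φ ψ = neg (and φ (neg ψ))

  allEl : ∀ {e s} → Formula n (suc e) s → Formula n e s
  allEl φ = neg (exEl (neg φ))

  allSet : ∀ {e s} → Formula n e (suc s) → Formula n e s
  allSet φ = neg (exSet (neg φ))

  exItv allItv : ∀ {e s} → Formula n (2 ℕ.+ e) s → Formula n (2 ℕ.+ e) s → Formula n e s
  exItv  γ φ = exEl (exEl (and γ φ))
  allItv γ φ = neg (exItv γ (neg φ))

  conj : ∀ {e s} k → (Fin (suc k) → Formula n e s) → Formula n e s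
  conj zero    f = f zero
  conj (suc k) f = and (f zero) (conj k (f ∘ suc))

  exSets : ∀ {e s} k → Formula n e (k ℕ.+ s) → Formula n e s
  exSets zero    φ = φ
  exSets (suc k) φ = exSets k (exSet φ)

  within : ∀ {e s} → Fin e → ItvVar e → Formula n e s
  within x (a , b) = and (less a x) (less x b)

  sub : ∀ {e s} → ItvVar e → ItvVar e → Formula n e s
  sub (c , d) (a , b) = and (less a c) (and (less c d) (less d b))

  member : ∀ {e s} → Fin e → TermVar s → Formula n e s
  member x (A , B) = and (mem x A) (mem x B)

  subset : ∀ {e s} → Fin s → Fin s → Formula n e s
  subset A B = allEl (imp (mem 0F A) (mem 0F B))

  -- The seven parameters are the three sorts, followed by the four tags.
  sortIx : Sort → Fin 7
  sortIx s = s ↑ˡ 4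

  tagIx : Tag → Fin 7
  tagIx t = 3 ↑ʳ t

  last : ∀ {e} → ItvVar (2 ℕ.+ e)
  last = 1F , 0F

module GoodFormula {n : ℕ} where

  open Formulas {suc n}

  witnessF : ∀ {e s} → ItvVar e → Fin s → (Fin 4 → TermVar s) → Formula (suc n) e s
  witnessF I Y Z =
    and (exEl (mem 0F Y))
   (and (allEl (imp (mem 0F Y) (and (within 0F (weaken 1 I))
          (allItv (within 2F last) (conj 3 λ j →
            exEl (and (within 0F (weaken 1 last)) (and (mem 0F Y) (member 0F (Z j)))))))))
        (allEl (imp (pred 0F 0F) (exItv (within 2F last)
          (allEl (imp (within 0F (weaken 1 last)) (neg (mem 0F Y))))))))

  goodF : ∀ {e s} → ItvVar e → Vec (TermVar s) 4 → Formula (suc n) e s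
  goodF I Z = allItv (sub last (weaken 2 I)) (exSet (witnessF last 0F λ j →
    let (A , B) = lookup Z j in suc A , suc B))

  denseF : ∀ {e s} → ItvVar e → TermVar s → Formula (suc n) e s
  denseF I Z = allItv (sub last (weaken 2 I)) (exEl (and (within 0F (weaken 1 last)) (member 0F Z)))

  quadF : ∀ {s} → (Fin 7 → Fin s) → Tag → (A B C : Fin s) → Vec (TermVar s) 4
  quadF π t A B C = (A , π (sortIx 0F)) ∷ (B , π (sortIx 1F)) ∷ (C , π (sortIx 2F)) ∷ (π (tagIx t) , π (tagIx t)) ∷ []

  twinsF : ∀ {s} → (B C P : Fin s) → Vec (TermVar s) 4
  twinsF B C P = (B , P) ∷ (B , P) ∷ (C , P) ∷ (C , P) ∷ []

  -- The `eqᵗ` clause of `nameF` also holds of a union of the sets of several trees, since a witness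
  -- may keep to one of them. The present clause excludes this: two parts dense in a common interval
  -- must have colours in a common facet, and a facet contains only one colour of each sort.
  sortMonoF : ∀ {e s} → (Fin 7 → Fin s) → ItvVar e → Fin s → Sort → Formula (suc n) e s
  sortMonoF π I A i = allItv (sub last (weaken 2 I)) (allSet (allSet
    (imp (subset 1F (suc (suc A))) (imp (subset 0F (suc (suc A)))
    (imp (denseF last (1F , P)) (imp (denseF last (0F , P)) (goodF last (twinsF 1F 0F P))))))))
    where P = suc (suc (π (sortIx i)))

  monoF : ∀ {e s} → (Fin 7 → Fin s) → ItvVar e → Fin s → Formula (suc n) e s
  monoF π I A = conj 2 (sortMonoF π I A)

  nameF : ∀ {e s} → (Fin 7 → Fin s) → ItvVar e → Fin s → Formula (suc n) e s
  nameF π I A = and (goodF I (quadF π eqᵗ A A A)) (monoF π I A)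

  extendVar : ∀ {k s} → (Fin k → Fin s) → Fin (suc k) → Fin (suc s)
  extendVar ν zero    = zero
  extendVar ν (suc i) = suc (ν i)

  -- Only `ex` carries an explicit density clause. An atom quantifies over all subintervals in
  -- `goodF` and is therefore settled by a dense set of intervals; the remaining clauses inherit
  -- this.
  forceF : ∀ {e s k} → (Fin 7 → Fin s) → (Fin k → Fin s) → ItvVar e → L k → Formula (suc n) e s
  forceF π ν I (rel t x y z) = goodF I (quadF π t (ν x) (ν y) (ν z))
  forceF π ν I (φ & ψ)       = and (forceF π ν I φ) (forceF π ν I ψ)
  forceF π ν I (φ ⇒ ψ)       = allItv (sub last (weaken 2 I)) (imp (forceF π ν last φ) (forceF π ν last ψ))
  forceF π ν I (all φ)       = allItv (sub last (weaken 2 I)) (allSet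
    (imp (nameF (λ j → suc (π j)) last 0F) (forceF (λ j → suc (π j)) (extendVar ν) last φ)))
  forceF π ν I (ex φ)        = allItv (sub last (weaken 2 I)) (exItv (sub last (weaken 2 last)) (exSet
    (and (nameF (λ j → suc (π j)) last 0F) (forceF (λ j → suc (π j)) (extendVar ν) last φ))))

module SentenceFormula {n : ℕ} where

  open Formulas {suc n}
  open GoodFormula {n}

  paramVars : ∀ {s} → Fin 7 → Fin (8 ℕ.+ s)
  paramVars {s} j = suc (j ↑ˡ s)

  equalSets : ∀ {e s} → Fin s → Fin s → Formula (suc n) e s
  equalSets A B = and (subset A B) (subset B A)

  isZero : ∀ {s} → Formula (suc n) 2 (8 ℕ.+ s)
  isZero = forceF paramVars (λ (_ : Fin 1) → 0F) last (leafᴸ 0F)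

  isSuccessor : ∀ {s} → Formula (suc n) 2 (8 ℕ.+ (8 ℕ.+ s))
  isSuccessor {s} = exSet (and (nameF (λ j → suc (paramVars j)) last 0F)
    (forceF (λ j → suc (paramVars j)) (lookup (0F ∷ 1F ∷ suc (8 ↑ʳ (zero {7 ℕ.+ s})) ∷ [])) last
      (leafᴸ 0F & rel nodeᵗ 0F 1F 2F)))

  -- The eight innermost set variables are the predecessor and the new parameters, the next eight
  -- the number itself and the old parameters.
  step : ∀ {s} → Formula (suc n) 2 (8 ℕ.+ (8 ℕ.+ s))
  step {s} = and (conj 6 λ j → equalSets (suc (j ↑ˡ (8 ℕ.+ s))) (8 ↑ʳ (paramVars {s} j)))
            (and (nameF paramVars last 0F) isSuccessor)

  -- The parameters are quantified anew at each step, so that the formulas for all m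
  -- refer to them by the same indices.
  numeral : (m : ℕ) → ∀ {s} → Formula (suc n) 2 (8 ℕ.+ s)
  numeral zero    = isZero
  numeral (suc m) = exSets 8 (and step (numeral m))

  setting : L 0 → Formula (suc n) 2 7
  setting τ = and (less 1F 0F) (forceF id (λ ()) last τ)

  -- Conjoining `numeral m` replaces the substitution of a numeral into χ, so the code of the result
  -- is computed from that of χ without any syntactic substitution. As χ is given apart from m, the
  -- number m may be that of χ itself.
  sentence : L 0 → ℕ → Formula (suc n) 2 8 → Sentence (suc n)
  sentence τ m χ = neg (exEl (exEl (exSets 7 (and (setting τ)
    (exSet (and (nameF (paramVars {0}) last 0F) (and (numeral m {0}) χ)))))))

  failing : L 1 → Formula (suc n) 2 8
  failing ψ = neg (forceF (paramVars {0}) (λ _ → 0F) last ψ)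

-- Computing Gödel numbers

record Computable (k : ℕ) (F : Vec ℕ k → ℕ) : Set where
  constructor computable
  field
    program  : Rec k
    computes : ∀ xs → program [ xs ]⇓ F xs

open Computable

project : ∀ {k} (i : Fin k) → Computable k λ xs → lookup xs i
project i = computable (proj i) λ _ → proj⇓

compose₁ : ∀ {k F G} → Computable 1 F → Computable k G → Computable k λ xs → F (G xs ∷ [])
compose₁ {G = G} f g = computable (comp (program f) (program g ∷ []))
  λ xs → comp⇓ (G xs ∷ []) (λ { 0F → computes g xs }) (computes f (G xs ∷ []))

compose₂ : ∀ {k F G H} → Computable 2 F → Computable k G → Computable k H →
           Computable k λ xs → F (G xs ∷ H xs ∷ [])
compose₂ {G = G} {H} f g h = computable (comp (program f) (program g ∷ program h ∷ []))
  λ xs → comp⇓ (G xs ∷ H xs ∷ []) (λ { 0F → computes g xs ; 1F → computes h xs })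
           (computes f (G xs ∷ H xs ∷ []))

successor : ∀ {k G} → Computable k G → Computable k λ xs → suc (G xs)
successor {G = G} g = computable (comp sucᴿ (program g ∷ []))
  λ xs → comp⇓ (G xs ∷ []) (λ { 0F → computes g xs }) suc⇓

constant : ∀ {k} c → Computable k λ _ → c
constant zero    = computable (comp zeroᴿ []) λ _ → comp⇓ [] (λ ()) zero⇓
constant (suc c) = successor (constant c)

iterate : (a : ℕ) (S : ℕ → ℕ → ℕ) → ℕ → ℕ
iterate a S zero    = a
iterate a S (suc m) = S m (iterate a S m)

recurse : ∀ {k F S} → Computable k F → Computable (2 ℕ.+ k) S →
          Computable (suc k) λ xs →
            iterate (F (Vec.tail xs)) (λ m y → S (m ∷ y ∷ Vec.tail xs)) (Vec.head xs)
recurse {k} {F} {S} f s = computable (prim (program f) (program s)) λ { (m ∷ xs) → go m xs }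
  where
  go : ∀ m (xs : Vec ℕ k) → prim (program f) (program s) [ m ∷ xs ]⇓ iterate (F xs) (λ m y → S (m ∷ y ∷ xs)) m
  go zero    xs = prim⇓-zero (computes f xs)
  go (suc m) xs = prim⇓-suc (go m xs) (computes s _)

along : ∀ {k F G} → (∀ xs → F xs ≡ G xs) → Computable k F → Computable k G
along F≡G f = computable (program f) λ xs → subst (program f [ xs ]⇓_) (F≡G xs) (computes f xs)

addition : Computable 2 λ xs → lookup xs 0F ℕ.+ lookup xs 1F
addition = along (λ { (a ∷ b ∷ []) → sum a b }) (recurse (project 0F) (successor (project 1F)))
  where
  sum : ∀ a b → iterate b (λ _ y → suc y) a ≡ a ℕ.+ b
  sum zero    b = refl
  sum (suc a) b = cong suc (sum a b)

triangles : Computable 1 λ xs → triangle (lookup xs 0F)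
triangles = along (λ { (m ∷ []) → total m })
  (recurse (constant 0) (compose₂ addition (successor (project 0F)) (project 1F)))
  where
  total : ∀ m → iterate 0 (λ m y → suc m ℕ.+ y) m ≡ triangle m
  total zero    = refl
  total (suc m) = cong (suc m ℕ.+_) (total m)

opaque
  -- Sealed, since unfolding triangle in nested pairs is exponential.
  ⟨_,_⟩ : ℕ → ℕ → ℕ
  ⟨ a , b ⟩ = pair a b

  pair≡⟨,⟩ : ∀ {a b c d} → a ≡ c → b ≡ d → pair a b ≡ ⟨ c , d ⟩
  pair≡⟨,⟩ = cong₂ pair

  pairing : ∀ {k F G} → Computable k F → Computable k G → Computable k λ xs → ⟨ F xs , G xs ⟩
  pairing f g = compose₂ addition (compose₁ triangles (compose₂ addition f g)) g

-- The part of a formula on which its Gödel number depends.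
data Shape : Set where
  less equal pred mem : ℕ → ℕ → Shape
  neg exEl exSet      : Shape → Shape
  and                 : Shape → Shape → Shape

shape : ∀ {n e s} → Formula n e s → Shape
shape (less i j)  = less (toℕ i) (toℕ j)
shape (equal i j) = equal (toℕ i) (toℕ j)
shape (pred k i)  = pred (toℕ k) (toℕ i)
shape (mem i j)   = mem (toℕ i) (toℕ j)
shape (neg φ)     = neg (shape φ)
shape (and φ ψ)   = and (shape φ) (shape ψ)
shape (exEl φ)    = exEl (shape φ)
shape (exSet φ)   = exSet (shape φ)

shapeCode : Shape → ℕ
shapeCode (less i j)  = ⟨ 0 , ⟨ i , j ⟩ ⟩
shapeCode (equal i j) = ⟨ 1 , ⟨ i , j ⟩ ⟩
shapeCode (pred i j)  = ⟨ 2 , ⟨ i , j ⟩ ⟩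
shapeCode (mem i j)   = ⟨ 3 , ⟨ i , j ⟩ ⟩
shapeCode (neg φ)     = ⟨ 4 , shapeCode φ ⟩
shapeCode (and φ ψ)   = ⟨ 5 , ⟨ shapeCode φ , shapeCode ψ ⟩ ⟩
shapeCode (exEl φ)    = ⟨ 6 , shapeCode φ ⟩
shapeCode (exSet φ)   = ⟨ 7 , shapeCode φ ⟩

code-shape : ∀ {n e s} (φ : Formula n e s) → code φ ≡ shapeCode (shape φ)
code-shape (less i j)  = pair≡⟨,⟩ refl (pair≡⟨,⟩ refl refl)
code-shape (equal i j) = pair≡⟨,⟩ refl (pair≡⟨,⟩ refl refl)
code-shape (pred k i)  = pair≡⟨,⟩ refl (pair≡⟨,⟩ refl refl)
code-shape (mem i j)   = pair≡⟨,⟩ refl (pair≡⟨,⟩ refl refl)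
code-shape (neg φ)     = pair≡⟨,⟩ refl (code-shape φ)
code-shape (and φ ψ)   = pair≡⟨,⟩ refl (pair≡⟨,⟩ (code-shape φ) (code-shape ψ))
code-shape (exEl φ)    = pair≡⟨,⟩ refl (code-shape φ)
code-shape (exSet φ)   = pair≡⟨,⟩ refl (code-shape φ)

opaque
  number : ∀ {n e s} → Formula n e s → ℕ
  number φ = shapeCode (shape φ)

  number-shape : ∀ {n e s} (φ : Formula n e s) {X} → shape φ ≡ X → number φ ≡ shapeCode X
  number-shape φ eq = cong shapeCode eq

  code≡number : ∀ {n e s} (φ : Formula n e s) → code φ ≡ number φ
  code≡number = code-shape

exSetsShape : ℕ → Shape → Shape
exSetsShape zero    φ = φ
exSetsShape (suc k) φ = exSetsShape k (exSet φ)

shape-exSets : ∀ {n e s} k (φ : Formula n e (k ℕ.+ s)) →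
               shape (Formulas.exSets k φ) ≡ exSetsShape k (shape φ)
shape-exSets zero    φ = refl
shape-exSets (suc k) φ = shape-exSets k (exSet φ)

exSetsCode : ℕ → ℕ → ℕ
exSetsCode zero    c = c
exSetsCode (suc k) c = exSetsCode k ⟨ 7 , c ⟩

shapeCode-exSets : ∀ k φ → shapeCode (exSetsShape k φ) ≡ exSetsCode k (shapeCode φ)
shapeCode-exSets zero    φ = refl
shapeCode-exSets (suc k) φ = shapeCode-exSets k (exSet φ)

exSetsCoding : ∀ {k F} m → Computable k F → Computable k λ xs → exSetsCode m (F xs)
exSetsCoding zero    f = f
exSetsCoding (suc m) f = exSetsCoding m (pairing (constant 7) f)

numeralShape : Shape → Shape → ℕ → Shape
numeralShape Z T zero    = Z
numeralShape Z T (suc m) = exSetsShape 8 (and T (numeralShape Z T m))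

numeralCode : ℕ → ℕ → ℕ → ℕ
numeralCode z t = iterate z (λ _ c → exSetsCode 8 ⟨ 5 , ⟨ t , c ⟩ ⟩)

shapeCode-numeral : ∀ Z T m → shapeCode (numeralShape Z T m) ≡ numeralCode (shapeCode Z) (shapeCode T) m
shapeCode-numeral Z T zero    = refl
shapeCode-numeral Z T (suc m) = trans (shapeCode-exSets 8 (and T (numeralShape Z T m)))
  (cong (λ c → exSetsCode 8 ⟨ 5 , ⟨ shapeCode T , c ⟩ ⟩) (shapeCode-numeral Z T m))

numeralCoding : ∀ z t → Computable 1 λ xs → numeralCode z t (lookup xs 0F)
numeralCoding z t = along (λ { (m ∷ []) → refl }) (recurse (constant z)
  (exSetsCoding 8 (pairing (constant 5) (pairing (constant t) (project 1F)))))

sentenceShape : (A B N X : Shape) → Shape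
sentenceShape A B N X = neg (exEl (exEl (exSetsShape 7 (and A (exSet (and B (and N X)))))))

sentenceCode : (a b m x : ℕ) → ℕ
sentenceCode a b m x =
  ⟨ 4 , ⟨ 6 , ⟨ 6 , exSetsCode 7 ⟨ 5 , ⟨ a , ⟨ 7 , ⟨ 5 , ⟨ b , ⟨ 5 , ⟨ m , x ⟩ ⟩ ⟩ ⟩ ⟩ ⟩ ⟩ ⟩ ⟩ ⟩

shapeCode-sentence : ∀ A B N X → shapeCode (sentenceShape A B N X) ≡
                     sentenceCode (shapeCode A) (shapeCode B) (shapeCode N) (shapeCode X)
shapeCode-sentence A B N X =
  cong (λ c → ⟨ 4 , ⟨ 6 , ⟨ 6 , c ⟩ ⟩ ⟩) (shapeCode-exSets 7 (and A (exSet (and B (and N X)))))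

-- The code of the diagonal sentence as a recursive function

module SentenceCode {n : ℕ} (τ : L 0) where

  open Formulas {suc n}
  open GoodFormula {n}
  open SentenceFormula {n}

  -- The variable contexts grow with m, but the indices used in a step do not change; on shapes the
  -- recursion is a plain iteration of one step.
  numeral-shape : ∀ m {s} → shape (numeral m {s}) ≡ numeralShape (shape (isZero {0})) (shape (step {0})) m
  numeral-shape zero        = refl
  numeral-shape (suc m) {s} = trans (shape-exSets 8 (and (step {s}) (numeral m)))
    (cong (λ N → exSetsShape 8 (and (shape (step {0})) N)) (numeral-shape m))

  sentence-shape : ∀ m χ → shape (sentence τ m χ) ≡
    sentenceShape (shape (setting τ)) (shape (nameF {2} (paramVars {0}) last 0F))
      (numeralShape (shape (isZero {0})) (shape (step {0})) m) (shape χ)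
  sentence-shape m χ = cong (λ N → sentenceShape (shape (setting τ)) (shape (nameF {2} (paramVars {0}) last 0F)) N (shape χ))
    (numeral-shape m {0})

  -- All that varies with m and χ is the code of the numeral and the number of χ; the other
  -- ingredients are four constants.
  sentence-code : ∃₂ λ a b → ∃₂ λ z t → ∀ m χ →
                  number (sentence τ m χ) ≡ sentenceCode a b (numeralCode z t m) (number χ)
  sentence-code = generic (shape (setting τ)) (shape (nameF {2} (paramVars {0}) last 0F))
                    (shape (isZero {0})) (shape (step {0})) sentence-shape
    where
    generic : ∀ A B Z T → (∀ m χ → shape (sentence τ m χ) ≡ sentenceShape A B (numeralShape Z T m) (shape χ)) →
              ∃₂ λ a b → ∃₂ λ z t → ∀ m χ →
              number (sentence τ m χ) ≡ sentenceCode a b (numeralCode z t m) (number χ)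
    generic A B Z T eq = shapeCode A , shapeCode B , shapeCode Z , shapeCode T , λ m χ →
      trans (number-shape (sentence τ m χ) (eq m χ))
        (trans (shapeCode-sentence A B (numeralShape Z T m) (shape χ))
          (cong₂ (sentenceCode (shapeCode A) (shapeCode B)) (shapeCode-numeral Z T m)
            (sym (number-shape χ refl))))

  diagonal-code : ∃ λ (h : Rec 1) → ∀ χ → h [ number χ ∷ [] ]⇓ number (sentence τ (number χ) χ)
  diagonal-code = let a , b , z , t , eq = sentence-code in from a b z t eq
    where
    from : ∀ a b z t → (∀ m χ → number (sentence τ m χ) ≡ sentenceCode a b (numeralCode z t m) (number χ)) →
           ∃ λ (h : Rec 1) → ∀ χ → h [ number χ ∷ [] ]⇓ number (sentence τ (number χ) χ)
    from a b z t eq =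
      program coding , λ χ → subst (program coding [ number χ ∷ [] ]⇓_) (sym (eq (number χ) χ)) (computes coding (number χ ∷ []))
      where
      coding : Computable 1 λ xs → sentenceCode a b (numeralCode z t (lookup xs 0F)) (lookup xs 0F)
      coding = pairing (constant 4) (pairing (constant 6) (pairing (constant 6) (exSetsCoding 7
        (pairing (constant 5) (pairing (constant a) (pairing (constant 7) (pairing (constant 5)
          (pairing (constant b) (pairing (constant 5) (pairing (numeralCoding z t) (project 0F)))))))))))

module Proof (em : ExcludedMiddle 0ℓ) (ext : Extensionality 0ℓ 0ℓ) where

  stable : {P : Set} → ¬ ¬ P → P
  stable = decidable-stable em

  opaque
    ⟪_⟫ : {A : Set} → (A → Set) → Subset A
    ⟪ P ⟫ x = ⌊ em {P x} ⌋

    ⟪⟫⁺ : {A : Set} {P : A → Set} {x : A} → P x → x ∈ ⟪ P ⟫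
    ⟪⟫⁺ = fromWitness

    ⟪⟫⁻ : {A : Set} {P : A → Set} {x : A} → x ∈ ⟪ P ⟫ → P x
    ⟪⟫⁻ = toWitness

  infix 4 _⊆_
  _⊆_ : {A : Set} → Subset A → Subset A → Set
  X ⊆ Y = ∀ {x} → x ∈ X → x ∈ Y

  ⊆-antisym : {A : Set} {X Y : Subset A} → X ⊆ Y → Y ⊆ X → X ≡ Y
  ⊆-antisym {X = X} {Y} X⊆Y Y⊆X = ext λ x → T-antisym (X x) (Y x) X⊆Y Y⊆X
    where
    T-antisym : ∀ a b → (T a → T b) → (T b → T a) → a ≡ b
    T-antisym true  true  _ _ = refl
    T-antisym true  false f _ = ⊥-elim (f tt)
    T-antisym false true  _ g = ⊥-elim (g tt)
    T-antisym false false _ _ = refl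

  Element-≡ : {A : Set} {X : Subset A} {a b : Element X} → proj₁ a ≡ proj₁ b → a ≡ b
  Element-≡ {a = x , p} {.x , q} refl = cong (x ,_) (Bool.T-irrelevant p q)

  -- Countability

  triangle-mono : ∀ {m n} → m ≤ n → triangle m ≤ triangle n
  triangle-mono z≤n       = z≤n
  triangle-mono (s≤s m≤n) = ℕ.+-mono-≤ (s≤s m≤n) (triangle-mono m≤n)

  -- Diagonal s of the enumeration ends at `triangle s + s`, one below the beginning of diagonal s +
  -- 1.
  pair-<-diagonal : ∀ a b c d → a ℕ.+ b ℕ.< c ℕ.+ d → pair a b ℕ.< pair c d
  pair-<-diagonal a b c d a+b<c+d = begin-strict
    triangle (a ℕ.+ b) ℕ.+ b         ≤⟨ ℕ.+-monoʳ-≤ (triangle (a ℕ.+ b)) (ℕ.m≤n+m b a) ⟩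
    triangle (a ℕ.+ b) ℕ.+ (a ℕ.+ b) ≡⟨ ℕ.+-comm (triangle (a ℕ.+ b)) (a ℕ.+ b) ⟩
    (a ℕ.+ b) ℕ.+ triangle (a ℕ.+ b) <⟨ ℕ.n<1+n _ ⟩
    triangle (suc (a ℕ.+ b))         ≤⟨ triangle-mono a+b<c+d ⟩
    triangle (c ℕ.+ d)               ≤⟨ ℕ.m≤m+n _ d ⟩
    pair c d                         ∎
    where open ℕ.≤-Reasoning

  pair-injective : ∀ a b c d → pair a b ≡ pair c d → a ≡ c × b ≡ d
  pair-injective a b c d eq with ℕ.<-cmp (a ℕ.+ b) (c ℕ.+ d)
  ... | tri< lt _ _ = contradiction (pair-<-diagonal a b c d lt) (ℕ.<-irrefl eq)
  ... | tri> _ _ gt = contradiction (pair-<-diagonal c d a b gt) (ℕ.<-irrefl (sym eq))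
  ... | tri≈ _ s _  = a≡c , b≡d
    where
    b≡d : b ≡ d
    b≡d = ℕ.+-cancelˡ-≡ (triangle (a ℕ.+ b)) b d
            (trans eq (cong (λ t → triangle t ℕ.+ d) (sym s)))
    a≡c : a ≡ c
    a≡c = ℕ.+-cancelʳ-≡ b a c (trans s (cong (c ℕ.+_) (sym b≡d)))

  record Enumerable (A : Set) : Set where
    field
      index     : A → ℕ
      injective : ∀ {a b} → index a ≡ index b → a ≡ b

    opaque
      element : ℕ → Maybe A
      element n with em {∃ λ a → index a ≡ n}
      ... | yes (a , _) = just a
      ... | no  _       = nothing

      element-index : ∀ a → element (index a) ≡ just a
      element-index a with em {∃ λ b → index b ≡ index a}
      ... | yes (b , eq) = cong just (injective eq)
      ... | no  none     = contradiction (a , refl) none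

  open Enumerable

  ×-enumerable : {A B : Set} → Enumerable A → Enumerable B → Enumerable (A × B)
  ×-enumerable EA EB .index (a , b) = pair (index EA a) (index EB b)
  ×-enumerable EA EB .injective {a , b} {c , d} eq =
    let p , q = pair-injective (index EA a) (index EB b) (index EA c) (index EB d) eq
    in cong₂ _,_ (injective EA p) (injective EB q)

  ℕ-enumerable : Enumerable ℕ
  ℕ-enumerable = record { index = id ; injective = id }

  Fin-enumerable : ∀ {k} → Enumerable (Fin k)
  Fin-enumerable = record { index = toℕ ; injective = Fin.toℕ-injective }

  ℤ-enumerable : Enumerable ℤ
  ℤ-enumerable .index (ℤ.+ n)      = pair 0 n
  ℤ-enumerable .index (ℤ.-[1+ n ]) = pair 1 n
  ℤ-enumerable .injective {ℤ.+ m} {ℤ.+ n} eq =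
    cong ℤ.+_ (proj₂ (pair-injective 0 m 0 n eq))
  ℤ-enumerable .injective {ℤ.-[1+ m ]} {ℤ.-[1+ n ]} eq =
    cong ℤ.-[1+_] (proj₂ (pair-injective 1 m 1 n eq))
  ℤ-enumerable .injective {ℤ.+ m} {ℤ.-[1+ n ]} eq =
    case proj₁ (pair-injective 0 m 1 n eq) of λ ()
  ℤ-enumerable .injective {ℤ.-[1+ m ]} {ℤ.+ n} eq =
    case proj₁ (pair-injective 1 m 0 n eq) of λ ()

  ℚ-enumerable : Enumerable ℚ
  ℚ-enumerable .index (mkℚ n d _) = pair (index ℤ-enumerable n) d
  ℚ-enumerable .injective {mkℚ n d _} {mkℚ n′ d′ _} eq
    with pair-injective (index ℤ-enumerable n) d (index ℤ-enumerable n′) d′ eq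
  ... | n≡ , refl with injective ℤ-enumerable {n} {n′} n≡
  ... | refl = refl

  -- Sequences that meet countably many requirements

  module GenericSequence {S : Set} (_≼_ : S → S → Set)
    (≼-refl : ∀ {s} → s ≼ s) (≼-trans : ∀ {s t u} → s ≼ t → t ≼ u → s ≼ u)
    (D : ℕ → S → S → Set) (start : S)
    (dense : ∀ n s → ∃ λ t → s ≼ t × D n s t) where

    opaque
      stage : ℕ → S
      stage zero    = start
      stage (suc n) = proj₁ (dense n (stage n))

      stage-zero : stage 0 ≡ start
      stage-zero = refl

      stage-step : ∀ n → D n (stage n) (stage (suc n))
      stage-step n = proj₂ (proj₂ (dense n (stage n)))

      stage-mono : ∀ {m n} → m ≤ n → stage m ≼ stage n
      stage-mono m≤n = go (ℕ.≤⇒≤′ m≤n)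
        where
        go : ∀ {m n} → m ℕ.≤′ n → stage m ≼ stage n
        go (ℕ.≤′-reflexive refl) = ≼-refl
        go (ℕ.≤′-step {n = n} le) = ≼-trans (go le) (proj₁ (proj₂ (dense n (stage n))))

  -- This serves twice: with the rationals as their own keys, to colour ℚ, and with colours as keys,
  -- to split a set that mixes colours.
  module Select {A Key : Set} (key : A → Key) (S : ℕ → A → Set)
    (fresh : ∀ n (ks : List Key) → ∃ λ a → S n a × ¬ key a ∈ᴸ ks) where

    opaque
      mutual
        select : ℕ → A
        select n = proj₁ (fresh n (keysBelow n))

        keysBelow : ℕ → List Key
        keysBelow zero    = []
        keysBelow (suc n) = key (select n) ∷ keysBelow n

      select-∈ : ∀ n → S n (select n)
      select-∈ n = proj₁ (proj₂ (fresh n (keysBelow n)))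

      keysBelow-∋ : ∀ {m n} → m ℕ.<′ n → key (select m) ∈ᴸ keysBelow n
      keysBelow-∋ (ℕ.≤′-reflexive refl) = here refl
      keysBelow-∋ (ℕ.≤′-step le)        = there (keysBelow-∋ le)

      distinct-< : ∀ {m n} → m ℕ.< n → key (select m) ≢ key (select n)
      distinct-< {m} {n} m<n eq = proj₂ (proj₂ (fresh n (keysBelow n)))
        (subst (_∈ᴸ keysBelow n) eq (keysBelow-∋ (ℕ.≤⇒≤′ m<n)))

    select-distinct : ∀ {m n} → key (select m) ≡ key (select n) → m ≡ n
    select-distinct {m} {n} eq with ℕ.<-cmp m n
    ... | tri< lt _ _  = contradiction eq (distinct-< lt)
    ... | tri≈ _ m≡n _ = m≡n
    ... | tri> _ _ gt  = contradiction (sym eq) (distinct-< gt)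

  -- The order of the reals

  lower-downward : ∀ (x : ℝ) {p q} → p ℚ.< q → q ∈ lower x → p ∈ lower x
  lower-downward (mkℝ _ _ _ downward _) p<q q∈x = recompute em (downward p<q q∈x)

  lower-rounded : ∀ (x : ℝ) {p} → p ∈ lower x → ∃ λ q → p ℚ.< q × q ∈ lower x
  lower-rounded (mkℝ _ _ _ _ rounded) p∈x = recompute em (rounded p∈x)

  lower-inhabited : ∀ (x : ℝ) → ∃ λ q → q ∈ lower x
  lower-inhabited (mkℝ _ inhabited _ _ _) = recompute em inhabited

  lower-bounded : ∀ (x : ℝ) → ∃ λ q → ¬ q ∈ lower x
  lower-bounded (mkℝ _ _ bounded _ _) = recompute em bounded

  lower-injective : ∀ {x y} → lower x ≡ lower y → x ≡ y
  lower-injective refl = refl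

  ∈∉⇒< : ∀ (x : ℝ) {p q} → p ∈ lower x → ¬ q ∈ lower x → p ℚ.< q
  ∈∉⇒< x {p} {q} p∈x q∉x with ℚ.<-cmp p q
  ... | tri< p<q _ _  = p<q
  ... | tri≈ _ refl _ = contradiction p∈x q∉x
  ... | tri> _ _ q<p  = contradiction (lower-downward x q<p p∈x) q∉x

  opaque
    -- Sealed copies of the order and of the embedding of ℚ, from which their arguments
    -- can be inferred.
    infix 4 _<_
    _<_ : ℝ → ℝ → Set
    _<_ = _<ᴿ_

    real : ℚ → ℝ
    real = fromℚ

    <⇒<ᴿ : ∀ {x y} → x < y → x <ᴿ y
    <⇒<ᴿ x<y = x<y

    <ᴿ⇒< : ∀ {x y} → x <ᴿ y → x < y
    <ᴿ⇒< x<y = x<y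

    real≡fromℚ : ∀ q → real q ≡ fromℚ q
    real≡fromℚ _ = refl

    <-trans : ∀ {x y z} → x < y → y < z → x < z
    <-trans {y = y} {z} (p , p∉x , p∈y) (q , q∉y , q∈z) =
      p , p∉x , lower-downward z (∈∉⇒< y p∈y q∉y) q∈z

    <-irrefl : ∀ {x} → ¬ x < x
    <-irrefl (_ , q∉x , q∈x) = q∉x q∈x

    ≮⇒lower⊇ : ∀ {x y} → ¬ x < y → lower y ⊆ lower x
    ≮⇒lower⊇ x≮y q∈y = stable λ q∉x → x≮y (_ , q∉x , q∈y)

    ∈lower-real⁺ : ∀ {p r} → p ℚ.< r → p ∈ lower (real r)
    ∈lower-real⁺ = fromWitness

    ∈lower-real⁻ : ∀ {p r} → p ∈ lower (real r) → p ℚ.< r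
    ∈lower-real⁻ {p} {r} = toWitness {a? = p ℚ.<? r}

    ∉lower-real : ∀ {r} → ¬ r ∈ lower (real r)
    ∉lower-real {r} r∈ = ℚ.<-irrefl refl (∈lower-real⁻ {r} {r} r∈)

    ∈lower⇒< : ∀ {x q} → q ∈ lower x → real q < x
    ∈lower⇒< {q = q} q∈x = q , ∉lower-real {q} , q∈x

    <⇒∈lower : ∀ {x q} → real q < x → q ∈ lower x
    <⇒∈lower {x} {q} (r , r∉q , r∈x) with ℚ.<-cmp q r
    ... | tri< q<r _ _  = lower-downward x q<r r∈x
    ... | tri≈ _ refl _ = r∈x
    ... | tri> _ _ r<q  = contradiction (∈lower-real⁺ {r} {q} r<q) r∉q

    ∉lower⇒< : ∀ {x p q} → ¬ p ∈ lower x → p ℚ.< q → x < real q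
    ∉lower⇒< {x} {p} {q} p∉x p<q = p , p∉x , ∈lower-real⁺ {p} {q} p<q

    ℚ-dense-in-ℝ : ∀ {x y} → x < y → ∃ λ q → x < real q × real q < y
    ℚ-dense-in-ℝ {x} {y} (p , p∉x , p∈y) =
      let q , p<q , q∈y = lower-rounded y p∈y
      in q , ∉lower⇒< {x} {p} {q} p∉x p<q , ∈lower⇒< {y} {q} q∈y

  <-asym : ∀ {x y} → x < y → ¬ y < x
  <-asym x<y y<x = <-irrefl (<-trans x<y y<x)

  ≢⇒<⊎> : ∀ {x y} → x ≢ y → x < y ⊎ y < x
  ≢⇒<⊎> {x} {y} x≢y with em {x < y} | em {y < x}
  ... | yes x<y | _       = inj₁ x<y
  ... | no _    | yes y<x = inj₂ y<x
  ... | no x≮y  | no y≮x  =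
    contradiction (lower-injective (⊆-antisym (≮⇒lower⊇ y≮x) (≮⇒lower⊇ x≮y))) x≢y

  real-mono : ∀ {p q} → p ℚ.< q → real p < real q
  real-mono = ∈lower⇒< ∘ ∈lower-real⁺

  real-reflects : ∀ {p q} → real p < real q → p ℚ.< q
  real-reflects p<q = ∈lower-real⁻ (<⇒∈lower p<q)

  real-injective : ∀ {p q} → real p ≡ real q → p ≡ q
  real-injective {p} {q} eq with ℚ.<-cmp p q
  ... | tri< p<q _ _ = contradiction (subst (_< real q) eq (real-mono p<q)) <-irrefl
  ... | tri≈ _ p≡q _ = p≡q
  ... | tri> _ _ q<p = contradiction (subst (real q <_) eq (real-mono q<p)) <-irrefl

  ℚ-unbounded-below : ∀ x → ∃ λ q → real q < x
  ℚ-unbounded-below x = let q , q∈x = lower-inhabited x in q , ∈lower⇒< q∈x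

  ℚ-unbounded-above : ∀ x → ∃ λ q → x < real q
  ℚ-unbounded-above x =
    let q , q∉x = lower-bounded x in q ℚ.+ 1ℚ , ∉lower⇒< q∉x q<q+1
    where
    q<q+1 : ∀ {q} → q ℚ.< q ℚ.+ 1ℚ
    q<q+1 {q} = subst (ℚ._< q ℚ.+ 1ℚ) (ℚ.+-identityʳ q) (ℚ.+-monoʳ-< q (ℚ.positive⁻¹ 1ℚ))

  Irrational : ℝ → Set
  Irrational x = ∀ r → x ≢ real r

  Between : ℚ → ℚ → ℚ → Set
  Between p q v = p ℚ.< v × v ℚ.< q

  _∈⟮_,_⟯ : ℝ → ℚ → ℚ → Set
  x ∈⟮ p , q ⟯ = real p < x × x < real q

  Between⇒∈ : ∀ {p q v} → Between p q v → real v ∈⟮ p , q ⟯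
  Between⇒∈ (p<v , v<q) = real-mono p<v , real-mono v<q

  ∈⇒Between : ∀ {p q v} → real v ∈⟮ p , q ⟯ → Between p q v
  ∈⇒Between (p<v , v<q) = real-reflects p<v , real-reflects v<q

  Gap : Subset ℚ → ℝ → Set
  Gap Y x = ∃₂ λ p q → x ∈⟮ p , q ⟯ × (∀ v → Between p q v → ¬ v ∈ Y)

  Closure : Subset ℚ → ℝ → Set
  Closure X x = ∀ p q → x ∈⟮ p , q ⟯ → ∃ λ v → Between p q v × v ∈ X

  -- Strict bounds make the nearer of two lower (upper) neighbourhood bounds
  -- available without a case distinction at every use.

  closer-below : ∀ {x p r} → real p < x → real r < x →
                 ∃ λ s → p ℚ.< s × r ℚ.< s × real s < x
  closer-below {x} {p} {r} p<x r<x with ℚ.<-cmp p r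
  ... | tri< p<r _ _ =
    let s , r<s , s<x = ℚ-dense-in-ℝ r<x ; r<s′ = real-reflects r<s
    in s , ℚ.<-trans p<r r<s′ , r<s′ , s<x
  ... | tri≈ _ refl _ =
    let s , r<s , s<x = ℚ-dense-in-ℝ r<x ; r<s′ = real-reflects r<s in s , r<s′ , r<s′ , s<x
  ... | tri> _ _ r<p =
    let s , p<s , s<x = ℚ-dense-in-ℝ p<x ; p<s′ = real-reflects p<s
    in s , p<s′ , ℚ.<-trans r<p p<s′ , s<x

  closer-above : ∀ {x q r} → x < real q → x < real r →
                 ∃ λ s → s ℚ.< q × s ℚ.< r × x < real s
  closer-above {x} {q} {r} x<q x<r with ℚ.<-cmp q r
  ... | tri< q<r _ _ =
    let s , x<s , s<q = ℚ-dense-in-ℝ x<q ; s<q′ = real-reflects s<q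
    in s , s<q′ , ℚ.<-trans s<q′ q<r , x<s
  ... | tri≈ _ refl _ =
    let s , x<s , s<q = ℚ-dense-in-ℝ x<q ; s<q′ = real-reflects s<q in s , s<q′ , s<q′ , x<s
  ... | tri> _ _ r<q =
    let s , x<s , s<r = ℚ-dense-in-ℝ x<r ; s<r′ = real-reflects s<r
    in s , ℚ.<-trans s<r′ r<q , s<r′ , x<s

  -- Both sequences move strictly, which puts the limit in the interior of every interval.
  module Nested (a b : ℕ → ℚ) (a-up : ∀ n → a n ℚ.< a (suc n))
                (b-down : ∀ n → b (suc n) ℚ.< b n) (a<b : ∀ n → a n ℚ.< b n) where

    private
      a-mono : ∀ {m n} → m ℕ.≤′ n → a m ℚ.≤ a n
      a-mono (ℕ.≤′-reflexive refl) = ℚ.≤-refl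
      a-mono (ℕ.≤′-step le)        = ℚ.≤-trans (a-mono le) (ℚ.<⇒≤ (a-up _))

      b-anti : ∀ {m n} → m ℕ.≤′ n → b n ℚ.≤ b m
      b-anti (ℕ.≤′-reflexive refl) = ℚ.≤-refl
      b-anti (ℕ.≤′-step le)        = ℚ.≤-trans (ℚ.<⇒≤ (b-down _)) (b-anti le)

      a<b′ : ∀ m n → a m ℚ.< b n
      a<b′ m n with ℕ.≤-total m n
      ... | inj₁ m≤n = ℚ.≤-<-trans (a-mono (ℕ.≤⇒≤′ m≤n)) (a<b n)
      ... | inj₂ n≤m = ℚ.<-≤-trans (a<b m) (b-anti (ℕ.≤⇒≤′ n≤m))

      low : Subset ℚ
      low = ⟪ (λ q → ∃ λ n → q ℚ.< a n) ⟫

      b∉low : ∀ n → ¬ b n ∈ low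
      b∉low n b∈ = let m , b<a = ⟪⟫⁻ b∈ in ℚ.<-asym b<a (a<b′ m n)

    opaque
      limit : ℝ
      limit = mkℝ low
        (a 0 , ⟪⟫⁺ (1 , a-up 0))
        (b 0 , b∉low 0)
        (λ p<q q∈ → let n , q<a = ⟪⟫⁻ q∈ in ⟪⟫⁺ (n , ℚ.<-trans p<q q<a))
        (λ p∈ → let n , p<a = ⟪⟫⁻ p∈ ; m , p<m , m<a = ℚ.<-dense p<a
                in m , p<m , ⟪⟫⁺ (n , m<a))

      limit-∈ : ∀ n → limit ∈⟮ a n , b n ⟯
      limit-∈ n = ∈lower⇒< (⟪⟫⁺ (suc n , a-up n)) , ∉lower⇒< (b∉low (suc n)) (b-down n)

  -- Cantor's injection of the power set of ℕ into ℝ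

  record Splitting (p q : ℚ) : Set where
    field
      u v w z : ℚ
      p<u : p ℚ.< u
      u<v : u ℚ.< v
      v<w : v ℚ.< w
      w<z : w ℚ.< z
      z<q : z ℚ.< q

  split : ∀ {p q} → p ℚ.< q → Splitting p q
  split p<q =
    let v , p<v , v<q = ℚ.<-dense p<q
        u , p<u , u<v = ℚ.<-dense p<v
        w , v<w , w<q = ℚ.<-dense v<q
        z , w<z , z<q = ℚ.<-dense w<q
    in record { u = u ; v = v ; w = w ; z = z
              ; p<u = p<u ; u<v = u<v ; v<w = v<w ; w<z = w<z ; z<q = z<q }

  record Interval : Set where
    constructor interval
    field
      left right : ℚ
      left<right : left ℚ.< right

  open Interval

  half : Bool → Interval → Interval
  half true  (interval _ _ p<q) = let open Splitting (split p<q) in interval u v u<v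
  half false (interval _ _ p<q) = let open Splitting (split p<q) in interval w z w<z

  half-left : ∀ b I → left I ℚ.< left (half b I)
  half-left true  (interval _ _ p<q) = Splitting.p<u (split p<q)
  half-left false (interval _ _ p<q) = let open Splitting (split p<q) in
    ℚ.<-trans p<u (ℚ.<-trans u<v v<w)

  half-right : ∀ b I → right (half b I) ℚ.< right I
  half-right true  (interval _ _ p<q) = let open Splitting (split p<q) in
    ℚ.<-trans v<w (ℚ.<-trans w<z z<q)
  half-right false (interval _ _ p<q) = Splitting.z<q (split p<q)

  halves-disjoint : ∀ I {x} → x ∈⟮ left (half true I) , right (half true I) ⟯ →
                    ¬ x ∈⟮ left (half false I) , right (half false I) ⟯
  halves-disjoint (interval _ _ p<q) (_ , x<v) (w<x , _) =
    <-asym (<-trans x<v (real-mono (Splitting.v<w (split p<q)))) w<x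

  branch : Subset ℕ → ℕ → Interval
  branch s zero    = interval 0ℚ 1ℚ (ℚ.positive⁻¹ 1ℚ)
  branch s (suc n) = half (s n) (branch s n)

  module Branch (s : Subset ℕ) = Nested (left ∘ branch s) (right ∘ branch s)
    (λ n → half-left (s n) (branch s n)) (λ n → half-right (s n) (branch s n))
    (λ n → left<right (branch s n))

  cantor : Subset ℕ → ℝ
  cantor s = Branch.limit s

  cantor-injective : ∀ {s t} → cantor s ≡ cantor t → s ≡ t
  cantor-injective {s} {t} eq = ext same
    where
    halves : ∀ I a b {x} → x ∈⟮ left (half a I) , right (half a I) ⟯ →
             x ∈⟮ left (half b I) , right (half b I) ⟯ → a ≡ b
    halves I true  true  _ _ = refl
    halves I false false _ _ = refl
    halves I true  false i j = contradiction j (halves-disjoint I i)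
    halves I false true  i j = contradiction i (halves-disjoint I j)

    mutual
      branches : ∀ n → branch s n ≡ branch t n
      branches zero    = refl
      branches (suc n) = cong₂ half (same n) (branches n)

      same : ∀ n → s n ≡ t n
      same n = halves (branch t n) (s n) (t n)
        (subst₂ (λ x I → x ∈⟮ left (half (s n) I) , right (half (s n) I) ⟯)
          eq (branches n) (Branch.limit-∈ s (suc n)))
        (Branch.limit-∈ t (suc n))

  -- CH speaks of ℝ; this carries it over to the families of sets of rationals through which the
  -- recursion of length ω₁ has to run.
  ℝ-onto-power : {A : Set} → Enumerable A → ∃ λ (f : ℝ → Subset A) → ∀ X → ∃ λ x → f x ≡ X
  ℝ-onto-power {A} E = f , λ X → cantor (code′ X) , ext (agree X)
    where
    code′ : Subset A → Subset ℕ
    code′ X = ⟪ (λ n → ∃ λ a → index E a ≡ n × a ∈ X) ⟫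

    decode : ℝ → Subset ℕ
    decode x with em {∃ λ s → cantor s ≡ x}
    ... | yes (s , _) = s
    ... | no  _       = λ _ → false

    decode-cantor : ∀ s → decode (cantor s) ≡ s
    decode-cantor s with em {∃ λ t → cantor t ≡ cantor s}
    ... | yes (t , eq) = cantor-injective eq
    ... | no  none     = contradiction (s , refl) none

    f : ℝ → Subset A
    f x a = decode x (index E a)

    agree : ∀ X a → f (cantor (code′ X)) a ≡ X a
    agree X a = trans (cong (λ s → s (index E a)) (decode-cantor (code′ X)))
      (cong (λ (Y : Subset A) → Y a) (⊆-antisym {X = code′ X ∘ index E} {Y = X}
        (λ x∈ → let b , eq , b∈X = ⟪⟫⁻ x∈ in subst (_∈ X) (injective E eq) b∈X)
        (λ {x} x∈X → ⟪⟫⁺ (x , refl , x∈X))))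

  -- Zermelo's well-ordering

  module WellOrdering (A : Set) where

    Fresh : Subset A → Set
    Fresh X = ∃ λ x → ¬ x ∈ X

    IsNew : Subset A → A → Set
    IsNew X x with em {Fresh X}
    ... | yes (y , _) = x ≡ y
    ... | no  _       = ⊥

    isNew-unique : ∀ X {x y} → IsNew X x → IsNew X y → x ≡ y
    isNew-unique X with em {Fresh X}
    ... | yes _ = λ p q → trans p (sym q)
    ... | no  _ = λ ()

    isNew-fresh : ∀ X {x} → IsNew X x → ¬ x ∈ X
    isNew-fresh X with em {Fresh X}
    ... | yes (_ , y∉X) = λ { refl → y∉X }
    ... | no  _         = λ ()

    new-exists : ∀ X → Fresh X → ∃ (IsNew X)
    new-exists X fresh with em {Fresh X}
    ... | yes (y , _) = y , refl
    ... | no  none    = contradiction fresh none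

    next : Subset A → Subset A
    next X = ⟪ (λ x → x ∈ X ⊎ IsNew X x) ⟫

    union : Subset (Subset A) → Subset A
    union 𝒮 = ⟪ (λ x → ∃ λ X → X ∈ 𝒮 × x ∈ X) ⟫

    -- The first stage is the union of the empty family.
    data Tower : Subset A → Set where
      nextᵀ  : ∀ {X} → Tower X → Tower (next X)
      unionᵀ : ∀ 𝒮 → (∀ X → X ∈ 𝒮 → Tower X) → Tower (union 𝒮)

    ⊆-next : ∀ {X} → X ⊆ next X
    ⊆-next x∈X = ⟪⟫⁺ (inj₁ x∈X)

    -- Zermelo's comparability of stages, by induction on both towers at once.
    compare : ∀ {X Y} → Tower X → Tower Y → X ⊆ Y ⊎ next Y ⊆ X
    compare {Y = Y} (nextᵀ {X} tX) tY with compare tX tY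
    ... | inj₂ Y⁺⊆X = inj₂ (⊆-next ∘ Y⁺⊆X)
    -- The roles are exchanged here: either `next X` is already contained in Y, or X and Y coincide
    -- and so do their successors.
    ... | inj₁ X⊆Y with compare tY tX
    ...   | inj₂ X⁺⊆Y = inj₁ X⁺⊆Y
    ...   | inj₁ Y⊆X  = inj₂ (subst (λ Z → next Y ⊆ next Z) (⊆-antisym Y⊆X X⊆Y) id)
    compare {Y = Y} (unionᵀ 𝒮 towers) tY with em {∃ λ X → X ∈ 𝒮 × next Y ⊆ X}
    ... | yes (X , X∈𝒮 , Y⁺⊆X) = inj₂ λ y∈ → ⟪⟫⁺ (X , X∈𝒮 , Y⁺⊆X y∈)
    ... | no  none = inj₁ λ x∈ → let X , X∈𝒮 , x∈X = ⟪⟫⁻ x∈ in below X X∈𝒮 x∈X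
      where
      below : ∀ X → X ∈ 𝒮 → X ⊆ Y
      below X X∈𝒮 with compare (towers X X∈𝒮) tY
      ... | inj₁ X⊆Y  = X⊆Y
      ... | inj₂ Y⁺⊆X = contradiction (X , X∈𝒮 , λ {_} → Y⁺⊆X) none

    infix 4 _≺_
    _≺_ : A → A → Set
    x ≺ y = ∃ λ X → Tower X × x ∈ X × ¬ y ∈ X

    -- The largest stage of the tower that omits x; x is the element added to it.
    before : A → Subset A
    before x = union ⟪ (λ X → Tower X × ¬ x ∈ X) ⟫

    before-tower : ∀ x → Tower (before x)
    before-tower x = unionᵀ _ λ X X∈ → proj₁ (⟪⟫⁻ X∈)

    before-∌ : ∀ x → ¬ x ∈ before x
    before-∌ x x∈ = let X , X∈ , x∈X = ⟪⟫⁻ x∈ in proj₂ (⟪⟫⁻ X∈) x∈X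

    -- If the next stage still omitted x, it would be among the stages whose union is `before x`,
    -- although it contains an element new to that union.
    before-new : ∀ x → IsNew (before x) x
    before-new x with em {x ∈ next (before x)}
    ... | yes x∈ with ⟪⟫⁻ x∈
    ...   | inj₁ x∈before = contradiction x∈before (before-∌ x)
    ...   | inj₂ isNew    = isNew
    before-new x | no x∉ =
      let y , y-new = new-exists (before x) (x , before-∌ x)
          y∈before  = ⟪⟫⁺ (next (before x) , ⟪⟫⁺ (nextᵀ (before-tower x) , x∉) , ⟪⟫⁺ (inj₂ y-new))
      in contradiction y∈before (isNew-fresh (before x) y-new)

    ≺-connex : ∀ x y → x ≢ y → x ≺ y ⊎ y ≺ x
    ≺-connex x y x≢y with em {x ∈ before y} | em {y ∈ before x}
    ... | yes x∈ | _      = inj₁ (before y , before-tower y , x∈ , before-∌ y)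
    ... | no _   | yes y∈ = inj₂ (before x , before-tower x , y∈ , before-∌ x)
    ... | no x∉  | no y∉  = contradiction
      (isNew-unique (before y) (subst (λ X → IsNew X x) same (before-new x)) (before-new y)) x≢y
      where
      maximal : ∀ {u v} → ¬ u ∈ before v → before v ⊆ before u
      maximal {u} {v} u∉ z∈ = ⟪⟫⁺ (before v , ⟪⟫⁺ (before-tower v , u∉) , z∈)
      same : before x ≡ before y
      same = ⊆-antisym (maximal y∉) (maximal x∉)

    -- A predecessor of the element added to X lies in a stage that omits this element. Such a stage
    -- cannot contain `next X`, so it is contained in X, where the induction hypothesis applies.
    tower-accessible : ∀ {X} → Tower X → ∀ {x} → x ∈ X → Acc _≺_ x
    tower-accessible (nextᵀ {X} tX) x∈ with ⟪⟫⁻ x∈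
    ... | inj₁ x∈X   = tower-accessible tX x∈X
    ... | inj₂ x-new = acc λ (Z , tZ , y∈Z , x∉Z) → case compare tZ tX of λ where
      (inj₁ Z⊆X)  → tower-accessible tX (Z⊆X y∈Z)
      (inj₂ X⁺⊆Z) → contradiction (X⁺⊆Z (⟪⟫⁺ (inj₂ x-new))) x∉Z
    tower-accessible (unionᵀ 𝒮 towers) x∈ =
      let X , X∈𝒮 , x∈X = ⟪⟫⁻ x∈ in tower-accessible (towers X X∈𝒮) x∈X

    ≺-wellFounded : WellFounded _≺_
    ≺-wellFounded x = acc λ (Z , tZ , y∈Z , _) → tower-accessible tZ y∈Z

  -- A well-ordering with countable initial segments, from CH

  record Ω₁ (B : Set) : Set₁ where
    field
      I             : Set
      _≺_           : I → I → Set
      ≺-wellFounded : WellFounded _≺_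
      ≺-connex      : ∀ i j → i ≢ j → i ≺ j ⊎ j ≺ i
      ≺-countable   : ∀ i → ∃ λ (e : ℕ → Maybe I) → ∀ j → j ≺ i → ∃ λ n → e n ≡ just j
      value         : I → B
      value-onto    : ∀ b → ∃ λ i → value i ≡ b

  module _ (ch : ContinuumHypothesis) where

    open WellOrdering ℝ

    segment : ℝ → Subset ℝ
    segment x = ⟪ _≺ x ⟫

    countable-initial : Subset ℝ
    countable-initial = ⟪ Countable ∘ segment ⟫

    least-outside : ∀ {x} → Acc _≺_ x → ¬ x ∈ countable-initial →
                    ∃ λ y → ¬ y ∈ countable-initial × segment y ⊆ countable-initial
    least-outside {x} (acc rs) x∉ with em {∃ λ y → y ≺ x × ¬ y ∈ countable-initial}
    ... | yes (y , y≺x , y∉) = least-outside (rs y≺x) y∉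
    ... | no  none           = x , x∉ , λ y∈ → stable λ y∉ → none (_ , ⟪⟫⁻ y∈ , y∉)

    -- If some real has uncountably many predecessors, the least such real has all its predecessors
    -- in `countable-initial`, which is therefore uncountable; by CH it is then equinumerous with ℝ.
    countable-initial-onto : ∃ λ (f : Element countable-initial → ℝ) → ∀ y → ∃ λ x → f x ≡ y
    countable-initial-onto with em {∃ λ x → ¬ x ∈ countable-initial}
    ... | no  none    = proj₁ , λ y → (y , stable λ y∉ → none (y , y∉)) , refl
    ... | yes (x , x∉) with ch countable-initial
    ...   | inj₂ bijection = Bijection.to bijection ,
            λ y → let z , eq = Bijection.surjective bijection y in z , eq refl
    ...   | inj₁ countable = contradiction (⟪⟫⁺ y-countable) y∉
      where
      y = proj₁ (least-outside (≺-wellFounded x) x∉)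
      y∉ = proj₁ (proj₂ (least-outside (≺-wellFounded x) x∉))
      y⊆ = proj₂ (proj₂ (least-outside (≺-wellFounded x) x∉))
      y-countable : Countable (segment y)
      y-countable = record
        { to = λ (z , z∈) → Injection.to countable (z , y⊆ z∈)
        ; cong = λ { refl → refl }
        ; injective = λ eq → Element-≡ (cong proj₁ (Injection.injective countable eq)) }

    continuum-Ω₁ : ∀ {B} → ∃ (λ (f : ℝ → B) → ∀ b → ∃ λ x → f x ≡ b) → Ω₁ B
    continuum-Ω₁ (f , f-onto) = record
      { I = Element countable-initial
      ; _≺_ = λ i j → proj₁ i ≺ proj₁ j
      ; ≺-wellFounded = λ i → accessible (≺-wellFounded (proj₁ i))
      ; ≺-connex = λ i j i≢j → ≺-connex _ _ (i≢j ∘ Element-≡)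
      ; ≺-countable = λ i → enumeration i , covers i
      ; value = f ∘ proj₁ countable-initial-onto
      ; value-onto = λ b →
          let y , fy≡b = f-onto b ; i , eq = proj₂ countable-initial-onto y
          in i , trans (cong f eq) fy≡b
      }
      where
      J : Set
      J = Element countable-initial

      accessible : ∀ {i : J} → Acc _≺_ (proj₁ i) → Acc (λ i j → proj₁ i ≺ proj₁ j) i
      accessible (acc rs) = acc λ j≺i → accessible (rs j≺i)

      numbering : (i : J) → Element (segment (proj₁ i)) ↣ ℕ
      numbering i = ⟪⟫⁻ (proj₂ i)

      At : J → ℕ → J → Set
      At i n j = ∃ λ (j∈ : proj₁ j ∈ segment (proj₁ i)) → Injection.to (numbering i) (proj₁ j , j∈) ≡ n

      enumeration : J → ℕ → Maybe J
      enumeration i n with em {∃ (At i n)}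
      ... | yes (j , _) = just j
      ... | no  _       = nothing

      covers : ∀ i j → proj₁ j ≺ proj₁ i → ∃ λ n → enumeration i n ≡ just j
      covers i j j≺i = n , found
        where
        j∈ : proj₁ j ∈ segment (proj₁ i)
        j∈ = ⟪⟫⁺ j≺i
        n = Injection.to (numbering i) (proj₁ j , j∈)
        found : enumeration i n ≡ just j
        found with em {∃ (At i n)}
        ... | yes (k , k∈ , eq) =
          cong just (Element-≡ (cong proj₁ (Injection.injective (numbering i) eq)))
        ... | no  none = contradiction (j , j∈ , refl) none

  -- Two constructions by finite approximation

  -- This supplies the promised set at a good stage; C will list the earlier points and the
  -- rationals off the facet. Each c gets a hole missing the finitely many points chosen so far, and
  -- each new point is chosen off the finitely many holes.
  module Avoid {k} (B : Fin k → Subset ℚ) (C : ℕ → Maybe ℝ) where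

    X : ℚ → Set
    X v = ∃ λ j → v ∈ B j

    module _ (X-dense : ∀ {x} → X x → ∀ {p q} → Between p q x →
                        ∀ j → ∃ λ v → Between p q v × v ∈ B j)
             (C-outside : ∀ n {c} → C n ≡ just c → ∀ {x} → X x → real x ≢ c)
             {x₀ : ℚ} (x₀∈X : X x₀) where

      -- Strictness keeps a whole neighbourhood of a point off a hole, and this is where later
      -- points close to it find room.
      Outside : ℚ → ℚ × ℚ → Set
      Outside v (p , q) = v ℚ.< p ⊎ q ℚ.< v

      -- A finite approximation: points already chosen, and closed intervals that all
      -- points must avoid.
      record Approximation : Set where
        field
          points  : List ℚ
          holes   : List (ℚ × ℚ)
          inX     : ∀ {v} → v ∈ᴸ points → X v
          outside : ∀ {v N} → v ∈ᴸ points → N ∈ᴸ holes → Outside v N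

      open Approximation

      _≼_ : Approximation → Approximation → Set
      s ≼ t = (∀ {v} → v ∈ᴸ points s → v ∈ᴸ points t) × (∀ {N} → N ∈ᴸ holes s → N ∈ᴸ holes t)

      ≼-refl : ∀ {s} → s ≼ s
      ≼-refl = id , id

      ≼-trans : ∀ {s t u} → s ≼ t → t ≼ u → s ≼ u
      ≼-trans (f , g) (f′ , g′) = f′ ∘ f , g′ ∘ g

      hole-around : ∀ {c} vs → (∀ {v} → v ∈ᴸ vs → real v ≢ c) →
                    ∃₂ λ p q → c ∈⟮ p , q ⟯ × (∀ {v} → v ∈ᴸ vs → Outside v (p , q))
      hole-around {c} [] _ =
        let p , p<c = ℚ-unbounded-below c ; q , c<q = ℚ-unbounded-above c
        in p , q , (p<c , c<q) , λ ()
      hole-around {c} (v ∷ vs) vs≢c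
        with p , q , (p<c , c<q) , out ← hole-around vs (vs≢c ∘ there)
        with ≢⇒<⊎> (vs≢c (here refl))
      ... | inj₁ v<c = let r , p<r , v<r , r<c = closer-below p<c v<c in
        r , q , (r<c , c<q) , λ where
          (here refl) → inj₁ v<r
          (there w∈)  → Sum.map₁ (λ w<p → ℚ.<-trans w<p p<r) (out w∈)
      ... | inj₂ c<v = let r , r<q , r<v , c<r = closer-above c<q c<v in
        p , r , (p<c , c<r) , λ where
          (here refl) → inj₂ r<v
          (there w∈)  → Sum.map₂ (ℚ.<-trans r<q) (out w∈)

      clearing : ∀ {x p q} Ns → Between p q x → (∀ {N} → N ∈ᴸ Ns → Outside x N) →
                 ∃₂ λ p′ q′ → Between p′ q′ x ×
                   (∀ {v} → Between p′ q′ v → Between p q v × (∀ {N} → N ∈ᴸ Ns → Outside v N))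
      clearing {x} {p} {q} [] x∈ _ = p , q , x∈ , λ v∈ → v∈ , λ ()
      clearing {x} (N ∷ Ns) x∈ out
        with p , q , (p<x , x<q) , clear ← clearing Ns x∈ (out ∘ there)
        with out (here refl)
      ... | inj₁ x<l = let r , r<q , r<l , x<r = closer-above (real-mono x<q) (real-mono x<l) in
        p , r , (p<x , real-reflects x<r) , λ (p<v , v<r) →
          let v∈ , v-out = clear (p<v , ℚ.<-trans v<r r<q) in v∈ , λ where
            (here refl) → inj₁ (ℚ.<-trans v<r r<l)
            (there N∈)  → v-out N∈
      ... | inj₂ h<x = let r , p<r , h<r , r<x = closer-below (real-mono p<x) (real-mono h<x) in
        r , q , (real-reflects r<x , x<q) , λ (r<v , v<q) →
          let v∈ , v-out = clear (ℚ.<-trans p<r r<v , v<q) in v∈ , λ where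
            (here refl) → inj₂ (ℚ.<-trans h<r r<v)
            (there N∈)  → v-out N∈

      Demand : Set
      Demand = (ℚ × (ℚ × ℚ)) × Fin k

      -- Every demand is met at infinitely many stages, thanks to the second component.
      demands : Enumerable (Demand × ℕ)
      demands = ×-enumerable
        (×-enumerable (×-enumerable ℚ-enumerable (×-enumerable ℚ-enumerable ℚ-enumerable)) Fin-enumerable)
        ℕ-enumerable

      Met : Demand → Approximation → Approximation → Set
      Met ((x , p , q) , j) s t =
        x ∈ᴸ points s → Between p q x → ∃ λ v → v ∈ᴸ points t × Between p q v × v ∈ B j

      Avoids : ℝ → Approximation → Set
      Avoids c t = ∃₂ λ p q → (p , q) ∈ᴸ holes t × c ∈⟮ p , q ⟯

      Step : ℕ → Approximation → Approximation → Set
      Step n s t = (∀ {c} → C n ≡ just c → Avoids c t) ×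
                   (∀ {d m} → element demands n ≡ just (d , m) → Met d s t)

      add-hole : ∀ n s → ∃ λ t → s ≼ t × points t ≡ points s × (∀ {c} → C n ≡ just c → Avoids c t)
      add-hole n s with C n in Cn
      ... | nothing = s , ≼-refl {s} , refl , λ ()
      ... | just c =
        let p , q , c∈ , out = hole-around (points s) (λ v∈ → C-outside n Cn (inX s v∈)) in
        record
          { points  = points s
          ; holes   = (p , q) ∷ holes s
          ; inX     = inX s
          ; outside = λ where
              v∈ (here refl) → out v∈
              v∈ (there N∈)  → outside s v∈ N∈
          } , (id , there) , refl , λ { refl → p , q , here refl , c∈ }

      add-point : ∀ d s → ∃ λ t → s ≼ t × Met d s t
      add-point ((x , p , q) , j) s with em {x ∈ᴸ points s × Between p q x}
      ... | no  no-demand   = s , ≼-refl {s} , λ x∈ x∈pq → contradiction (x∈ , x∈pq) no-demand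
      ... | yes (x∈ , x∈pq) =
        let p′ , q′ , x∈p′q′ , clear = clearing (holes s) x∈pq (outside s x∈)
            v , v∈p′q′ , v∈B = X-dense (inX s x∈) x∈p′q′ j
            v∈pq , v-out = clear v∈p′q′
        in record
          { points  = v ∷ points s
          ; holes   = holes s
          ; inX     = λ where
              (here refl) → j , v∈B
              (there w∈)  → inX s w∈
          ; outside = λ where
              (here refl) N∈ → v-out N∈
              (there w∈) N∈  → outside s w∈ N∈
          } , (there , id) , λ _ _ → v , here refl , v∈pq , v∈B

      step : ∀ n s → ∃ λ t → s ≼ t × Step n s t
      step n s with t , s≼t , pts , hole ← add-hole n s with element demands n
      ... | nothing = t , s≼t , hole , λ ()
      ... | just (d , m) =
        let u , t≼u , met = add-point d t in
        u , ≼-trans {s} {t} {u} s≼t t≼u ,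
        (λ eq → let p , q , N∈ , c∈ = hole eq in p , q , proj₂ t≼u N∈ , c∈) ,
        -- Making the hole has added no points, so a demand concerning s is one concerning t.
        λ { refl x∈ → met (subst (_ ∈ᴸ_) (sym pts) x∈) }

      initial : Approximation
      initial = record
        { points = x₀ ∷ [] ; holes = [] ; inX = λ { (here refl) → x₀∈X } ; outside = λ _ () }

      open GenericSequence _≼_ (λ {s} → ≼-refl {s}) (λ {s} {t} {u} → ≼-trans {s} {t} {u})
        Step initial step

      avoid : ∃ λ Y → (∀ {v} → v ∈ Y → X v) × (∃ λ v → v ∈ Y) ×
        (∀ {x} → x ∈ Y → ∀ {p q} → Between p q x → ∀ j → ∃ λ v → Between p q v × v ∈ Y × v ∈ B j) ×
        (∀ n {c} → C n ≡ just c → Gap Y c)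
      avoid = Y , (λ v∈ → let n , v∈n = ⟪⟫⁻ v∈ in inX (stage n) v∈n) ,
        (x₀ , ⟪⟫⁺ (0 , subst (λ s → x₀ ∈ᴸ points s) (sym stage-zero) (here refl))) , Y-dense , Y-avoids
        where
        Y : Subset ℚ
        Y = ⟪ (λ v → ∃ λ n → v ∈ᴸ points (stage n)) ⟫

        Y-dense : ∀ {x} → x ∈ Y → ∀ {p q} → Between p q x →
                  ∀ j → ∃ λ v → Between p q v × v ∈ Y × v ∈ B j
        Y-dense {x} x∈ {p} {q} x∈pq j =
          let m , x∈m = ⟪⟫⁻ x∈
              d = (x , p , q) , j
              n = index demands (d , m)
              x∈n = proj₁ (stage-mono (ℕ.m≤n+m m _)) x∈m
              v , v∈n , v∈pq , v∈B =
                proj₂ (stage-step n) (element-index demands (d , m)) x∈n x∈pq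
          in v , v∈pq , ⟪⟫⁺ (suc n , v∈n) , v∈B

        Y-avoids : ∀ n {c} → C n ≡ just c → Gap Y c
        Y-avoids n eq =
          let p , q , N∈ , c∈ = proj₁ (stage-step n) eq in
          p , q , c∈ , λ v (p<v , v<q) v∈ →
            let m , v∈m = ⟪⟫⁻ v∈
                l = m ℕ.⊔ suc n
                v∈l = proj₁ (stage-mono (ℕ.m≤m⊔n m (suc n))) v∈m
                N∈l = proj₂ (stage-mono (ℕ.m≤n⊔m m (suc n))) N∈
            in case outside (stage l) v∈l N∈l of λ where
                 (inj₁ v<p) → ℚ.<-asym v<p p<v
                 (inj₂ q<v) → ℚ.<-asym q<v v<q

  -- The category argument in the closure of X, which supplies the new point at a bad stage. Every
  -- neighbourhood keeps a centre in X, so the limit is adherent to X; the rationals are excluded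
  -- one by one, so the limit is irrational.
  module Baire (X : ℚ → Set) (K : ℕ → Subset ℚ)
    (escape : ∀ n {x} → X x → ∀ {p q} → Between p q x →
              ∃ λ v → X v × Between p q v × Gap (K n) (real v))
    (not-isolated : ∀ r {x} → X x → ∀ {p q} → Between p q x → ∃ λ v → X v × Between p q v × v ≢ r)
    {x₀ : ℚ} (x₀∈X : X x₀) where

    record Neighbourhood : Set where
      field
        {left′ right′ centre} : ℚ
        centre∈X              : X centre
        left<centre           : left′ ℚ.< centre
        centre<right          : centre ℚ.< right′

    open Neighbourhood

    _≼_ : Neighbourhood → Neighbourhood → Set
    s ≼ t = left′ s ℚ.≤ left′ t × right′ t ℚ.≤ right′ s

    ≼-trans : ∀ {s t u} → s ≼ t → t ≼ u → s ≼ u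
    ≼-trans (a , b) (c , d) = ℚ.≤-trans a c , ℚ.≤-trans d b

    Step : ℕ → Neighbourhood → Neighbourhood → Set
    Step n s t = left′ s ℚ.< left′ t × right′ t ℚ.< right′ s ×
      (∀ v → Between (left′ t) (right′ t) v → ¬ v ∈ K n) ×
      (∀ {r} → element ℚ-enumerable n ≡ just r → r ℚ.< left′ t ⊎ right′ t ℚ.< r)

    shrink : ∀ {s x p q} → X x → Between (left′ s) (right′ s) x → Between p q x →
             ∃ λ t → left′ s ℚ.< left′ t × right′ t ℚ.< right′ s × p ℚ.< left′ t × right′ t ℚ.< q
    shrink x∈ (l<x , x<r) (p<x , x<q) =
      let l , a , b , l<x′ = closer-below (real-mono l<x) (real-mono p<x)
          r , c , d , x<r′ = closer-above (real-mono x<r) (real-mono x<q)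
      in record { centre∈X = x∈ ; left<centre = real-reflects l<x′ ; centre<right = real-reflects x<r′ }
         , a , c , b , d

    exclude : ∀ r s → ∃ λ t → s ≼ t × (r ℚ.< left′ t ⊎ right′ t ℚ.< r)
    exclude r s with not-isolated r (centre∈X s) (left<centre s , centre<right s)
    ... | v , v∈X , v∈s@(l<v , v<r) , v≢r with ℚ.<-cmp v r
    ...   | tri≈ _ v≡r _ = contradiction v≡r v≢r
    ...   | tri< v<r′ _ _ = let t , a , b , _ , c = shrink {s} v∈X v∈s (l<v , v<r′) in
      t , (ℚ.<⇒≤ a , ℚ.<⇒≤ b) , inj₂ c
    ...   | tri> _ _ r<v  = let t , a , b , c , _ = shrink {s} v∈X v∈s (r<v , v<r) in
      t , (ℚ.<⇒≤ a , ℚ.<⇒≤ b) , inj₁ c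

    step : ∀ n s → ∃ λ t → s ≼ t × Step n s t
    step n s
      with v , v∈X , v∈s , (p , q , v∈pq , free) ← escape n (centre∈X s) (left<centre s , centre<right s)
      with t , a , b , c , d ← shrink {s} v∈X v∈s (∈⇒Between v∈pq)
      with element ℚ-enumerable n
    ... | nothing = t , (ℚ.<⇒≤ a , ℚ.<⇒≤ b) , a , b ,
      (λ w (l<w , w<r) → free w (ℚ.<-trans c l<w , ℚ.<-trans w<r d)) , λ ()
    ... | just r =
      let u , (e , f) , r-out = exclude r t in
      u , (ℚ.≤-trans (ℚ.<⇒≤ a) e , ℚ.≤-trans f (ℚ.<⇒≤ b)) ,
      ℚ.<-≤-trans a e , ℚ.≤-<-trans f b ,
      (λ w (l<w , w<r) → free w (ℚ.<-trans c (ℚ.≤-<-trans e l<w) , ℚ.<-trans (ℚ.<-≤-trans w<r f) d)) ,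
      λ { refl → r-out }

    start : Neighbourhood
    start = record
      { centre∈X     = x₀∈X
      ; left<centre  = real-reflects (proj₂ (ℚ-unbounded-below (real x₀)))
      ; centre<right = real-reflects (proj₂ (ℚ-unbounded-above (real x₀))) }

    open GenericSequence _≼_ (ℚ.≤-refl , ℚ.≤-refl) (λ {s} {t} {u} → ≼-trans {s} {t} {u}) Step start step

    open Nested (λ n → left′ (stage n)) (λ n → right′ (stage n))
      (λ n → proj₁ (stage-step n)) (λ n → proj₁ (proj₂ (stage-step n)))
      (λ n → ℚ.<-trans (left<centre (stage n)) (centre<right (stage n)))
      public

    limit-gap : ∀ n → Gap (K n) limit
    limit-gap n = _ , _ , limit-∈ (suc n) , proj₁ (proj₂ (proj₂ (stage-step n)))

    eventually-outside : ∀ r → ∃ λ n → r ℚ.< left′ (stage n) ⊎ right′ (stage n) ℚ.< r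
    eventually-outside r = suc (index ℚ-enumerable r) ,
      proj₂ (proj₂ (proj₂ (stage-step _))) (element-index ℚ-enumerable r)

    limit-irrational : Irrational limit
    limit-irrational r eq with eventually-outside r
    ... | n , inj₁ r<l = <-irrefl (<-trans (subst (_< _) (sym eq) (real-mono r<l)) (proj₁ (limit-∈ n)))
    ... | n , inj₂ h<r = <-irrefl (<-trans (proj₂ (limit-∈ n)) (subst (_ <_) (sym eq) (real-mono h<r)))

    -- Convergence comes from the exclusion of the rationals, with no estimate of lengths: a
    -- rational below the limit ends up outside the intervals, hence on their left.
    left-after : ∀ {p} → real p < limit → ∃ λ n → p ℚ.< left′ (stage n)
    left-after {p} p<x with eventually-outside p
    ... | n , inj₁ p<l = n , p<l
    ... | n , inj₂ h<p = contradiction (<-trans p<x (proj₂ (limit-∈ n))) (<-asym (real-mono h<p))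

    right-before : ∀ {q} → limit < real q → ∃ λ n → right′ (stage n) ℚ.< q
    right-before {q} x<q with eventually-outside q
    ... | n , inj₁ q<l = contradiction (<-trans (proj₁ (limit-∈ n)) x<q) (<-asym (real-mono q<l))
    ... | n , inj₂ h<q = n , h<q

    limit-closure : ∀ p q → limit ∈⟮ p , q ⟯ → ∃ λ v → Between p q v × X v
    limit-closure p q (p<x , x<q) =
      let m , p<l = left-after p<x
          n , h<q = right-before x<q
          s = stage (m ℕ.⊔ n)
          lm , _ = stage-mono (ℕ.m≤m⊔n m n)
          _ , hn = stage-mono (ℕ.m≤n⊔m m n)
      in centre s , (ℚ.<-trans (ℚ.<-≤-trans p<l lm) (left<centre s) ,
                     ℚ.<-trans (centre<right s) (ℚ.≤-<-trans hn h<q)) , centre∈X s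

  -- Separating facets by a set of reals

  Gap-⊆ : ∀ {Y Z x} → Y ⊆ Z → Gap Z x → Gap Y x
  Gap-⊆ Y⊆Z (p , q , x∈ , free) = p , q , x∈ , λ v v∈pq v∈Y → free v v∈pq (Y⊆Z v∈Y)

  Gap-empty : ∀ {Y} x → (∀ {v} → ¬ v ∈ Y) → Gap Y x
  Gap-empty x none =
    let p , p<x = ℚ-unbounded-below x ; q , x<q = ℚ-unbounded-above x
    in p , q , (p<x , x<q) , λ _ _ → none

  decode : {A : Set} (Code : A → ℕ → Set) → (∀ {a b n} → Code a n → Code b n → a ≡ b) →
           ∃ λ (C : ℕ → Maybe A) → (∀ {n a} → C n ≡ just a → Code a n) ×
                                   (∀ {n a} → Code a n → C n ≡ just a)
  decode {A} Code unique = C , sound , complete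
    where
    C : ℕ → Maybe A
    C n with em {∃ λ a → Code a n}
    ... | yes (a , _) = just a
    ... | no  _       = nothing
    sound : ∀ {n a} → C n ≡ just a → Code a n
    sound {n} eq with em {∃ λ a → Code a n}
    sound refl | yes (_ , code-a) = code-a
    complete : ∀ {n a} → Code a n → C n ≡ just a
    complete {n} {a} code-a with em {∃ λ a → Code a n}
    ... | yes (_ , code-b) = cong just (unique code-b code-a)
    ... | no  none         = contradiction (a , code-a) none

  module Separation (ch : ContinuumHypothesis) {Colour Facet : Set} (_∈ᶠ_ : Colour → Facet → Set)
    (colour : ℚ → Colour) (facet-of : ∀ c → ∃ λ F → c ∈ᶠ F) (k : ℕ) where

    Parts : Set
    Parts = Fin (suc k) → Subset ℚ

    Union : Parts → ℚ → Set
    Union B v = ∃ λ j → v ∈ B j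

    record Good (B : Parts) : Set where
      field
        facet    : Facet
        coloured : ∀ {v} → Union B v → colour v ∈ᶠ facet
        nonempty : ∃ (Union B)
        dense    : ∀ {x} → Union B x → ∀ {p q} → Between p q x →
                   ∀ j → ∃ λ v → Between p q v × v ∈ B j

    record Bad (X : ℚ → Set) : Set where
      field
        nonempty : ∃ X
        leaves   : ∀ F {x} → X x → ∀ {p q} → Between p q x →
                   ∃ λ v → X v × Between p q v × ¬ colour v ∈ᶠ F

    Refines : Parts → Subset ℚ → Set
    Refines B Y = (∀ {v} → v ∈ Y → Union B v) × (∃ λ v → v ∈ Y) ×
      (∀ {x} → x ∈ Y → ∀ {p q} → Between p q x → ∀ j → ∃ λ v → Between p q v × v ∈ Y × v ∈ B j)

    -- This is the condition on promises that keeps bad stages possible. A bad set has, in every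
    -- neighbourhood of its points, rationals coloured outside F, and around these the promise
    -- leaves a gap; so promises are nowhere dense relative to a bad set.
    Thin : Subset ℚ → Set
    Thin Y = ∃ λ F → ∀ u → ¬ colour u ∈ᶠ F → Gap Y (real u)

    not-both : ∀ {B} → Good B → ¬ Bad (Union B)
    not-both good bad =
      let open Good good
          x , x∈ = Bad.nonempty bad
          p , p<x = ℚ-unbounded-below (real x)
          q , x<q = ℚ-unbounded-above (real x)
          v , v∈ , _ , v∉F = Bad.leaves bad facet x∈ (real-reflects p<x , real-reflects x<q)
      in v∉F (coloured v∈)

    Output : Set
    Output = Subset ℚ × Maybe ℝ

    opaque
      parts-Ω₁ : Ω₁ (Subset (Fin (suc k) × ℚ))
      parts-Ω₁ = continuum-Ω₁ ch (ℝ-onto-power (×-enumerable Fin-enumerable ℚ-enumerable))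

    open Ω₁ parts-Ω₁

    parts : I → Parts
    parts i j v = value i (j , v)

    -- Stage i yields a set promised to stay clear of the final set of reals, and possibly
    -- a member of the latter.
    record Spec (i : I) (prev : I → Output) (Y : Subset ℚ) (point : Maybe ℝ) : Set where
      field
        thin        : Thin Y
        irrational  : ∀ {x} → point ≡ just x → Irrational x
        gap         : ∀ {x} → point ≡ just x → Gap Y x
        gap-earlier : ∀ {x} → point ≡ just x → ∀ {j} → j ≺ i → Gap (proj₁ (prev j)) x
        gap-later   : ∀ {x j} → j ≺ i → proj₂ (prev j) ≡ just x → Gap Y x
        if-good     : Good (parts i) → Refines (parts i) Y
        if-bad      : Bad (Union (parts i)) → ∃ λ x → point ≡ just x ×
                      (∀ p q → x ∈⟮ p , q ⟯ → ∃ λ v → Between p q v × Union (parts i) v)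

    Sound : Output → Set
    Sound (Y , point) = Thin Y × (∀ {x} → point ≡ just x → Irrational x)

    ∅ : Subset ℚ
    ∅ _ = false

    ∅-thin : Thin ∅
    ∅-thin = proj₁ (facet-of (colour 0ℚ)) , λ u _ → Gap-empty (real u) λ ()

    module _ (i : I) (prev : I → Output) (prev-sound : ∀ {j} → j ≺ i → Sound (prev j)) where

      earlier : ℕ → Maybe I
      earlier = proj₁ (≺-countable i)

      stage-bad : Bad (Union (parts i)) → ∃ λ x → Spec i prev ∅ (just x)
      stage-bad bad = limit , record
        { thin = ∅-thin
        ; irrational = λ { refl → limit-irrational }
        ; gap = λ _ → Gap-empty _ λ ()
        ; gap-earlier = λ { refl j≺i →
            let n , eq = proj₂ (≺-countable i) _ j≺i
            in Gap-⊆ {proj₁ (prev _)} {earlierPromise n} (λ v∈ → ⟪⟫⁺ (_ , eq , j≺i , v∈)) (limit-gap n) }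
        ; gap-later = λ _ _ → Gap-empty _ λ ()
        ; if-good = λ good → contradiction bad (not-both good)
        ; if-bad = λ _ → limit , refl , limit-closure
        }
        where
        earlierPromise : ℕ → Subset ℚ
        earlierPromise n = ⟪ (λ v → ∃ λ j → earlier n ≡ just j × j ≺ i × v ∈ proj₁ (prev j)) ⟫

        earlierPromise-thin : ∀ n → Thin (earlierPromise n)
        earlierPromise-thin n with em {∃ λ j → earlier n ≡ just j × j ≺ i}
        ... | no none = proj₁ ∅-thin , λ u _ → Gap-empty {earlierPromise n} (real u) λ v∈ →
          let j , eq , j≺i , _ = ⟪⟫⁻ v∈ in none (j , eq , j≺i)
        ... | yes (j , eq , j≺i) = let F , free = proj₁ (prev-sound j≺i) in
          F , λ u u∉F → Gap-⊆ {earlierPromise n} {proj₁ (prev j)} (λ v∈ → let j′ , eq′ , _ , v∈Y = ⟪⟫⁻ v∈ in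
                subst (λ l → _ ∈ proj₁ (prev l)) (just-injective (trans (sym eq′) eq)) v∈Y)
              (free u u∉F)

        escape : ∀ n {x} → Union (parts i) x → ∀ {p q} → Between p q x →
                 ∃ λ v → Union (parts i) v × Between p q v × Gap (earlierPromise n) (real v)
        escape n x∈ x∈pq =
          let F , free = earlierPromise-thin n ; v , v∈ , v∈pq , v∉F = Bad.leaves bad F x∈ x∈pq
          in v , v∈ , v∈pq , free v v∉F

        not-isolated : ∀ r {x} → Union (parts i) x → ∀ {p q} → Between p q x →
                       ∃ λ v → Union (parts i) v × Between p q v × v ≢ r
        -- A facet containing the colour of r serves to tell v from r: the point v leaves this
        -- facet.
        not-isolated r x∈ x∈pq =
          let F , r∈F = facet-of (colour r) ; v , v∈ , v∈pq , v∉F = Bad.leaves bad F x∈ x∈pq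
          in v , v∈ , v∈pq , λ v≡r → v∉F (subst (λ w → colour w ∈ᶠ F) (sym v≡r) r∈F)

        open Baire (Union (parts i)) earlierPromise escape not-isolated
          {proj₁ (Bad.nonempty bad)} (proj₂ (Bad.nonempty bad))

      stage-good : Good (parts i) → ∃ λ Y → Spec i prev Y nothing
      stage-good good = Y , record
        { thin = facet , λ u u∉F → gaps (inj₂ (u , refl , u∉F , refl))
        ; irrational = λ ()
        ; gap = λ ()
        ; gap-earlier = λ ()
        ; gap-later = λ j≺i eq →
            let n , found = proj₂ (≺-countable i) _ j≺i in gaps (inj₁ (_ , n , found , j≺i , eq , refl))
        ; if-good = λ _ → refines
        ; if-bad = λ bad → contradiction bad (not-both good)
        }
        where
        open Good good

        -- The new promise avoids the earlier points because it has to respect them, and the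
        -- rationals off the facet in order to be thin.
        Code : ℝ → ℕ → Set
        Code c n = (∃₂ λ j m → earlier m ≡ just j × j ≺ i × proj₂ (prev j) ≡ just c × n ≡ pair 0 m) ⊎
                   (∃ λ u → c ≡ real u × ¬ colour u ∈ᶠ facet × n ≡ pair 1 (index ℚ-enumerable u))

        unique : ∀ {c d n} → Code c n → Code d n → c ≡ d
        unique (inj₁ (j , m , eq , _ , pt , refl)) (inj₁ (j′ , m′ , eq′ , _ , pt′ , n≡))
          with proj₂ (pair-injective 0 m 0 m′ n≡)
        ... | refl with just-injective (trans (sym eq) eq′)
        ... | refl = just-injective (trans (sym pt) pt′)
        unique (inj₂ (u , refl , _ , refl)) (inj₂ (u′ , refl , _ , n≡)) =
          cong real (injective ℚ-enumerable
            (proj₂ (pair-injective 1 (index ℚ-enumerable u) 1 (index ℚ-enumerable u′) n≡)))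
        unique (inj₁ (_ , m , _ , _ , _ , refl)) (inj₂ (u , _ , _ , n≡)) =
          case proj₁ (pair-injective 0 m 1 (index ℚ-enumerable u) n≡) of λ ()
        unique (inj₂ (u , refl , _ , refl)) (inj₁ (_ , m , _ , _ , _ , n≡)) =
          case proj₁ (pair-injective 1 (index ℚ-enumerable u) 0 m n≡) of λ ()

        C = proj₁ (decode Code unique)

        -- For this purpose the points are irrational: a good family consists of rationals and so
        -- contains none of the earlier points.
        C-outside : ∀ n {c} → C n ≡ just c → ∀ {x} → Union (parts i) x → real x ≢ c
        C-outside n eq x∈ x≡c with proj₁ (proj₂ (decode Code unique)) eq
        ... | inj₁ (j , _ , _ , j≺i , pt , _) = proj₂ (prev-sound j≺i) pt _ (sym x≡c)
        ... | inj₂ (u , refl , u∉F , _)       =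
          u∉F (subst (λ v → colour v ∈ᶠ facet) (real-injective x≡c) (coloured x∈))

        avoided = Avoid.avoid (parts i) C dense C-outside (proj₂ nonempty)
        Y = proj₁ avoided

        refines : Refines (parts i) Y
        refines = let _ , Y⊆ , Y-nonempty , Y-dense , _ = avoided in Y⊆ , Y-nonempty , Y-dense

        gaps : ∀ {c n} → Code c n → Gap Y c
        gaps code-c = proj₂ (proj₂ (proj₂ (proj₂ avoided))) _ (proj₂ (proj₂ (decode Code unique)) code-c)

      stage-exists : ∃ λ (out : Output) → Spec i prev (proj₁ out) (proj₂ out)
      stage-exists with em {Bad (Union (parts i))} | em {Good (parts i)}
      ... | yes bad | _        = let x , spec = stage-bad bad in (∅ , just x) , spec
      ... | no _    | yes good = let Y , spec = stage-good good in (Y , nothing) , spec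
      ... | no ¬bad | no ¬good = (∅ , nothing) , record
        { thin = ∅-thin ; irrational = λ () ; gap = λ () ; gap-earlier = λ ()
        ; gap-later = λ _ _ → Gap-empty _ λ ()
        ; if-good = λ good → contradiction good ¬good ; if-bad = λ bad → contradiction bad ¬bad }

    -- The recursion is defined before its earlier outputs are known to be sound; soundness is
    -- therefore a hypothesis on the result, with a dummy output where it fails.
    choose : (i : I) (prev : I → Output) →
             ∃ λ (out : Output) → (∀ {j} → j ≺ i → Sound (prev j)) → Spec i prev (proj₁ out) (proj₂ out)
    choose i prev with em {∀ {j} → j ≺ i → Sound (prev j)}
    ... | yes sound = let out , spec = stage-exists i prev sound in out , λ _ → spec
    ... | no ¬sound = (∅ , nothing) , λ sound → contradiction (λ {j} → sound {j}) ¬sound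

    -- Indices not below i receive a default, which makes the earlier outputs a total function;
    -- `Spec` reads it below i only.
    extend : ∀ i → (∀ {j} → j ≺ i → Output) → I → Output
    extend i prev j with em {j ≺ i}
    ... | yes j≺i = prev j≺i
    ... | no  _   = ∅ , nothing

    extend-constant : ∀ (f : I → Output) {i j} → j ≺ i → extend i (λ {j} _ → f j) j ≡ f j
    extend-constant f {i} {j} j≺i with em {j ≺ i}
    ... | yes _  = refl
    ... | no j⊀i = contradiction j≺i j⊀i

    private
      module Fix = FixPoint ≺-wellFounded (λ _ → Output) (λ i prev → proj₁ (choose i (extend i prev)))
        (λ i same → cong (λ prev → proj₁ (choose i (extend i (λ {j} → prev j))))
                         (ext λ j → ext λ j≺i → same j≺i))

    output : I → Output
    output = All.wfRec ≺-wellFounded 0ℓ (λ _ → Output) (λ i prev → proj₁ (choose i (extend i prev)))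

    promise : I → Subset ℚ
    promise = proj₁ ∘ output

    point : I → Maybe ℝ
    point = proj₂ ∘ output

    previous : I → I → Output
    previous i = extend i (λ {j} _ → output j)

    spec : ∀ i → Spec i (previous i) (promise i) (point i)
    spec i = go (≺-wellFounded i)
      where
      go : ∀ {i} → Acc _≺_ i → Spec i (previous i) (promise i) (point i)
      go {i} (acc rs) = subst (λ out → Spec i (previous i) (proj₁ out) (proj₂ out))
        (sym Fix.unfold-wfRec)
        (proj₂ (choose i (previous i)) λ {j} j≺i →
          subst Sound (sym (extend-constant output j≺i))
            (Spec.thin (go (rs j≺i)) , Spec.irrational (go (rs j≺i))))

    opaque
      avoider : Subset ℝ
      avoider = ⟪ (λ x → ∃ λ i → point i ≡ just x) ⟫

      promises-kept : ∀ i {x} → x ∈ avoider → Gap (promise i) x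
      promises-kept i x∈ with j , eq ← ⟪⟫⁻ x∈ with em {i ≡ j}
      ... | yes refl = Spec.gap (spec j) eq
      ... | no  i≢j with ≺-connex i j i≢j
      ...   | inj₁ i≺j = subst (λ out → Gap (proj₁ out) _) (extend-constant output i≺j)
                           (Spec.gap-earlier (spec j) eq i≺j)
      ...   | inj₂ j≺i = Spec.gap-later (spec i) j≺i
                           (trans (cong proj₂ (extend-constant output j≺i)) eq)

    parts-onto : ∀ B → ∃ λ i → parts i ≡ B
    parts-onto B = let i , eq = value-onto (λ (j , v) → B j v) in
      i , cong (λ S j v → S (j , v)) eq

    avoider-good : ∀ B → Good B → ∃ λ Y → Refines B Y × (∀ {x} → x ∈ avoider → Gap Y x)
    avoider-good B good with parts-onto B
    ... | i , refl = promise i , Spec.if-good (spec i) good , promises-kept i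

    opaque
      unfolding avoider

      avoider-bad : ∀ X → Bad (_∈ X) → ∃ λ x → x ∈ avoider × Closure X x
      avoider-bad X bad with parts-onto (λ _ → X)
      ... | i , eq = let x , pt , closure = Spec.if-bad (spec i) (subst (Bad ∘ Union) (sym eq) bad′) in
        x , ⟪⟫⁺ (i , pt) , λ p q x∈ →
          let v , v∈pq , j , v∈ = closure p q x∈ in v , v∈pq , subst (λ (B : Parts) → v ∈ B j) eq v∈
        where
        bad′ : Bad (Union (λ _ → X))
        bad′ = record
          { nonempty = let x , x∈ = Bad.nonempty bad in x , zero , x∈
          ; leaves = λ F (_ , x∈) x∈pq →
              let v , v∈ , rest = Bad.leaves bad F x∈ x∈pq in v , (zero , v∈) , rest }

  -- A colouring of the rationals with all colours dense

  -- For every pair of a rational interval and a colour, a rational of its own is selected in the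
  -- interval. As the selected rationals are distinct, each can be given the colour for which it was
  -- selected.
  module Colouring {C : Set} (E : Enumerable C) (default : C) where

    private
      targets : Enumerable ((ℚ × ℚ) × C)
      targets = ×-enumerable (×-enumerable ℚ-enumerable ℚ-enumerable) E

      Serves : ℕ → ℚ → Set
      Serves n v = ∀ {p q c} → element targets n ≡ just ((p , q) , c) → p ℚ.< q → Between p q v

      clear-interval : ∀ {p q} → p ℚ.< q → (vs : List ℚ) →
        ∃₂ λ p′ q′ → p′ ℚ.< q′ × (∀ {v} → Between p′ q′ v → Between p q v × ¬ v ∈ᴸ vs)
      clear-interval {p} {q} p<q [] = p , q , p<q , λ v∈ → v∈ , λ ()
      clear-interval p<q (w ∷ vs)
        with p , q , below , clear ← clear-interval p<q vs with em {Between p q w}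
      ... | no w∉ = p , q , below , λ v∈ → let v∈′ , v∉ = clear v∈ in
        v∈′ , λ { (here refl) → w∉ v∈ ; (there v∈vs) → v∉ v∈vs }
      ... | yes (p<w , w<q) = p , w , p<w , λ (p<v , v<w) →
        let v∈′ , v∉ = clear (p<v , ℚ.<-trans v<w w<q) in
        v∈′ , λ { (here refl) → ℚ.<-irrefl refl v<w ; (there v∈vs) → v∉ v∈vs }

      fresh : ∀ n (vs : List ℚ) → ∃ λ v → Serves n v × ¬ v ∈ᴸ vs
      fresh n vs with element targets n in eq
      ... | nothing = let _ , _ , p<q , clear = clear-interval (ℚ.positive⁻¹ 1ℚ) vs
                          v , v∈ = ℚ.<-dense p<q
                      in v , (λ ()) , proj₂ (clear v∈)
      ... | just ((p , q) , c) with em {p ℚ.< q}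
      ...   | no p≮q  = let _ , _ , p<q , clear = clear-interval (ℚ.positive⁻¹ 1ℚ) vs
                            v , v∈ = ℚ.<-dense p<q
                        in v , (λ { refl p<q → contradiction p<q p≮q }) , proj₂ (clear v∈)
      ...   | yes p<q = let _ , _ , p′<q′ , clear = clear-interval p<q vs
                            v , v∈ = ℚ.<-dense p′<q′
                        in v , (λ { refl _ → proj₁ (clear v∈) }) , proj₂ (clear v∈)

      open Select id Serves fresh

      Serving : ℚ → Set
      Serving v = ∃₂ λ n p → ∃₂ λ q c → select n ≡ v × element targets n ≡ just ((p , q) , c)

    private
      paint : ℚ → C
      paint v with em {Serving v}
      ... | yes (_ , _ , _ , c , _) = c
      ... | no  _                   = default

      paint-dense : ∀ c {p q} → p ℚ.< q → ∃ λ v → Between p q v × paint v ≡ c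
      paint-dense c {p} {q} p<q = select n , select-∈ n found p<q , coloured
        where
        n = index targets ((p , q) , c)
        found : element targets n ≡ just ((p , q) , c)
        found = element-index targets ((p , q) , c)
        coloured : paint (select n) ≡ c
        coloured with em {Serving (select n)}
        ... | no none = contradiction (n , p , q , c , refl , found) none
        ... | yes (m , _ , _ , _ , same , found′) with select-distinct {m} {n} same
        ...   | refl = cong proj₂ (just-injective (trans (sym found′) found))

    opaque
      colour : ℚ → C
      colour = paint

      colour-dense : ∀ c {p q} → p ℚ.< q → ∃ λ v → Between p q v × colour v ≡ c
      colour-dense = paint-dense

  Tree-enumerable : Enumerable Tree
  Tree-enumerable = record { index = code′ ; injective = λ {s} {t} → code′-injective s t }
    where
    code′ : Tree → ℕ
    code′ leaf       = 0
    code′ (node s t) = suc (pair (code′ s) (code′ t))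
    code′-injective : ∀ s t → code′ s ≡ code′ t → s ≡ t
    code′-injective leaf leaf _ = refl
    code′-injective (node s t) (node s′ t′) eq =
      let p , q = pair-injective (code′ s) (code′ t) (code′ s′) (code′ t′) (ℕ.suc-injective eq)
      in cong₂ node (code′-injective s s′ p) (code′-injective t t′ q)

  -- Each tree has one colour for each of the three argument places of a relation.
  data Colour : Set where
    obj : Sort → Tree → Colour
    tag : Tag → Colour

  Colour-enumerable : Enumerable Colour
  Colour-enumerable .index (obj s t) = pair 0 (pair (toℕ s) (index Tree-enumerable t))
  Colour-enumerable .index (tag t)   = pair 1 (toℕ t)
  Colour-enumerable .injective {obj s t} {obj s′ t′} eq =
    let p , q = pair-injective (toℕ s) (index Tree-enumerable t) (toℕ s′) (index Tree-enumerable t′)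
                  (proj₂ (pair-injective 0 (pair (toℕ s) (index Tree-enumerable t))
                                         0 (pair (toℕ s′) (index Tree-enumerable t′)) eq))
    in cong₂ obj (Fin.toℕ-injective p) (injective Tree-enumerable q)
  Colour-enumerable .injective {tag t} {tag t′} eq =
    cong tag (Fin.toℕ-injective (proj₂ (pair-injective 1 (toℕ t) 1 (toℕ t′) eq)))
  Colour-enumerable .injective {obj s t} {tag t′} eq =
    case proj₁ (pair-injective 0 (pair (toℕ s) (index Tree-enumerable t)) 1 (toℕ t′) eq) of λ ()
  Colour-enumerable .injective {tag t} {obj s t′} eq =
    case proj₁ (pair-injective 1 (toℕ t) 0 (pair (toℕ s) (index Tree-enumerable t′)) eq) of λ ()

  -- Forcing over intervals

  Itv : Set
  Itv = ℝ × ℝ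

  infix 4 _⊏_ _∈ᴵ_ _∈²_
  record _⊏_ (J I : Itv) : Set where
    constructor inside
    field
      left<left   : proj₁ I < proj₁ J
      proper      : proj₁ J < proj₂ J
      right<right : proj₂ J < proj₂ I

  Proper : Itv → Set
  Proper (a , b) = a < b

  _∈ᴵ_ : ℝ → Itv → Set
  x ∈ᴵ (a , b) = a < x × x < b

  _∈²_ : ℝ → Subset ℝ × Subset ℝ → Set
  x ∈² (A , B) = x ∈ A × x ∈ B

  ⊏-trans : ∀ {I J K} → K ⊏ J → J ⊏ I → K ⊏ I
  ⊏-trans (inside a b c) (inside d _ e) = inside (<-trans d a) b (<-trans c e)

  ∈ᴵ-⊏ : ∀ {I J x} → J ⊏ I → x ∈ᴵ J → x ∈ᴵ I
  ∈ᴵ-⊏ (inside a _ b) (c , d) = <-trans a c , <-trans d b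

  ⊏⇒proper : ∀ {I J} → J ⊏ I → Proper J
  ⊏⇒proper = _⊏_.proper

  ⊏-inside : ∀ {I} → Proper I → ∃ λ J → J ⊏ I
  ⊏-inside {_ , _} a<b =
    let q , a<q , q<b = ℚ-dense-in-ℝ a<b
        p , a<p , p<q = ℚ-dense-in-ℝ a<q
    in (real p , real q) , inside a<p p<q q<b

  ⊏-below : ∀ {I J} → J ⊏ I → ∃ λ K → K ⊏ J
  ⊏-below J⊏I = ⊏-inside (⊏⇒proper J⊏I)

  Densely : Itv → (Itv → Set) → Set
  Densely I Φ = ∀ J → J ⊏ I → ∃ λ K → K ⊏ J × Φ K

  Persistent : (Itv → Set) → Set
  Persistent Φ = ∀ {I J} → J ⊏ I → Φ I → Φ J

  Local : (Itv → Set) → Set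
  Local Φ = ∀ {I} → Densely I Φ → Φ I

  densely->>= : ∀ {Φ Ψ : Itv → Set} {I} → Densely I Φ →
                (∀ {J} → J ⊏ I → Φ J → Densely J Ψ) → Densely I Ψ
  densely->>= {I = I} dense f J J⊏I =
    let K , K⊏J , φ = dense J J⊏I
        K⊏I = ⊏-trans K⊏J J⊏I
        M , M⊏K = ⊏-below K⊏J
        N , N⊏M , ψ = f K⊏I φ M M⊏K
    in N , ⊏-trans N⊏M (⊏-trans M⊏K K⊏J) , ψ

  Params : Set
  Params = Vec (Subset ℝ) 7

  sortOf : Params → Sort → Subset ℝ
  sortOf ps s = lookup ps (s ↑ˡ 4)

  tagOf : Params → Tag → Subset ℝ
  tagOf ps t = lookup ps (3 ↑ʳ t)

  module Forcing (Q₀ : Subset ℝ) (𝓕 : Subset ℝ → Set) (ps : Params) where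

    Terms : Set
    Terms = Vec (Subset ℝ × Subset ℝ) 4

    Witness : Itv → Terms → Subset ℝ → Set
    Witness I Z Y = 𝓕 Y × (∃ λ u → u ∈ Y) ×
      (∀ u → u ∈ Y → u ∈ᴵ I ×
        (∀ J → u ∈ᴵ J → ∀ j → ∃ λ v → v ∈ᴵ J × v ∈ Y × v ∈² lookup Z j)) ×
      (∀ u → u ∈ Q₀ → ∃ λ J → u ∈ᴵ J × (∀ v → v ∈ᴵ J → ¬ v ∈ Y))

    record Good (I : Itv) (Z : Terms) : Set where
      constructor good
      field witness : ∀ J → J ⊏ I → ∃ (Witness J Z)

    open Good public

    DenseIn : Itv → Subset ℝ × Subset ℝ → Set
    DenseIn I Z = ∀ J → J ⊏ I → ∃ λ v → v ∈ᴵ J × v ∈² Z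

    quad : Tag → (A B C : Subset ℝ) → Terms
    quad t A B C =
      (A , sortOf ps 0F) ∷ (B , sortOf ps 1F) ∷ (C , sortOf ps 2F) ∷ (tagOf ps t , tagOf ps t) ∷ []

    twins : (B C P : Subset ℝ) → Terms
    twins B C P = (B , P) ∷ (B , P) ∷ (C , P) ∷ (C , P) ∷ []

    Mono : Itv → Subset ℝ → Set
    Mono I A = ∀ s J → J ⊏ I → ∀ B → 𝓕 B → ∀ C → 𝓕 C → B ⊆ A → C ⊆ A →
      DenseIn J (B , sortOf ps s) → DenseIn J (C , sortOf ps s) → Good J (twins B C (sortOf ps s))

    -- Locally, a name is the trace of a single tree on the three sorts.
    Name : Itv → Subset ℝ → Set
    Name I A = Good I (quad eqᵗ A A A) × Mono I A

    Named : Itv → Subset ℝ → Set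
    Named I A = 𝓕 A × Name I A

    Force : ∀ {k} → Itv → Vec (Subset ℝ) k → L k → Set
    Force I xs (rel t x y z) = Good I (quad t (lookup xs x) (lookup xs y) (lookup xs z))
    Force I xs (φ & ψ)       = Force I xs φ × Force I xs ψ
    Force I xs (φ ⇒ ψ)       = ∀ J → J ⊏ I → Force J xs φ → Force J xs ψ
    Force I xs (all φ)       = ∀ J → J ⊏ I → ∀ A → Named J A → Force J (A ∷ xs) φ
    Force I xs (ex φ)        = Densely I λ J → ∃ λ A → Named J A × Force J (A ∷ xs) φ

    good-persistent : ∀ {Z} → Persistent λ I → Good I Z
    good-persistent J⊏I g = good λ K K⊏J → witness g K (⊏-trans K⊏J J⊏I)

    -- A witness for a subinterval also serves the larger interval.
    good-local : ∀ {Z} → Local λ I → Good I Z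
    good-local dense = good λ J J⊏I →
      let K , K⊏J , g = dense J J⊏I
          M , M⊏K = ⊏-below K⊏J
          Y , Y∈ , nonempty , local , gap = witness g M M⊏K
      in Y , Y∈ , nonempty ,
         (λ u u∈ → let u∈M , rest = local u u∈ in
            ∈ᴵ-⊏ K⊏J (∈ᴵ-⊏ M⊏K u∈M) , rest) , gap

    named-persistent : ∀ {A} → Persistent λ I → Named I A
    named-persistent J⊏I (A∈ , link , mono) =
      A∈ , good-persistent J⊏I link , λ s K K⊏J → mono s K (⊏-trans K⊏J J⊏I)

    force-persistent : ∀ {k} (xs : Vec (Subset ℝ) k) φ → Persistent λ I → Force I xs φ
    force-persistent xs (rel t x y z) J⊏I g       = good-persistent J⊏I g
    force-persistent xs (φ & ψ)       J⊏I (p , q) =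
      force-persistent xs φ J⊏I p , force-persistent xs ψ J⊏I q
    force-persistent xs (φ ⇒ ψ)       J⊏I f       = λ K K⊏J → f K (⊏-trans K⊏J J⊏I)
    force-persistent xs (all φ)       J⊏I f       = λ K K⊏J → f K (⊏-trans K⊏J J⊏I)
    force-persistent xs (ex φ)        J⊏I f       = λ K K⊏J → f K (⊏-trans K⊏J J⊏I)

    force-local : ∀ {k} (xs : Vec (Subset ℝ) k) φ → Local λ I → Force I xs φ
    force-local xs (rel t x y z) dense = good-local dense
    force-local xs (φ & ψ) dense =
      force-local xs φ (λ J J⊏I → let K , K⊏J , p , _ = dense J J⊏I in K , K⊏J , p) ,
      force-local xs ψ (λ J J⊏I → let K , K⊏J , _ , q = dense J J⊏I in K , K⊏J , q)
    force-local xs (φ ⇒ ψ) dense J J⊏I p = force-local xs ψ λ K K⊏J →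
      let M , M⊏K , f = dense K (⊏-trans K⊏J J⊏I)
          N , N⊏M = ⊏-below M⊏K
          N⊏K = ⊏-trans N⊏M M⊏K
      in N , N⊏K , f N N⊏M (force-persistent xs φ (⊏-trans N⊏K K⊏J) p)
    force-local xs (all φ) dense J J⊏I A named = force-local (A ∷ xs) φ λ K K⊏J →
      let M , M⊏K , f = dense K (⊏-trans K⊏J J⊏I)
          N , N⊏M = ⊏-below M⊏K
          N⊏K = ⊏-trans N⊏M M⊏K
      in N , N⊏K , f N N⊏M A (named-persistent (⊏-trans N⊏K K⊏J) named)
    force-local xs (ex φ) {I} dense = densely->>= {I = I} dense λ _ → id

  -- The forcing interpretation of the structure of trees

  image : Subset ℚ → Subset ℝ
  image S = ⟪ (λ x → ∃ λ q → x ≡ real q × q ∈ S) ⟫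

  image⁺ : ∀ {S q} → q ∈ S → real q ∈ image S
  image⁺ q∈ = ⟪⟫⁺ (_ , refl , q∈)

  image⁻ : ∀ {S x} → x ∈ image S → ∃ λ q → x ≡ real q × q ∈ S
  image⁻ = ⟪⟫⁻

  image-real⁻ : ∀ {S q} → real q ∈ image S → q ∈ S
  image-real⁻ {S} q∈ = let r , eq , r∈ = image⁻ {S} q∈ in subst (_∈ S) (sym (real-injective eq)) r∈

  rational-around : ∀ {I x} → x ∈ᴵ I → ∃₂ λ p q → x ∈⟮ p , q ⟯ × (∀ {y} → y ∈⟮ p , q ⟯ → y ∈ᴵ I)
  rational-around (a<x , x<b) =
    let p , a<p , p<x = ℚ-dense-in-ℝ a<x ; q , x<q , q<b = ℚ-dense-in-ℝ x<b
    in p , q , (p<x , x<q) , λ (p<y , y<q) → <-trans a<p p<y , <-trans y<q q<b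

  rational-inside : ∀ {I} → Proper I → ∃₂ λ p q → (real p , real q) ⊏ I
  rational-inside {_ , _} a<b =
    let q , a<q , q<b = ℚ-dense-in-ℝ a<b ; p , a<p , p<q = ℚ-dense-in-ℝ a<q
    in p , q , inside a<p p<q q<b

  meet-around : ∀ {I p q x} → x ∈ᴵ I → x ∈⟮ p , q ⟯ →
                ∃ λ J → J ⊏ I × x ∈ᴵ J × (∀ {y} → y ∈ᴵ J → y ∈⟮ p , q ⟯)
  meet-around {a , b} (a<x , x<b) (p<x , x<q) =
    let p′ , a<p′ , p′<x = ℚ-dense-in-ℝ a<x
        q′ , x<q′ , q′<b = ℚ-dense-in-ℝ x<b
        l , p<l , p′<l , l<x = closer-below p<x p′<x
        r , r<q , r<q′ , x<r = closer-above x<q x<q′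
    in (real l , real r) ,
       inside (<-trans a<p′ (real-mono p′<l)) (<-trans l<x x<r) (<-trans (real-mono r<q′) q′<b) ,
       (l<x , x<r) ,
       λ (l<y , y<r) → <-trans (real-mono p<l) l<y , <-trans y<r (real-mono r<q)

  module Standard (ch : ContinuumHypothesis) (𝓕 : Subset ℝ → Set) (𝓕-image : ∀ S → 𝓕 (image S))
                  (Holds : Tree → Set) (some-hold : ∃ Holds) where

    open Trees Holds public

    record Facet : Set where
      field
        kind              : Tag
        first second third : Tree
        related           : Rel kind first second third

    open Facet public

    _∈ᶠ_ : Colour → Facet → Set
    obj 0F o ∈ᶠ F = o ≡ first F
    obj 1F o ∈ᶠ F = o ≡ second F
    obj 2F o ∈ᶠ F = o ≡ third F
    tag t    ∈ᶠ F = t ≡ kind F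

    diagonal : Tree → Facet
    diagonal o = record { kind = eqᵗ ; first = o ; second = o ; third = o ; related = refl , refl }

    obj∈diagonal : ∀ s o → obj s o ∈ᶠ diagonal o
    obj∈diagonal 0F o = refl
    obj∈diagonal 1F o = refl
    obj∈diagonal 2F o = refl

    obj-unique : ∀ s {a b} F → obj s a ∈ᶠ F → obj s b ∈ᶠ F → a ≡ b
    obj-unique 0F F p q = trans p (sym q)
    obj-unique 1F F p q = trans p (sym q)
    obj-unique 2F F p q = trans p (sym q)

    facet-of : ∀ c → ∃ λ F → c ∈ᶠ F
    facet-of (obj s o)   = diagonal o , obj∈diagonal s o
    facet-of (tag eqᵗ)   = diagonal leaf , refl
    facet-of (tag leafᵗ) = record
      { kind = leafᵗ ; first = leaf ; second = leaf ; third = leaf ; related = refl } , refl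
    facet-of (tag nodeᵗ) = record
      { kind = nodeᵗ ; first = leaf ; second = leaf ; third = node leaf leaf ; related = refl } , refl
    -- Some tree has to satisfy `Holds`, or else the colour `tag holds` would lie on no facet.
    facet-of (tag holds) = let o , o-holds = some-hold in record
      { kind = holds ; first = o ; second = o ; third = o ; related = o-holds } , refl

    open Colouring Colour-enumerable (tag eqᵗ) public
    module Sep = Separation ch _∈ᶠ_ colour facet-of 3

    Sorted : Sort → ℚ → Set
    Sorted s q = ∃ λ o → colour q ≡ obj s o

    sortSet : Sort → Subset ℝ
    sortSet s = image ⟪ Sorted s ⟫

    tagSet : Tag → Subset ℝ
    tagSet t = image ⟪ (λ q → colour q ≡ tag t) ⟫

    opaque
      params : Params
      params = Vec.tabulate sortSet ++ Vec.tabulate tagSet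

      sortOf-params : ∀ s → sortOf params s ≡ sortSet s
      sortOf-params s = trans (Vec.lookup-++ˡ (Vec.tabulate sortSet) (Vec.tabulate tagSet) s) (Vec.lookup∘tabulate sortSet s)

      tagOf-params : ∀ t → tagOf params t ≡ tagSet t
      tagOf-params t = trans (Vec.lookup-++ʳ (Vec.tabulate sortSet) (Vec.tabulate tagSet) t) (Vec.lookup∘tabulate tagSet t)

      params-∈ : ∀ j → 𝓕 (lookup params j)
      params-∈ j = subst 𝓕 (sym (Vec.lookup-splitAt 3 (Vec.tabulate sortSet) (Vec.tabulate tagSet) j))
        (go (Fin.splitAt 3 j))
        where
        go : (i : Sort ⊎ Tag) → 𝓕 ([ lookup (Vec.tabulate sortSet) , lookup (Vec.tabulate tagSet) ] i)
        go (inj₁ s) = subst 𝓕 (sym (Vec.lookup∘tabulate sortSet s)) (𝓕-image _)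
        go (inj₂ t) = subst 𝓕 (sym (Vec.lookup∘tabulate tagSet t)) (𝓕-image _)

    ∈sortOf⁻ : ∀ {s x} → x ∈ sortOf params s → ∃ λ q → x ≡ real q × Sorted s q
    ∈sortOf⁻ {s} x∈ with q , eq , q∈ ← image⁻ {⟪ Sorted s ⟫} (subst (λ P → _ ∈ P) (sortOf-params s) x∈) =
      q , eq , ⟪⟫⁻ q∈

    ∈sortOf⁺ : ∀ {s q} → Sorted s q → real q ∈ sortOf params s
    ∈sortOf⁺ {s} sorted = subst (λ P → _ ∈ P) (sym (sortOf-params s)) (image⁺ (⟪⟫⁺ sorted))

    ∈sortOf-real⁻ : ∀ {s q} → real q ∈ sortOf params s → Sorted s q
    ∈sortOf-real⁻ {s} q∈ with r , eq , sorted ← ∈sortOf⁻ {s} q∈ with refl ← real-injective eq = sorted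

    ∈tagOf⁻ : ∀ {t x} → x ∈ tagOf params t → ∃ λ q → x ≡ real q × colour q ≡ tag t
    ∈tagOf⁻ {t} x∈
      with q , eq , q∈ ← image⁻ {⟪ (λ q → colour q ≡ tag t) ⟫} (subst (λ P → _ ∈ P) (tagOf-params t) x∈) =
      q , eq , ⟪⟫⁻ q∈

    ∈tagOf⁺ : ∀ {t q} → colour q ≡ tag t → real q ∈ tagOf params t
    ∈tagOf⁺ {t} c = subst (λ P → _ ∈ P) (sym (tagOf-params t)) (image⁺ (⟪⟫⁺ c))

    open Forcing Sep.avoider 𝓕 params public

    good⇒dense : ∀ {I Z} → Good I Z → ∀ j → DenseIn I (lookup Z j)
    good⇒dense g j J J⊏I =
      let Y , _ , (u , u∈Y) , local , _ = witness g J J⊏I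
          u∈J , near = local u u∈Y
          v , v∈J , _ , v∈Z = near J u∈J j
      in v , v∈J , v∈Z

    -- The positive half of the coding: inside J, the four sets form a good family on the facet F,
    -- and the set promised for this family is the witness.
    good-intro : ∀ {I Z} F → (∀ j → DenseIn I (lookup Z j)) →
                 (∀ j {v} → v ∈² lookup Z j → v ∈ᴵ I → ∃ λ q → v ≡ real q × colour q ∈ᶠ F) → Good I Z
    good-intro {I} {Z} F dense coloured = good λ J J⊏I → witness-in J J⊏I
      where
      module _ (J : Itv) (J⊏I : J ⊏ I) where
        InPart : Fin 4 → ℚ → Set
        InPart j q = real q ∈ᴵ J × real q ∈² lookup Z j

        parts : Sep.Parts
        parts j = ⟪ InPart j ⟫

        in-J : ∀ {q} → Sep.Union parts q → real q ∈ᴵ J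
        in-J (j , q∈) = proj₁ (⟪⟫⁻ q∈)

        point-in : ∀ {K} → K ⊏ J → ∀ j → ∃ λ q → real q ∈ᴵ K × q ∈ parts j
        point-in K⊏J j with v , v∈K , v∈Z ← dense j _ (⊏-trans K⊏J J⊏I)
          with q , refl , _ ← coloured j v∈Z (∈ᴵ-⊏ (⊏-trans K⊏J J⊏I) v∈K) =
          q , v∈K , ⟪⟫⁺ (∈ᴵ-⊏ K⊏J v∈K , v∈Z)

        parts-good : Sep.Good parts
        parts-good = record
          { facet = F
          ; coloured = λ (j , v∈) → let v∈J , v∈Z = ⟪⟫⁻ v∈
                                        q , eq , q∈F = coloured j v∈Z (∈ᴵ-⊏ J⊏I v∈J)
                                    in subst (λ w → colour w ∈ᶠ F) (sym (real-injective eq)) q∈F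
          ; nonempty = let _ , K⊏J = ⊏-below J⊏I ; q , _ , q∈ = point-in K⊏J 0F in q , 0F , q∈
          ; dense = λ x∈ {p} {q} x∈pq j →
              let K , K⊏J , _ , K⊆ = meet-around (in-J x∈) (Between⇒∈ x∈pq)
                  v , v∈K , v∈ = point-in K⊏J j
              in v , ∈⇒Between (K⊆ v∈K) , v∈
          }

        witness-in : ∃ (Witness J Z)
        witness-in =
          let Y , (Y⊆ , (y , y∈) , Y-dense) , gap = Sep.avoider-good parts parts-good in
          image Y , 𝓕-image Y , (real y , image⁺ y∈) ,
          (λ u u∈ → case image⁻ {Y} u∈ of λ { (x , refl , x∈) →
            in-J (Y⊆ x∈) , λ K x∈K j →
              let p , q , x∈pq , pq⊆K = rational-around x∈K
                  v , v∈pq , v∈Y , v∈B = Y-dense x∈ (∈⇒Between x∈pq) j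
              in real v , pq⊆K (Between⇒∈ v∈pq) , image⁺ v∈Y , proj₂ (⟪⟫⁻ v∈B) }) ,
          (λ u u∈ → let p , q , u∈pq , free = gap u∈ in
            (real p , real q) , u∈pq , λ v v∈pq v∈ → case image⁻ {Y} v∈ of λ where
              (w , refl , w∈Y) → free w (∈⇒Between v∈pq) w∈Y)

    -- The negative half of the coding. If no facet had points in all four sets inside J, the part X
    -- of the witness would nowhere keep to a facet, and `avoider` would meet its closure.
    good-elim : ∀ {I Z} → Good I Z → (∀ j {v} → v ∈² lookup Z j → ∃ λ q → v ≡ real q) →
                ∀ {J} → J ⊏ I → ∃ λ F → ∀ j → ∃ λ q →
                real q ∈ᴵ J × real q ∈² lookup Z j × colour q ∈ᶠ F
    good-elim {I} {Z} g rational {J} J⊏I = stable λ none → absurd none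
      where
      Captures : Facet → Set
      Captures F = ∀ j → ∃ λ q → real q ∈ᴵ J × real q ∈² lookup Z j × colour q ∈ᶠ F

      Y = proj₁ (witness g J J⊏I)
      nonempty = proj₁ (proj₂ (proj₂ (witness g J J⊏I)))
      local = proj₁ (proj₂ (proj₂ (proj₂ (witness g J J⊏I))))
      gap = proj₂ (proj₂ (proj₂ (proj₂ (witness g J J⊏I))))

      X : Subset ℚ
      X = ⟪ (λ q → real q ∈ Y × ∃ λ j → real q ∈² lookup Z j) ⟫

      nearby : ∀ {u K} → u ∈ Y → u ∈ᴵ K → ∀ j →
               ∃ λ q → real q ∈ᴵ K × real q ∈ Y × real q ∈² lookup Z j
      nearby u∈Y u∈K j with v , v∈K , v∈Y , v∈Z ← proj₂ (local _ u∈Y) _ u∈K j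
        with q , refl ← rational j v∈Z = q , v∈K , v∈Y , v∈Z

      bad : ¬ ∃ Captures → Sep.Bad (_∈ X)
      bad none = record
        { nonempty = let u , u∈Y = nonempty
                         q , _ , q∈Y , q∈Z = nearby u∈Y (proj₁ (local u u∈Y)) 0F
                     in q , ⟪⟫⁺ (q∈Y , 0F , q∈Z)
        -- If X kept to F between p and q, each of the four sets would have there a point with a
        -- colour of F, since all four are dense in the witness.
        ; leaves = λ F x∈X x∈pq → stable λ stays → none (F , λ j →
            let x∈Y , _ = ⟪⟫⁻ x∈X
                q , q∈pq , q∈Y , q∈Z = nearby x∈Y (Between⇒∈ x∈pq) j
            in q , proj₁ (local _ q∈Y) , q∈Z , stable λ q∉F →
               stays (q , ⟪⟫⁺ (q∈Y , j , q∈Z) , ∈⇒Between q∈pq , q∉F)) }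

      absurd : ¬ ¬ ∃ Captures
      absurd none =
        let x , x∈Q , closure = Sep.avoider-bad X (bad none)
            K , x∈K , free = gap x x∈Q
            p , q , x∈pq , pq⊆K = rational-around x∈K
            v , v∈pq , v∈X = closure p q x∈pq
        in free (real v) (pq⊆K (Between⇒∈ v∈pq)) (proj₁ (⟪⟫⁻ v∈X))

    quad-rational : ∀ {t A B C} j {v} → v ∈² lookup (quad t A B C) j → ∃ λ q → v ≡ real q
    quad-rational 0F (_ , v∈) = let q , eq , _ = ∈sortOf⁻ {0F} v∈ in q , eq
    quad-rational 1F (_ , v∈) = let q , eq , _ = ∈sortOf⁻ {1F} v∈ in q , eq
    quad-rational 2F (_ , v∈) = let q , eq , _ = ∈sortOf⁻ {2F} v∈ in q , eq
    quad-rational {t} 3F (_ , v∈) = let q , eq , _ = ∈tagOf⁻ {t} v∈ in q , eq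

    -- Only the absence of colours of other trees is demanded; that the colours of o do occur
    -- densely is a consequence of `Name`.
    Represents : Itv → Subset ℝ → Tree → Set
    Represents I A o = ∀ {q s a} → real q ∈ᴵ I → real q ∈ A → colour q ≡ obj s a → a ≡ o

    represents-persistent : ∀ {A o} → Persistent λ I → Represents I A o
    represents-persistent J⊏I rep q∈J = rep (∈ᴵ-⊏ J⊏I q∈J)

    rel-elim : ∀ {I A B C i j k} t → Proper I → Represents I A i → Represents I B j →
               Represents I C k → Good I (quad t A B C) → Rel t i j k
    rel-elim {I} {A} {B} {C} {i} {j} {k} t proper repA repB repC g
      with J , J⊏I ← ⊏-inside {I} proper
      with F , captures ← good-elim g (quad-rational {t} {A} {B} {C}) J⊏I
      = rel≡ t≡ (component {A} 0F (captures 0F) repA) (component {B} 1F (captures 1F) repB)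
                (component {C} 2F (captures 2F) repC) (related F)
      where
      component : ∀ {D o} s → (∃ λ q → real q ∈ᴵ J × real q ∈² (D , sortOf params s) × colour q ∈ᶠ F) →
                  Represents I D o → obj s o ∈ᶠ F
      component s (q , q∈J , (q∈D , q∈s) , q∈F) rep =
        let a , eq = ∈sortOf-real⁻ {s} q∈s in
        subst (λ o → obj s o ∈ᶠ F) (rep (∈ᴵ-⊏ J⊏I q∈J) q∈D eq) (subst (_∈ᶠ F) eq q∈F)

      t≡ : t ≡ kind F
      t≡ with q , _ , (_ , q∈t) , q∈F ← captures 3F
        with r , eq , c ← ∈tagOf⁻ {t} q∈t with refl ← real-injective eq = subst (_∈ᶠ F) c q∈F

      rel≡ : ∀ {t t′ i i′ j j′ k k′} → t ≡ t′ → i ≡ i′ → j ≡ j′ → k ≡ k′ → Rel t′ i′ j′ k′ → Rel t i j k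
      rel≡ refl refl refl refl r = r

    tag-dense : ∀ {I} t → DenseIn I (tagOf params t , tagOf params t)
    tag-dense t J J⊏I =
      let p , q , inside J<p p<q q<J = rational-inside (⊏⇒proper J⊏I)
          v , v∈pq , c = colour-dense (tag t) (real-reflects p<q)
          p<v , v<q = Between⇒∈ v∈pq
      in real v , (<-trans J<p p<v , <-trans v<q q<J) , ∈tagOf⁺ {t} c , ∈tagOf⁺ {t} c

    rel-intro : ∀ {I A B C i j k} t → Rel t i j k →
                Named I A → Represents I A i → Named I B → Represents I B j →
                Named I C → Represents I C k → Good I (quad t A B C)
    rel-intro {I} {A} {B} {C} {i} {j} {k} t r nA repA nB repB nC repC = good-intro F dense coloured
      where
      F = record { kind = t ; first = i ; second = j ; third = k ; related = r }

      dense : ∀ l → DenseIn I (lookup (quad t A B C) l)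
      dense 0F = good⇒dense (proj₁ (proj₂ nA)) 0F
      dense 1F = good⇒dense (proj₁ (proj₂ nB)) 1F
      dense 2F = good⇒dense (proj₁ (proj₂ nC)) 2F
      dense 3F = tag-dense t

      sorted : ∀ {D o v} s → obj s o ∈ᶠ F → Represents I D o → v ∈² (D , sortOf params s) → v ∈ᴵ I →
               ∃ λ q → v ≡ real q × colour q ∈ᶠ F
      sorted s o∈F rep (v∈D , v∈s) v∈I with q , refl , a , eq ← ∈sortOf⁻ {s} v∈s =
        q , refl , subst (_∈ᶠ F) (sym (trans eq (cong (obj s) (rep v∈I v∈D eq)))) o∈F

      coloured : ∀ l {v} → v ∈² lookup (quad t A B C) l → v ∈ᴵ I → ∃ λ q → v ≡ real q × colour q ∈ᶠ F
      coloured 0F = sorted 0F refl repA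
      coloured 1F = sorted 1F refl repB
      coloured 2F = sorted 2F refl repC
      coloured 3F (v∈ , _) _ = let q , eq , c = ∈tagOf⁻ {t} v∈ in q , eq , subst (_∈ᶠ F) (sym c) refl

    canonical : Tree → Subset ℝ
    canonical o = image ⟪ (λ q → ∃ λ s → colour q ≡ obj s o) ⟫

    canonical-colour : ∀ {o q} → real q ∈ canonical o → ∃ λ s → colour q ≡ obj s o
    canonical-colour {o} q∈ = ⟪⟫⁻ (image-real⁻ {⟪ (λ q → ∃ λ s → colour q ≡ obj s o) ⟫} q∈)

    obj-injective : ∀ {s s′ a b} → obj s a ≡ obj s′ b → s ≡ s′ × a ≡ b
    obj-injective refl = refl , refl

    canonical-represents : ∀ {I} o → Represents I (canonical o) o
    canonical-represents o _ q∈ eq =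
      let _ , eq′ = canonical-colour {o} q∈ in proj₂ (obj-injective (trans (sym eq) eq′))

    canonical-dense : ∀ {I} o s → DenseIn I (canonical o , sortOf params s)
    canonical-dense o s J J⊏I =
      let p , q , inside J<p p<q q<J = rational-inside (⊏⇒proper J⊏I)
          v , v∈pq , c = colour-dense (obj s o) (real-reflects p<q)
          p<v , v<q = Between⇒∈ v∈pq
      in real v , (<-trans J<p p<v , <-trans v<q q<J) , image⁺ (⟪⟫⁺ (s , c)) , ∈sortOf⁺ {s} (o , c)

    canonical-coloured : ∀ {o v} s → v ∈ canonical o → v ∈ sortOf params s →
                         ∃ λ q → v ≡ real q × colour q ∈ᶠ diagonal o
    canonical-coloured {o} s v∈ v∈s with q , refl , a , eq ← ∈sortOf⁻ {s} v∈s =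
      q , refl , subst (_∈ᶠ diagonal o)
        (sym (trans eq (cong (obj s) (let _ , eq′ = canonical-colour {o} v∈ in proj₂ (obj-injective (trans (sym eq) eq′))))))
        (obj∈diagonal s o)

    canonical-named : ∀ {I} o → Named I (canonical o)
    canonical-named {I} o = 𝓕-image _ , good-intro (diagonal o) dense coloured ,
      λ s J J⊏I B _ C _ B⊆ C⊆ B-dense C-dense → good-intro (diagonal o)
        (λ { 0F → B-dense ; 1F → B-dense ; 2F → C-dense ; 3F → C-dense })
        (λ { 0F (v∈ , v∈s) _ → canonical-coloured s (B⊆ v∈) v∈s
           ; 1F (v∈ , v∈s) _ → canonical-coloured s (B⊆ v∈) v∈s
           ; 2F (v∈ , v∈s) _ → canonical-coloured s (C⊆ v∈) v∈s
           ; 3F (v∈ , v∈s) _ → canonical-coloured s (C⊆ v∈) v∈s })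
      where
      dense : ∀ l → DenseIn I (lookup (quad eqᵗ (canonical o) (canonical o) (canonical o)) l)
      dense 0F = canonical-dense o 0F
      dense 1F = canonical-dense o 1F
      dense 2F = canonical-dense o 2F
      dense 3F = tag-dense eqᵗ

      coloured : ∀ l {v} → v ∈² lookup (quad eqᵗ (canonical o) (canonical o) (canonical o)) l → v ∈ᴵ I →
                 ∃ λ q → v ≡ real q × colour q ∈ᶠ diagonal o
      coloured 0F (v∈ , v∈s) _ = canonical-coloured 0F v∈ v∈s
      coloured 1F (v∈ , v∈s) _ = canonical-coloured 1F v∈ v∈s
      coloured 2F (v∈ , v∈s) _ = canonical-coloured 2F v∈ v∈s
      coloured 3F (v∈ , _) _ =
        let q , eq , c = ∈tagOf⁻ {eqᵗ} v∈ in q , eq , subst (_∈ᶠ diagonal o) (sym c) refl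

  -- Forcing coincides with truth in the structure of trees

  module StandardTruth (ch : ContinuumHypothesis) (𝓕 : Subset ℝ → Set) (𝓕-image : ∀ S → 𝓕 (image S))
                       (Holds : Tree → Set) (some-hold : ∃ Holds) where

    open Standard ch 𝓕 𝓕-image Holds some-hold public

    module _ {I : Itv} {A : Subset ℝ} (named : Named I A) (s : Sort) where

      Member : ℚ → Set
      Member q = real q ∈ A × Sorted s q

      DenseMembers : Itv → Subset ℚ → Set
      DenseMembers J S = ∀ K → K ⊏ J → ∃ λ q → real q ∈ᴵ K × q ∈ S

      -- Two dense parts of a name cannot have disjoint sets of colours: the closure of any
      -- set in which both are dense would meet the avoider.
      no-clash : ∀ {J} → J ⊏ I → ∀ B C → (∀ {q} → q ∈ B → Member q) → (∀ {q} → q ∈ C → Member q) →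
                 DenseMembers J B → DenseMembers J C →
                 ¬ (∀ {q r} → q ∈ B → r ∈ C → colour q ≢ colour r)
      no-clash {J} J⊏I B C B⊆ C⊆ B-dense C-dense distinct =
        let F , captures = good-elim g rational J′⊏J
            q , _ , (q∈B , _) , q∈F = captures 0F
            r , _ , (r∈C , _) , r∈F = captures 2F
            b = image-real⁻ {B} q∈B
            c = image-real⁻ {C} r∈C
        in distinct b c (same F (proj₂ (B⊆ b)) (proj₂ (C⊆ c)) q∈F r∈F)
        where
        J′⊏J = proj₂ (⊏-below J⊏I)

        ⊆A : ∀ S → (∀ {q} → q ∈ S → Member q) → image S ⊆ A
        ⊆A S S⊆ x∈ with q , refl , q∈ ← image⁻ {S} x∈ = proj₁ (S⊆ q∈)

        lift-dense : ∀ S → (∀ {q} → q ∈ S → Member q) → DenseMembers J S →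
                     DenseIn J (image S , sortOf params s)
        lift-dense S S⊆ S-dense K K⊏J =
          let q , q∈K , q∈S = S-dense K K⊏J
          in real q , q∈K , image⁺ q∈S , ∈sortOf⁺ {s} (proj₂ (S⊆ q∈S))

        g : Good J (twins (image B) (image C) (sortOf params s))
        g = proj₂ (proj₂ named) s J J⊏I (image B) (𝓕-image B) (image C) (𝓕-image C)
              (⊆A B B⊆) (⊆A C C⊆) (lift-dense B B⊆ B-dense) (lift-dense C C⊆ C-dense)

        rational : ∀ j {v} → v ∈² lookup (twins (image B) (image C) (sortOf params s)) j →
                   ∃ λ q → v ≡ real q
        rational 0F (_ , v∈) = let q , eq , _ = ∈sortOf⁻ {s} v∈ in q , eq
        rational 1F (_ , v∈) = let q , eq , _ = ∈sortOf⁻ {s} v∈ in q , eq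
        rational 2F (_ , v∈) = let q , eq , _ = ∈sortOf⁻ {s} v∈ in q , eq
        rational 3F (_ , v∈) = let q , eq , _ = ∈sortOf⁻ {s} v∈ in q , eq

        same : ∀ {q r} F → Sorted s q → Sorted s r → colour q ∈ᶠ F → colour r ∈ᶠ F → colour q ≡ colour r
        same F (a , eq) (b , eq′) q∈F r∈F =
          trans eq (trans (cong (obj s) (obj-unique s F (subst (_∈ᶠ F) eq q∈F) (subst (_∈ᶠ F) eq′ r∈F)))
                          (sym eq′))

      Uniform : Itv → Colour → Set
      Uniform J c = ∀ q → real q ∈ᴵ J → Member q → colour q ≡ c

      module _ {J : Itv} (J⊏I : J ⊏ I) (mixed : ∀ K → K ⊏ J → ∀ c → ¬ Uniform K c) where

        OfColour OffColour : Colour → Subset ℚ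
        OfColour  c = ⟪ (λ q → Member q × colour q ≡ c) ⟫
        OffColour c = ⟪ (λ q → Member q × colour q ≢ c) ⟫

        offColour-dense : ∀ {K} → K ⊏ J → ∀ c → DenseMembers K (OffColour c)
        offColour-dense K⊏J c M M⊏K = stable λ none → mixed M (⊏-trans M⊏K K⊏J) c
          λ q q∈M member → stable λ q≢c → none (q , q∈M , ⟪⟫⁺ (member , q≢c))

        -- A colour dense in K would clash with the members of other colours, which are dense
        -- because no subinterval is uniform.
        nowhere-dense : ∀ {K} → K ⊏ J → ∀ c → ∃ λ M → M ⊏ K × (∀ {q} → real q ∈ᴵ M → Member q → colour q ≢ c)
        nowhere-dense {K} K⊏J c = stable λ none →
          no-clash (⊏-trans K⊏J J⊏I) (OfColour c) (OffColour c) (proj₁ ∘ ⟪⟫⁻) (proj₁ ∘ ⟪⟫⁻)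
            (λ M M⊏K → stable λ empty → none (M , M⊏K , λ {q} q∈M member q≡c →
              empty (q , q∈M , ⟪⟫⁺ (member , q≡c))))
            (offColour-dense K⊏J c)
            λ q∈ r∈ q≡r → proj₂ (⟪⟫⁻ r∈) (trans (sym q≡r) (proj₂ (⟪⟫⁻ q∈)))

        avoid-colours : ∀ {K} → K ⊏ J → ∀ cs →
                        ∃ λ M → M ⊏ K × (∀ {q} → real q ∈ᴵ M → Member q → ¬ colour q ∈ᴸ cs)
        avoid-colours K⊏J [] = let M , M⊏K = ⊏-below K⊏J in M , M⊏K , λ _ _ ()
        avoid-colours K⊏J (c ∷ cs) =
          let M , M⊏K , cs-free = avoid-colours K⊏J cs
              N , N⊏M , c-free = nowhere-dense (⊏-trans M⊏K K⊏J) c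
          in N , ⊏-trans N⊏M M⊏K , λ q∈N member → λ where
               (here eq)   → c-free q∈N member eq
               (there c∈) → cs-free (∈ᴵ-⊏ N⊏M q∈N) member c∈

        slots : Enumerable ((ℚ × ℚ) × Fin 2)
        slots = ×-enumerable (×-enumerable ℚ-enumerable ℚ-enumerable) Fin-enumerable

        Fills : ℕ → ℚ → Set
        Fills n v = ∀ {p q b} → element slots n ≡ just ((p , q) , b) → (real p , real q) ⊏ J →
                    real v ∈ᴵ (real p , real q) × Member v

        member-in : ∀ {K} → K ⊏ J → ∃ λ q → real q ∈ᴵ K × Member q
        -- An interval without members would be uniform for any colour; `tag eqᵗ` is an arbitrary
        -- choice.
        member-in {K} K⊏J = stable λ none → mixed K K⊏J (tag eqᵗ) λ q q∈K member →
          contradiction (q , q∈K , member) none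

        fresh : ∀ n cs → ∃ λ v → Fills n v × ¬ colour v ∈ᴸ cs
        fresh n cs with em {∃₂ λ p q → (∃ λ b → element slots n ≡ just ((p , q) , b)) × (real p , real q) ⊏ J}
        ... | yes (p , q , (b , eq) , pq⊏J) =
          let M , M⊏pq , free = avoid-colours pq⊏J cs
              v , v∈M , member = member-in (⊏-trans M⊏pq pq⊏J)
          in v , (λ eq′ _ → subst (λ { ((p , q) , _) → real v ∈ᴵ (real p , real q) × Member v })
                              (just-injective (trans (sym eq) eq′)) (∈ᴵ-⊏ M⊏pq v∈M , member)) ,
             free v∈M member
        ... | no none =
          let M , M⊏J = ⊏-below J⊏I
              N , N⊏M , free = avoid-colours M⊏J cs
              v , v∈N , member = member-in (⊏-trans N⊏M M⊏J)
          in v , (λ eq pq⊏J → contradiction (_ , _ , (_ , eq) , pq⊏J) none) , free v∈N member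

        open Select colour Fills fresh

        Half : Fin 2 → ℚ → Set
        Half b v = ∃₂ λ n p → ∃ λ q → select n ≡ v × element slots n ≡ just ((p , q) , b) ×
                                      (real p , real q) ⊏ J

        half-member : ∀ {b v} → Half b v → Member v
        half-member (n , _ , _ , refl , eq , pq⊏J) = proj₂ (select-∈ n eq pq⊏J)

        half-dense : ∀ b → DenseMembers J ⟪ Half b ⟫
        half-dense b K K⊏J =
          let p , q , pq⊏K = rational-inside (⊏⇒proper K⊏J)
              pq⊏J = ⊏-trans pq⊏K K⊏J
              n = index slots ((p , q) , b)
              found = element-index slots ((p , q) , b)
          in select n , ∈ᴵ-⊏ pq⊏K (proj₁ (select-∈ n found pq⊏J)) ,
             ⟪⟫⁺ (n , p , q , refl , found , pq⊏J)

        halves-distinct : ∀ {q r} → Half 0F q → Half 1F r → colour q ≢ colour r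
        halves-distinct (n , _ , _ , refl , eq , _) (m , _ , _ , refl , eq′ , _) same
          with select-distinct {n} {m} same
        ... | refl = case cong proj₂ (just-injective (trans (sym eq) eq′)) of λ ()

        -- Every interval has members whose colours avoid any given finite list. Hence members of
        -- pairwise different colours can be selected, two for each rational interval inside J; the
        -- first and the second ones form two dense sets without a common colour.
        mixed-absurd : ⊥
        mixed-absurd = no-clash J⊏I ⟪ Half 0F ⟫ ⟪ Half 1F ⟫ (half-member ∘ ⟪⟫⁻) (half-member ∘ ⟪⟫⁻)
          (half-dense 0F) (half-dense 1F) λ q∈ r∈ → halves-distinct (⟪⟫⁻ q∈) (⟪⟫⁻ r∈)

      locally-uniform : Densely I λ K → ∃ (Uniform K)
      locally-uniform J J⊏I = stable λ none → mixed-absurd J⊏I λ K K⊏J c uniform →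
        none (K , K⊏J , c , uniform)

    -- Three successive shrinkings make A uniform on each of the three sorts. A facet captured in
    -- the last interval through the `eqᵗ` clause shows that the three colours belong to one tree.
    locally-represents : ∀ {I A} → Named I A → Densely I λ J → ∃ (Represents J A)
    locally-represents {I} {A} named J J⊏I =
      let K₀ , K₀⊏J , c₀ , u₀ = locally-uniform named 0F J J⊏I
          K₀⊏I = ⊏-trans K₀⊏J J⊏I
          M₀ , M₀⊏K₀ = ⊏-below K₀⊏J
          K₁ , K₁⊏M₀ , c₁ , u₁ = locally-uniform named 1F M₀ (⊏-trans M₀⊏K₀ K₀⊏I)
          K₁⊏K₀ = ⊏-trans K₁⊏M₀ M₀⊏K₀
          M₁ , M₁⊏K₁ = ⊏-below K₁⊏M₀
          K₂ , K₂⊏M₁ , c₂ , u₂ = locally-uniform named 2F M₁ (⊏-trans M₁⊏K₁ (⊏-trans K₁⊏K₀ K₀⊏I))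
          K₂⊏K₁ = ⊏-trans K₂⊏M₁ M₁⊏K₁
          K₂⊏K₀ = ⊏-trans K₂⊏K₁ K₁⊏K₀
          F , captures = good-elim (proj₁ (proj₂ named)) (quad-rational {eqᵗ} {A} {A} {A})
                           (⊏-trans K₂⊏K₀ K₀⊏I)
          e₀ = component 0F F (λ q q∈ → u₀ q (∈ᴵ-⊏ K₂⊏K₀ q∈)) (captures 0F)
          e₁ = component 1F F (λ q q∈ → u₁ q (∈ᴵ-⊏ K₂⊏K₁ q∈)) (captures 1F)
          e₂ = component 2F F u₂ (captures 2F)
      in K₂ , ⊏-trans K₂⊏K₀ K₀⊏J , first F , represents F (captures 3F)
           (sorted 0F F u₀ (∈ᴵ-⊏ K₂⊏K₀) e₀) (sorted 1F F u₁ (∈ᴵ-⊏ K₂⊏K₁) e₁) (sorted 2F F u₂ id e₂)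
      where
      component : ∀ {K c} s F → (∀ q → real q ∈ᴵ K → Member named s q → colour q ≡ c) →
        (∃ λ q → real q ∈ᴵ K × real q ∈² (A , sortOf params s) × colour q ∈ᶠ F) → c ∈ᶠ F
      component s F u (q , q∈K , (q∈A , q∈s) , q∈F) =
        subst (_∈ᶠ F) (u q q∈K (q∈A , ∈sortOf-real⁻ {s} q∈s)) q∈F

      sorted : ∀ {K M c} s F → Uniform named s K c → (∀ {x} → x ∈ᴵ M → x ∈ᴵ K) → c ∈ᶠ F →
               ∀ {q a} → real q ∈ᴵ M → real q ∈ A → colour q ≡ obj s a → obj s a ∈ᶠ F
      sorted s F u M⊆K c∈F q∈M q∈A eq =
        subst (_∈ᶠ F) (trans (sym (u _ (M⊆K q∈M) (q∈A , _ , eq))) eq) c∈F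

      represents : ∀ {M} F →
        (∃ λ q → real q ∈ᴵ M × real q ∈² (tagOf params eqᵗ , tagOf params eqᵗ) × colour q ∈ᶠ F) →
        (∀ {q a} → real q ∈ᴵ M → real q ∈ A → colour q ≡ obj 0F a → obj 0F a ∈ᶠ F) →
        (∀ {q a} → real q ∈ᴵ M → real q ∈ A → colour q ≡ obj 1F a → obj 1F a ∈ᶠ F) →
        (∀ {q a} → real q ∈ᴵ M → real q ∈ A → colour q ≡ obj 2F a → obj 2F a ∈ᶠ F) →
        Represents M A (first F)
      represents {M} F (q , _ , (q∈t , _) , q∈F) f₀ f₁ f₂ {s = s} = by-sort s
        where
        kind≡ : eqᵗ ≡ kind F
        kind≡ = let r , eq , c = ∈tagOf⁻ {eqᵗ} q∈t in
          subst (_∈ᶠ F) c (subst (λ v → colour v ∈ᶠ F) (real-injective eq) q∈F)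
        agree : first F ≡ second F × second F ≡ third F
        agree = subst (λ t → Rel t (first F) (second F) (third F)) (sym kind≡) (related F)
        by-sort : ∀ s {r a} → real r ∈ᴵ M → real r ∈ A → colour r ≡ obj s a → a ≡ first F
        by-sort 0F r∈M r∈A eq = f₀ r∈M r∈A eq
        by-sort 1F r∈M r∈A eq = trans (f₁ r∈M r∈A eq) (sym (proj₁ agree))
        by-sort 2F r∈M r∈A eq = trans (f₂ r∈M r∈A eq) (sym (trans (proj₁ agree) (proj₂ agree)))

    record Interprets {k} (I : Itv) (xs : Vec (Subset ℝ) k) (os : Vec Tree k) : Set where
      constructor interprets
      field
        named      : ∀ i → Named I (lookup xs i)
        represents : ∀ i → Represents I (lookup xs i) (lookup os i)

    open Interprets

    interprets-persistent : ∀ {k} {xs : Vec (Subset ℝ) k} {os} → Persistent λ I → Interprets I xs os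
    interprets-persistent {xs = xs} {os} J⊏I r = interprets (λ i → named-persistent J⊏I (named r i))
                                             (λ i → represents-persistent {lookup xs i} {lookup os i} J⊏I (represents r i))

    extend : ∀ {k I A o} {xs : Vec (Subset ℝ) k} {os} → Named I A → Represents I A o →
             Interprets I xs os → Interprets I (A ∷ xs) (o ∷ os)
    extend n r rs = interprets (λ { zero → n ; (suc i) → named rs i })
                               (λ { zero → r ; (suc i) → represents rs i })

    mutual
      -- The implication makes the two directions depend on each other. A tree enters forcing as its
      -- canonical set; a given name is replaced by the tree that it represents on a smaller
      -- interval, from which `force-local` leads back.
      forced⇒models : ∀ {k I} {xs : Vec (Subset ℝ) k} {os} φ → Proper I → Interprets I xs os →
                      Force I xs φ → Models os φ
      forced⇒models (rel t x y z) proper r g =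
        rel-elim t proper (represents r x) (represents r y) (represents r z) g
      forced⇒models (φ & ψ) proper r (p , q) = forced⇒models φ proper r p , forced⇒models ψ proper r q
      forced⇒models (φ ⇒ ψ) proper r f m =
        let J , J⊏I = ⊏-inside proper ; r′ = interprets-persistent J⊏I r
        in forced⇒models ψ (⊏⇒proper J⊏I) r′ (f J J⊏I (models⇒forced φ (⊏⇒proper J⊏I) r′ m))
      forced⇒models (all φ) proper r f o =
        let J , J⊏I = ⊏-inside proper
        in forced⇒models φ (⊏⇒proper J⊏I)
             (extend (canonical-named o) (canonical-represents o) (interprets-persistent J⊏I r))
             (f J J⊏I (canonical o) (canonical-named o))
      forced⇒models {xs = xs} (ex φ) proper r f =
        let J , J⊏I = ⊏-inside proper
            K , K⊏J , A , n , p = f J J⊏I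
            M , M⊏K = ⊏-below K⊏J
            N , N⊏M , o , ro = locally-represents n M M⊏K
            N⊏K = ⊏-trans N⊏M M⊏K
        in o , forced⇒models φ (⊏⇒proper N⊏M)
                 (extend (named-persistent N⊏K n) ro
                   (interprets-persistent (⊏-trans N⊏K (⊏-trans K⊏J J⊏I)) r))
                 (force-persistent (A ∷ xs) φ N⊏K p)

      models⇒forced : ∀ {k I} {xs : Vec (Subset ℝ) k} {os} φ → Proper I → Interprets I xs os →
                      Models os φ → Force I xs φ
      models⇒forced (rel t x y z) proper r m =
        rel-intro t m (named r x) (represents r x) (named r y) (represents r y) (named r z) (represents r z)
      models⇒forced (φ & ψ) proper r (p , q) = models⇒forced φ proper r p , models⇒forced ψ proper r q
      models⇒forced (φ ⇒ ψ) proper r f J J⊏I p =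
        let r′ = interprets-persistent J⊏I r
        in models⇒forced ψ (⊏⇒proper J⊏I) r′ (f (forced⇒models φ (⊏⇒proper J⊏I) r′ p))
      models⇒forced {xs = xs} (all φ) proper r f J J⊏I A n = force-local (A ∷ xs) φ λ K K⊏J →
        let M , M⊏K , o , ro = locally-represents n K K⊏J
            M⊏J = ⊏-trans M⊏K K⊏J
        in M , M⊏K , models⇒forced φ (⊏⇒proper M⊏K)
             (extend (named-persistent M⊏J n) ro (interprets-persistent (⊏-trans M⊏J J⊏I) r)) (f o)
      models⇒forced (ex φ) proper r (o , m) J J⊏I =
        let K , K⊏J = ⊏-below J⊏I
        in K , K⊏J , canonical o , canonical-named o ,
           models⇒forced φ (⊏⇒proper K⊏J)
             (extend (canonical-named o) (canonical-represents o)
               (interprets-persistent (⊏-trans K⊏J J⊏I) r)) m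

  -- Derivability is forced

  module _ {n} (program : Vec Rule n) where

    open Trees (Derivable program)

    closeAll-models : ∀ k {φ : L k} → (∀ os → Models os φ) → Models [] (closeAll k φ)
    closeAll-models zero    m = m []
    closeAll-models (suc k) m = closeAll-models k λ os o → m (o ∷ os)

    ⇒*-models : ∀ {m} {os : Vec Tree m} φs {ψ} → (All (Models os) φs → Models os ψ) → Models os (φs ⇒* ψ)
    ⇒*-models []       f = f []
    ⇒*-models (φ ∷ φs) f = λ p → ⇒*-models φs λ ps → f (p ∷ ps)

    match-models : ∀ {k m} {os : Vec Tree k} (os′ : Vec Tree m) {ν} p {z} →
                   (∀ i → lookup os′ (ν i) ≡ lookup os i) → Models os′ (match ν p z) →
                   lookup os′ z ≡ inst os p
    match-models _ (var i) ν≡ (eq , _) = trans (sym eq) (ν≡ i)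
    match-models _ leafᵖ ν≡ eq       = eq
    match-models os′ (nodeᵖ p q) ν≡ (a , b , mp , mq , eq) =
      trans eq (cong₂ node (match-models (b ∷ a ∷ os′) p ν≡ mp) (match-models (b ∷ a ∷ os′) q ν≡ mq))

    rule-models : ∀ i → Models [] (ruleᴸ (lookup program i))
    rule-models i = closeAll-models (suc (vars r)) λ { (o ∷ os) matched →
      ⇒*-models (Data.List.map (instance-holds suc) (premises r)) λ ps →
        subst (Derivable program) (sym (match-models (o ∷ os) (conclusion r) (λ _ → refl) matched))
          (derive i os (premise-instances os ps)) }
      where
      r = lookup program i
      premise-instances : ∀ {o} os {ps} →
        All (Models (o ∷ os)) (Data.List.map (instance-holds suc) ps) → All (Derivable program ∘ inst os) ps
      premise-instances os {[]}     []                      = []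
      premise-instances {o} os {p ∷ ps} ((t , matched , d) ∷ rest) =
        subst (Derivable program) (match-models (t ∷ o ∷ os) p (λ _ → refl) matched) d ∷ premise-instances os rest

    theory-models : Models [] (theory program)
    theory-models = (leaf , refl) , (λ x y → node x y , refl) ,
      (λ { x y (refl , refl) → refl , refl }) ,
      (λ { _ _ _ _ _ _ (refl , refl , (refl , _) , (refl , _)) → refl , refl }) ,
      rules-models program (λ i → rule-models i)
      where
      rules-models : ∀ {m} (rs : Vec Rule m) → (∀ i → Models [] (ruleᴸ (lookup rs i))) → Models [] (rulesᴸ rs)
      rules-models []       f = leaf , refl
      rules-models (r ∷ rs) f = f zero , rules-models rs (f ∘ suc)

    module ForcedTheory (Q₀ : Subset ℝ) (𝓕 : Subset ℝ → Set) (ps : Params) where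

      open Forcing Q₀ 𝓕 ps

      module Consequences {I : Itv} (forced : Force I [] (theory program)) where

        -- The clauses for `all` and `_⇒_` speak of strictly smaller intervals only; locality brings
        -- the conclusion back to J itself.
        instantiate : ∀ k (φ : L k) → Force I [] (closeAll k φ) → ∀ {J} → J ⊏ I → (xs : Vec (Subset ℝ) k) →
                      (∀ i → Named J (lookup xs i)) → Force J xs φ
        instantiate zero    φ f J⊏I [] _ = force-persistent [] φ J⊏I f
        instantiate (suc k) φ f {J} J⊏I (A ∷ xs) named = force-local (A ∷ xs) φ λ K K⊏J →
          let M , M⊏K = ⊏-below K⊏J in
          M , M⊏K , instantiate k (all φ) f J⊏I xs (named ∘ suc) M (⊏-trans M⊏K K⊏J) A
                      (named-persistent (⊏-trans M⊏K K⊏J) (named zero))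

        modus-ponens : ∀ {k J} {xs : Vec (Subset ℝ) k} φ ψ → Force J xs (φ ⇒ ψ) → Force J xs φ → Force J xs ψ
        modus-ponens {xs = xs} φ ψ f p = force-local xs ψ λ K K⊏J →
          let M , M⊏K = ⊏-below K⊏J ; M⊏J = ⊏-trans M⊏K K⊏J
          in M , M⊏K , f M M⊏J (force-persistent xs φ M⊏J p)

        -- In an arbitrary structure trees have no colours. That w denotes a tree is expressed
        -- through forced relations alone, the sets for the subtrees being found on a dense set of
        -- intervals.
        Den : Itv → Tree → Subset ℝ → Set
        Den J leaf       w = Force J (w ∷ []) (leafᴸ 0F)
        Den J (node s t) w = Densely J λ K → ∃₂ λ u v → Named K u × Named K v × Den K s u × Den K t v ×
                                           Force K (u ∷ v ∷ w ∷ []) (rel nodeᵗ 0F 1F 2F)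

        den-persistent : ∀ t {w} → Persistent λ J → Den J t w
        den-persistent leaf       {w} K⊏J d = force-persistent (w ∷ []) (leafᴸ 0F) K⊏J d
        den-persistent (node s t) K⊏J d     = λ M M⊏K → d M (⊏-trans M⊏K K⊏J)

        Denotes : Itv → Tree → Subset ℝ → Set
        Denotes J t w = Named J w × Den J t w

        denotes-persistent : ∀ t {w} → Persistent λ J → Denotes J t w
        denotes-persistent t {w} K⊏J (n , d) = named-persistent K⊏J n , den-persistent t {w} K⊏J d

        denotes-node : ∀ s t {J u v} → J ⊏ I → Denotes J s u → Denotes J t v →
                       Densely J λ K → ∃ (Denotes K (node s t))
        denotes-node s t {J} {u} {v} J⊏I du dv K K⊏J =
          let M , M⊏K , w , nw , g = node-exists K K⊏J
          in M , M⊏K , w , nw , λ N N⊏M → children M⊏K g N⊏M (⊏-below N⊏M)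
          where
          node-exists : Densely J λ K → ∃ λ w → Named K w × Force K (w ∷ v ∷ u ∷ []) (rel nodeᵗ 2F 1F 0F)
          node-exists = instantiate 2 (ex (rel nodeᵗ 2F 1F 0F)) (proj₁ (proj₂ forced)) J⊏I
            (v ∷ u ∷ []) (λ { 0F → proj₁ dv ; 1F → proj₁ du })
          children : ∀ {M N w} → M ⊏ K → Force M (w ∷ v ∷ u ∷ []) (rel nodeᵗ 2F 1F 0F) →
            N ⊏ M → (∃ λ O → O ⊏ N) → ∃ λ O → O ⊏ N × ∃₂ λ u v →
            Named O u × Named O v × Den O s u × Den O t v × Force O (u ∷ v ∷ w ∷ []) (rel nodeᵗ 0F 1F 2F)
          children M⊏K g N⊏M (O , O⊏N) =
            let O⊏M = ⊏-trans O⊏N N⊏M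
                O⊏J = ⊏-trans O⊏M (⊏-trans M⊏K K⊏J)
                nu , du′ = denotes-persistent s {u} O⊏J du
                nv , dv′ = denotes-persistent t {v} O⊏J dv
            in O , O⊏N , u , v , nu , nv , du′ , dv′ , good-persistent O⊏M g

        denotes-exists : ∀ t {J} → J ⊏ I → Densely J λ K → ∃ (Denotes K t)
        denotes-exists leaf J⊏I K K⊏J = proj₁ forced K (⊏-trans K⊏J J⊏I)
        denotes-exists (node s t) {J} J⊏I = densely->>= {I = J} (denotes-exists s J⊏I) λ {K} K⊏J (u , du) →
          let K⊏I = ⊏-trans K⊏J J⊏I in
          densely->>= {I = K} (denotes-exists t K⊏I) λ M⊏K (v , dv) →
            denotes-node s t {_} {u} {v} (⊏-trans M⊏K K⊏I) (denotes-persistent s {u} M⊏K du) dv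

        equal-leaves : ∀ {J w w′} → J ⊏ I → Denotes J leaf w → Denotes J leaf w′ → Good J (quad eqᵗ w w′ w′)
        equal-leaves {J} {w} {w′} J⊏I (n , d) (n′ , d′) =
          modus-ponens {xs = w′ ∷ w ∷ []} (leafᴸ 1F & leafᴸ 0F) (eqᴸ 1F 0F)
            (instantiate 2 (leafᴸ 1F & leafᴸ 0F ⇒ eqᴸ 1F 0F) (proj₁ (proj₂ (proj₂ forced))) J⊏I
              (w′ ∷ w ∷ []) (λ { 0F → n′ ; 1F → n }))
            (d , d′)

        equal-nodes : ∀ {J u v w u′ v′ w′} → J ⊏ I →
          Named J u → Named J v → Named J w → Named J u′ → Named J v′ → Named J w′ →
          Good J (quad nodeᵗ u v w) → Good J (quad nodeᵗ u′ v′ w′) →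
          Good J (quad eqᵗ u u′ u′) → Good J (quad eqᵗ v v′ v′) → Good J (quad eqᵗ w w′ w′)
        equal-nodes {J} {u} {v} {w} {u′} {v′} {w′} J⊏I nu nv nw nu′ nv′ nw′ g g′ p q =
          modus-ponens {xs = xs} φ (eqᴸ 3F 0F)
            (instantiate 6 (φ ⇒ eqᴸ 3F 0F) (proj₁ (proj₂ (proj₂ (proj₂ forced)))) J⊏I xs
              (λ { 0F → nw′ ; 1F → nv′ ; 2F → nu′ ; 3F → nw ; 4F → nv ; 5F → nu }))
            (g , g′ , p , q)
          where
          xs = w′ ∷ v′ ∷ u′ ∷ w ∷ v ∷ u ∷ []
          φ = rel nodeᵗ 5F 4F 3F & rel nodeᵗ 2F 1F 0F & eqᴸ 5F 2F & eqᴸ 4F 1F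

        -- Two decompositions of a node are compared on a common smaller interval, where the
        -- subtrees agree by induction and `node-congruent` applies.
        denotes-unique : ∀ t {J w w′} → J ⊏ I → Denotes J t w → Denotes J t w′ → Good J (quad eqᵗ w w′ w′)
        denotes-unique leaf J⊏I d d′ = equal-leaves J⊏I d d′
        denotes-unique (node s t) {J} {w} {w′} J⊏I (n , d) (n′ , d′) = good-local λ K K⊏J →
          let M , M⊏K , parts = d K K⊏J
              N , N⊏M = ⊏-below M⊏K
              O , O⊏N , parts′ = d′ N (⊏-trans N⊏M (⊏-trans M⊏K K⊏J))
          in O , ⊏-trans O⊏N (⊏-trans N⊏M M⊏K) , agree (⊏-trans M⊏K K⊏J) (⊏-trans O⊏N N⊏M) parts parts′
          where
          Parts : Itv → Subset ℝ → Set
          Parts K w = ∃₂ λ u v → Named K u × Named K v × Den K s u × Den K t v × Good K (quad nodeᵗ u v w)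
          agree : ∀ {K M} → K ⊏ J → M ⊏ K → Parts K w → Parts M w′ → Good M (quad eqᵗ w w′ w′)
          agree K⊏J M⊏K (u , v , nu , nv , du , dv , g) (u′ , v′ , nu′ , nv′ , du′ , dv′ , g′) =
            equal-nodes M⊏I (named-persistent M⊏K nu) (named-persistent M⊏K nv) (named-persistent M⊏J n)
              nu′ nv′ (named-persistent M⊏J n′) (good-persistent M⊏K g) g′
              (denotes-unique s M⊏I (denotes-persistent s {u} M⊏K (nu , du)) (nu′ , du′))
              (denotes-unique t M⊏I (denotes-persistent t {v} M⊏K (nv , dv)) (nv′ , dv′))
            where
            M⊏J = ⊏-trans M⊏K K⊏J
            M⊏I = ⊏-trans M⊏J J⊏I

        -- At a variable, the set at z need not be the set assigned to the variable; that both
        -- denote the same tree gives their equality in the sense of `eqᵗ`.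
        denotes-match : ∀ {k m} p (os : Vec Tree k) (xs : Vec (Subset ℝ) m) ν z {J} → J ⊏ I →
                        (∀ i → Denotes J (lookup os i) (lookup xs (ν i))) →
                        Denotes J (inst os p) (lookup xs z) → Force J xs (match ν p z)
        denotes-match (var i) os xs ν z J⊏I ds d = denotes-unique (lookup os i) J⊏I (ds i) d
        denotes-match leafᵖ os xs ν z J⊏I ds (_ , d) = d
        denotes-match (nodeᵖ p q) os xs ν z {J} J⊏I ds (_ , d) K K⊏J =
          let M , M⊏K , u , v , nu , nv , du , dv , g = d K K⊏J
          in M , M⊏K , u , nu , λ N N⊏M → let O , O⊏N = ⊏-below N⊏M ; O⊏M = ⊏-trans O⊏N N⊏M
             in O , O⊏N , v , named-persistent O⊏M nv ,
                both (⊏-trans O⊏M (⊏-trans M⊏K K⊏J)) (denotes-persistent (inst os p) {u} O⊏M (nu , du))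
                  (denotes-persistent (inst os q) {v} O⊏M (nv , dv)) (good-persistent O⊏M g)
          where
          both : ∀ {K u v} → K ⊏ J → Denotes K (inst os p) u → Denotes K (inst os q) v →
                 Good K (quad nodeᵗ u v (lookup xs z)) →
                 Force K (v ∷ u ∷ xs) (match (λ i → suc (suc (ν i))) p 1F & match (λ i → suc (suc (ν i))) q 0F &
                                       rel nodeᵗ 1F 0F (suc (suc z)))
          both {K} {u} {v} K⊏J du dv g =
            denotes-match p os (v ∷ u ∷ xs) (λ i → suc (suc (ν i))) 1F (⊏-trans K⊏J J⊏I) ds′ du ,
            denotes-match q os (v ∷ u ∷ xs) (λ i → suc (suc (ν i))) 0F (⊏-trans K⊏J J⊏I) ds′ dv , g
            where
            ds′ : ∀ i → Denotes K (lookup os i) (lookup xs (ν i))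
            ds′ i = denotes-persistent (lookup os i) {lookup xs (ν i)} K⊏J (ds i)

        DenotesAll : ∀ {k} → Itv → Vec Tree k → Vec (Subset ℝ) k → Set
        DenotesAll J os xs = ∀ i → Denotes J (lookup os i) (lookup xs i)

        denotes-all-exists : ∀ {k} (os : Vec Tree k) {J} → J ⊏ I → Densely J λ K → ∃ (DenotesAll K os)
        denotes-all-exists []       J⊏I K K⊏J = let M , M⊏K = ⊏-below K⊏J in M , M⊏K , [] , λ ()
        denotes-all-exists (o ∷ os) {J} J⊏I = densely->>= {I = J} (denotes-exists o J⊏I) λ K⊏J (x , d) M M⊏K →
          let N , N⊏M , xs , ds = denotes-all-exists os (⊏-trans K⊏J J⊏I) M M⊏K
              N⊏K = ⊏-trans N⊏M M⊏K
          in N , N⊏M , x ∷ xs , λ { zero → denotes-persistent o {x} N⊏K d ; (suc i) → ds i }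

        rule-forced : ∀ i → Force I [] (ruleᴸ (lookup program i))
        rule-forced = go program (proj₂ (proj₂ (proj₂ (proj₂ forced))))
          where
          go : ∀ {m} (rs : Vec Rule m) → Force I [] (rulesᴸ rs) → ∀ i → Force I [] (ruleᴸ (lookup rs i))
          go (r ∷ rs) (f , _)  zero    = f
          go (r ∷ rs) (_ , fs) (suc i) = go rs fs i

        mutual
          -- By induction on the derivation, for all sets w denoting the tree: the variables of the
          -- last rule have denoting sets on a dense set of intervals, and the conclusion is local.
          derivable-forced : ∀ {t} → Derivable program t → ∀ {J w} → J ⊏ I → Denotes J t w →
                             Good J (quad holds w w w)
          derivable-forced (derive i os ds) {J} {w} J⊏I dw = good-local λ K K⊏J →
            let M , M⊏K , xs , dxs = denotes-all-exists os J⊏I K K⊏J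
                M⊏J = ⊏-trans M⊏K K⊏J
            in M , M⊏K , premises-forced ds {M} {w} {xs} (⊏-trans M⊏J J⊏I) dxs
                 (applied (⊏-trans M⊏J J⊏I) dxs
                   (denotes-persistent (inst os (conclusion (lookup program i))) {w} M⊏J dw))
            where
            r = lookup program i
            ψ = Data.List.map (instance-holds suc) (premises r) ⇒* holdsᴸ 0F
            applied : ∀ {M xs} → M ⊏ I → DenotesAll M os xs → Denotes M (inst os (conclusion r)) w →
                      Force M (w ∷ xs) ψ
            applied {M} {xs} M⊏I dxs dw =
              modus-ponens {xs = w ∷ xs} (match suc (conclusion r) 0F) ψ
                (instantiate (suc (vars r)) (match suc (conclusion r) 0F ⇒ ψ) (rule-forced i) M⊏I (w ∷ xs)
                  (λ { zero → proj₁ dw ; (suc i) → proj₁ (dxs i) }))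
                (denotes-match (conclusion r) os (w ∷ xs) suc 0F M⊏I dxs dw)

          premises-forced : ∀ {k} {os : Vec Tree k} {ps} → All (Derivable program ∘ inst os) ps →
            ∀ {J w xs} → J ⊏ I → DenotesAll J os xs →
            Force J (w ∷ xs) (Data.List.map (instance-holds suc) ps ⇒* holdsᴸ 0F) →
            Good J (quad holds w w w)
          premises-forced [] J⊏I dxs f = f
          premises-forced {os = os} {p ∷ ps} (d ∷ ds) {J} {w} {xs} J⊏I dxs f =
            premises-forced ds {J} {w} {xs} J⊏I dxs
              (modus-ponens {xs = w ∷ xs} (instance-holds suc p)
                (Data.List.map (instance-holds suc) ps ⇒* holdsᴸ 0F) f premise)
            where
            premise : Force J (w ∷ xs) (instance-holds suc p)
            premise K K⊏J =
              let M , M⊏K , z , dz = denotes-exists (inst os p) J⊏I K K⊏J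
                  M⊏J = ⊏-trans M⊏K K⊏J
                  M⊏I = ⊏-trans M⊏J J⊏I
              in M , M⊏K , z , proj₁ dz ,
                 denotes-match p os (z ∷ w ∷ xs) (λ i → suc (suc i)) 0F M⊏I
                   (λ i → denotes-persistent (lookup os i) {lookup xs i} M⊏J (dxs i)) dz ,
                 derivable-forced d M⊏I dz

        instance-forced : ∀ {k} p {os : Vec Tree k} {xs J} → J ⊏ I → DenotesAll J os xs →
                          Derivable program (inst os p) → Force J xs (instance-holds id p)
        instance-forced p {os} {xs} {J} J⊏I dxs d K K⊏J =
          let M , M⊏K , z , dz = denotes-exists (inst os p) J⊏I K K⊏J
              M⊏J = ⊏-trans M⊏K K⊏J
              M⊏I = ⊏-trans M⊏J J⊏I
          in M , M⊏K , z , proj₁ dz ,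
             denotes-match p os (z ∷ xs) suc 0F M⊏I
               (λ i → denotes-persistent (lookup os i) {lookup xs i} M⊏J (dxs i)) dz ,
             derivable-forced d M⊏I dz

  -- Forcing is definable

  infix 1 _↔_
  _↔_ : Set → Set → Set
  A ↔ B = (A → B) × (B → A)

  ↔-neg : ∀ {P A : Set} → P ↔ A → ¬ P ↔ ¬ A
  ↔-neg (f , g) = _∘ g , _∘ f

  ↔-and : ∀ {P R A B : Set} → P ↔ A → R ↔ B → P × R ↔ A × B
  ↔-and (f , g) (h , k) = (λ (p , q) → f p , h q) , (λ (p , q) → g p , k q)

  ↔-imp : ∀ {P R A B : Set} → P ↔ A → R ↔ B → ¬ (P × ¬ R) ↔ (A → B)
  ↔-imp (f , g) (h , k) = (λ s a → h (stable λ ¬r → s (g a , ¬r))) , (λ m (p , ¬r) → ¬r (k (m (f p))))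

  ↔-ex : ∀ {X : Set} {P A : X → Set} → (∀ x → P x ↔ A x) → ∃ P ↔ ∃ A
  ↔-ex h = (λ (x , p) → x , proj₁ (h x) p) , (λ (x , a) → x , proj₂ (h x) a)

  ↔-all : ∀ {X : Set} {P A : X → Set} → (∀ x → P x ↔ A x) → ¬ (∃ λ x → ¬ P x) ↔ (∀ x → A x)
  ↔-all h = (λ s x → proj₁ (h x) (stable λ ¬p → s (x , ¬p))) , (λ m (x , ¬p) → ¬p (proj₂ (h x) (m x)))

  ↔-allIn : ∀ {X : Set} {D P A : X → Set} → (∀ x → D x → P x ↔ A x) →
            ¬ (∃ λ x → D x × ¬ P x) ↔ (∀ x → D x → A x)
  ↔-allIn h = (λ s x d → proj₁ (h x d) (stable λ ¬p → s (x , d , ¬p))) ,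
              (λ m (x , d , ¬p) → ¬p (proj₂ (h x d) (m x d)))

  ↔-exItv : ∀ {D P : ℝ → ℝ → Set} {Γ A : Itv → Set} → (∀ c d → D c d ↔ Γ (c , d)) →
            (∀ c d → P c d ↔ A (c , d)) → (∃₂ λ c d → D c d × P c d) ↔ (∃ λ J → Γ J × A J)
  ↔-exItv g h =
    (λ (c , d , p , q) → (c , d) , proj₁ (g c d) p , proj₁ (h c d) q) ,
    (λ ((c , d) , p , q) → c , d , proj₂ (g c d) p , proj₂ (h c d) q)

  ↔-allItv : ∀ {D P : ℝ → ℝ → Set} {Γ A : Itv → Set} → (∀ c d → D c d ↔ Γ (c , d)) →
             (∀ c d → P c d ↔ A (c , d)) → ¬ (∃₂ λ c d → D c d × ¬ P c d) ↔ (∀ J → Γ J → A J)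
  ↔-allItv g h =
    (λ s (c , d) p → proj₁ (h c d) (stable λ ¬p → s (c , d , proj₂ (g c d) p , ¬p))) ,
    (λ m (c , d , p , ¬p) → ¬p (proj₂ (h c d) (m (c , d) (proj₁ (g c d) p))))

  Product : ∀ k → (Fin (suc k) → Set) → Set
  Product zero    P = P zero
  Product (suc k) P = P zero × Product k (λ i → P (suc i))

  ↔-product : ∀ k (P : Fin (suc k) → Set) {A : Fin (suc k) → Set} → (∀ i → P i ↔ A i) → Product k P ↔ (∀ i → A i)
  ↔-product zero    P h = (λ p → λ { zero → proj₁ (h zero) p }) , (λ m → proj₂ (h zero) (m zero))
  ↔-product (suc k) P h =
    (λ (p , q) → λ { zero → proj₁ (h zero) p ; (suc i) → proj₁ (↔-product k (λ i → P (suc i)) (λ i → h (suc i))) q i }) ,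
    (λ m → proj₂ (h zero) (m zero) , proj₂ (↔-product k (λ i → P (suc i)) (λ i → h (suc i))) (λ i → m (suc i)))

  ↔-within : ∀ x a b → a <ᴿ x × x <ᴿ b ↔ x ∈ᴵ (a , b)
  ↔-within x a b = ↔-and (<ᴿ⇒< , <⇒<ᴿ) (<ᴿ⇒< , <⇒<ᴿ)

  ↔-sub : ∀ c d a b → a <ᴿ c × c <ᴿ d × d <ᴿ b ↔ (c , d) ⊏ (a , b)
  ↔-sub c d a b =
    (λ (p , q , r) → inside (<ᴿ⇒< p) (<ᴿ⇒< q) (<ᴿ⇒< r)) ,
    (λ (inside p q r) → <⇒<ᴿ p , <⇒<ᴿ q , <⇒<ᴿ r)

  -- `Witness` contains membership in 𝓕, which its formula leaves to the range of the set
  -- quantifier.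
  ↔-given : ∀ {D P A : Set} → D → P ↔ A → P ↔ D × A
  ↔-given d (f , g) = (λ p → d , f p) , (λ (_ , a) → g a)

  ↔-reflexive : ∀ {A B : Set} → A ≡ B → A ↔ B
  ↔-reflexive refl = id , id

  module Definability {n : ℕ} (Q : Fin (suc n) → Subset ℝ) (𝓕 : Subset ℝ → Set) where

    open Formulas {suc n}
    open GoodFormula {n}
    open Satisfaction (K (suc n) Q) 𝓕

    itv : ∀ {e} → Vec ℝ e → ItvVar e → Itv
    itv ρ (a , b) = lookup ρ a , lookup ρ b

    ↔-subItv : ∀ {e} (ρ : Vec ℝ e) I c d →
                lookup ρ (proj₁ I) <ᴿ c × c <ᴿ d × d <ᴿ lookup ρ (proj₂ I) ↔ (c , d) ⊏ itv ρ I
    ↔-subItv ρ I c d = ↔-sub c d (lookup ρ (proj₁ I)) (lookup ρ (proj₂ I))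

    ↔-subset : ∀ {e s} (ρ : Vec ℝ e) (σ : Vec (Subset ℝ) s) A B →
               Sat ρ σ (subset A B) ↔ (lookup σ A ⊆ lookup σ B)
    ↔-subset ρ σ A B = (λ p {x} → proj₁ pointwise p x) , (λ h → proj₂ pointwise λ x → h {x})
      where
      pointwise : Sat ρ σ (subset A B) ↔ (∀ x → x ∈ lookup σ A → x ∈ lookup σ B)
      pointwise = ↔-all λ x → ↔-imp (id , id) (id , id)

    ↔-exSets : ∀ {e s} (ρ : Vec ℝ e) (σ : Vec (Subset ℝ) s) k φ → Sat ρ σ (exSets k φ) ↔
               ∃ λ (Xs : Vec (Subset ℝ) k) → (∀ i → 𝓕 (lookup Xs i)) × Sat ρ (Xs ++ σ) φ
    ↔-exSets ρ σ zero    φ = (λ p → [] , (λ ()) , p) , λ { ([] , _ , p) → p }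
    ↔-exSets ρ σ (suc k) φ =
      (λ p → let Xs , Xs∈ , X , X∈ , q = proj₁ (↔-exSets ρ σ k (exSet φ)) p
             in X ∷ Xs , (λ { zero → X∈ ; (suc i) → Xs∈ i }) , q) ,
      λ { (X ∷ Xs , Xs∈ , q) →
        proj₂ (↔-exSets ρ σ k (exSet φ)) (Xs , (λ i → Xs∈ (suc i)) , X , Xs∈ zero , q) }

    evalTerm : ∀ {s} → Vec (Subset ℝ) s → TermVar s → Subset ℝ × Subset ℝ
    evalTerm σ (A , B) = lookup σ A , lookup σ B

    module _ (ps : Params) where

      open Forcing (Q 0F) 𝓕 ps

      ↔-witness : ∀ {e s} (ρ : Vec ℝ e) (σ : Vec (Subset ℝ) s) I Y Z {Zs} →
                  (∀ j → evalTerm σ (Z j) ≡ lookup Zs j) → 𝓕 (lookup σ Y) →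
                  Sat ρ σ (witnessF I Y Z) ↔ Witness (itv ρ I) Zs (lookup σ Y)
      ↔-witness ρ σ I Y Z eval Y∈ = ↔-given Y∈
         (↔-and (↔-ex λ u → id , id)
         (↔-and (↔-all λ u → ↔-imp (id , id) (↔-and
                  (↔-within u (lookup ρ (proj₁ I)) (lookup ρ (proj₂ I)))
                  (↔-allItv (λ c d → ↔-within u c d) (λ c d → ↔-product 3
                    (λ j → ∃ λ v → (c <ᴿ v × v <ᴿ d) × v ∈ lookup σ Y × v ∈² evalTerm σ (Z j)) λ j → ↔-ex λ v →
                    ↔-and (↔-within v c d) (↔-and (id , id) (↔-reflexive (cong (v ∈²_) (eval j))))))))
                (↔-all λ u → ↔-imp (id , id) (↔-exItv (λ c d → ↔-within u c d)
                  (λ c d → ↔-all λ v → ↔-imp (↔-within v c d) (↔-neg (id , id)))))))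

      ↔-good : ∀ {e s} (ρ : Vec ℝ e) (σ : Vec (Subset ℝ) s) I Z {Zs} → Vec.map (evalTerm σ) Z ≡ Zs →
               Sat ρ σ (goodF I Z) ↔ Good (itv ρ I) Zs
      ↔-good ρ σ I Z refl = good ∘ proj₁ body , proj₂ body ∘ witness
        where
        at : ∀ Y c d → 𝓕 Y → Sat (d ∷ c ∷ ρ) (Y ∷ σ) (witnessF last 0F λ j →
               let (A , B) = lookup Z j in suc A , suc B) ↔ Witness (c , d) (Vec.map (evalTerm σ) Z) Y
        at Y c d = ↔-witness (d ∷ c ∷ ρ) (Y ∷ σ) last 0F
          (λ j → let (A , B) = lookup Z j in suc A , suc B) {Vec.map (evalTerm σ) Z} λ j → sym (Vec.lookup-map j (evalTerm σ) Z)
        body : Sat ρ σ (goodF I Z) ↔ (∀ J → J ⊏ itv ρ I → ∃ (Witness J (Vec.map (evalTerm σ) Z)))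
        body = ↔-allItv (↔-subItv ρ I) λ c d →
          (λ (Y , Y∈ , p) → Y , proj₁ (at Y c d Y∈) p) ,
          (λ (Y , w) → Y , proj₁ w , proj₂ (at Y c d (proj₁ w)) w)

      ↔-dense : ∀ {e s} (ρ : Vec ℝ e) (σ : Vec (Subset ℝ) s) I Z {T} → evalTerm σ Z ≡ T →
                Sat ρ σ (denseF I Z) ↔ DenseIn (itv ρ I) T
      ↔-dense ρ σ I Z refl = ↔-allItv (↔-subItv ρ I) λ c d →
        ↔-ex λ v → ↔-and (↔-within v c d) (id , id)

      module _ {s} (σ : Vec (Subset ℝ) s) (π : Fin 7 → Fin s) (eval : ∀ j → lookup σ (π j) ≡ lookup ps j) where

        eval-quad : ∀ t {A B C X Y Z} → lookup σ A ≡ X → lookup σ B ≡ Y → lookup σ C ≡ Z →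
                    Vec.map (evalTerm σ) (quadF π t A B C) ≡ quad t X Y Z
        eval-quad t refl refl refl = cong₂ _∷_ (cong (_ ,_) (eval 0F)) (cong₂ _∷_ (cong (_ ,_) (eval 1F))
          (cong₂ _∷_ (cong (_ ,_) (eval 2F)) (cong (λ E → (E , E) ∷ []) (eval (tagIx t)))))

        ↔-mono : ∀ {e} (ρ : Vec ℝ e) I A → Sat ρ σ (monoF π I A) ↔ Mono (itv ρ I) (lookup σ A)
        ↔-mono ρ I A = ↔-product 2 (λ i → Sat ρ σ (sortMonoF π I A i)) λ i →
          ↔-allItv (↔-subItv ρ I) λ c d →
          ↔-allIn λ B _ → ↔-allIn λ C _ → let ρ′ = d ∷ c ∷ ρ ; σ′ = C ∷ B ∷ σ ; P = suc (suc (π (sortIx i))) in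
            ↔-imp (↔-subset ρ′ σ′ 1F (suc (suc A))) (↔-imp (↔-subset ρ′ σ′ 0F (suc (suc A)))
            (↔-imp (↔-dense ρ′ σ′ last (1F , P) (cong (B ,_) (eval (sortIx i))))
            (↔-imp (↔-dense ρ′ σ′ last (0F , P) (cong (C ,_) (eval (sortIx i))))
            (↔-good ρ′ σ′ last (twinsF 1F 0F P) (cong (twins B C) (eval (sortIx i)))))))

        ↔-name : ∀ {e} (ρ : Vec ℝ e) I A → Sat ρ σ (nameF π I A) ↔ Name (itv ρ I) (lookup σ A)
        ↔-name ρ I A = ↔-and (↔-good ρ σ I (quadF π eqᵗ A A A) (eval-quad eqᵗ refl refl refl)) (↔-mono ρ I A)

      lookup-extendVar : ∀ {k s} {σ : Vec (Subset ℝ) s} {ν : Fin k → Fin s} {xs : Vec (Subset ℝ) k} {A} →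
        (∀ i → lookup σ (ν i) ≡ lookup xs i) → ∀ i → lookup (A ∷ σ) (extendVar ν i) ≡ lookup (A ∷ xs) i
      lookup-extendVar ν≡ zero    = refl
      lookup-extendVar ν≡ (suc i) = ν≡ i

      ↔-force : ∀ {e s k} (ρ : Vec ℝ e) (σ : Vec (Subset ℝ) s) (π : Fin 7 → Fin s)
                (eval : ∀ j → lookup σ (π j) ≡ lookup ps j) (ν : Fin k → Fin s) (xs : Vec (Subset ℝ) k)
                (ν≡ : ∀ i → lookup σ (ν i) ≡ lookup xs i) I (φ : L k) →
                Sat ρ σ (forceF π ν I φ) ↔ Force (itv ρ I) xs φ
      ↔-force ρ σ π eval ν xs ν≡ I (rel t x y z) =
        ↔-good ρ σ I (quadF π t (ν x) (ν y) (ν z)) (eval-quad σ π eval t (ν≡ x) (ν≡ y) (ν≡ z))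
      ↔-force ρ σ π eval ν xs ν≡ I (φ & ψ) =
        ↔-and (↔-force ρ σ π eval ν xs ν≡ I φ) (↔-force ρ σ π eval ν xs ν≡ I ψ)
      ↔-force ρ σ π eval ν xs ν≡ I (φ ⇒ ψ) =
        ↔-allItv (↔-subItv ρ I) λ c d →
          ↔-imp (↔-force (d ∷ c ∷ ρ) σ π eval ν xs ν≡ last φ) (↔-force (d ∷ c ∷ ρ) σ π eval ν xs ν≡ last ψ)
      ↔-force ρ σ π eval ν xs ν≡ I (all φ) =
        (λ p J J⊏I A (A∈ , named) → proj₁ curried p J J⊏I A A∈ named) ,
        (λ p → proj₂ curried λ J J⊏I A A∈ named → p J J⊏I A (A∈ , named))
        where
        curried : Sat ρ σ (forceF π ν I (all φ)) ↔
                  (∀ J → J ⊏ itv ρ I → ∀ A → 𝓕 A → Name J A → Force J (A ∷ xs) φ)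
        curried = ↔-allItv (↔-subItv ρ I) λ c d → ↔-allIn λ A _ →
          ↔-imp (↔-name (A ∷ σ) (λ j → suc (π j)) eval (d ∷ c ∷ ρ) last 0F)
                (↔-force (d ∷ c ∷ ρ) (A ∷ σ) (λ j → suc (π j)) eval (extendVar ν) (A ∷ xs)
                  (lookup-extendVar {ν = ν} {xs} ν≡) last φ)
      ↔-force ρ σ π eval ν xs ν≡ I (ex φ) =
        ↔-allItv (↔-subItv ρ I) λ c d →
        ↔-exItv (λ c′ d′ → ↔-sub c′ d′ c d) λ c′ d′ →
          (λ (A , A∈ , p) → let named , q = proj₁ (at c d c′ d′ A) p in A , (A∈ , named) , q) ,
          (λ (A , (A∈ , named) , q) → A , A∈ , proj₂ (at c d c′ d′ A) (named , q))
        where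
        at : ∀ c d c′ d′ A →
          Sat (d′ ∷ c′ ∷ d ∷ c ∷ ρ) (A ∷ σ)
            (and (nameF (λ j → suc (π j)) last 0F) (forceF (λ j → suc (π j)) (extendVar ν) last φ)) ↔
          Name (c′ , d′) A × Force (c′ , d′) (A ∷ xs) φ
        at c d c′ d′ A =
          ↔-and (↔-name (A ∷ σ) (λ j → suc (π j)) eval (d′ ∷ c′ ∷ d ∷ c ∷ ρ) last 0F)
                (↔-force (d′ ∷ c′ ∷ d ∷ c ∷ ρ) (A ∷ σ) (λ j → suc (π j)) eval (extendVar ν) (A ∷ xs)
                  (lookup-extendVar {ν = ν} {xs} ν≡) last φ)

  -- Truth of the diagonal sentences

  module SentenceTruth {n : ℕ} (Q : Fin (suc n) → Subset ℝ) (𝓕 : Subset ℝ → Set) where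

    open Formulas {suc n}
    open GoodFormula {n}
    open SentenceFormula {n}
    open Satisfaction (K (suc n) Q) 𝓕
    open Definability {n} Q 𝓕

    module F = Forcing (Q 0F) 𝓕

    Numeral : Params → Itv → ℕ → Subset ℝ → Set
    Numeral ps I zero    x = F.Force ps I (x ∷ []) (leafᴸ 0F)
    Numeral ps I (suc m) x = ∃ λ v → F.Named ps I v ×
      (∃ λ u → F.Named ps I u × F.Force ps I (u ∷ v ∷ x ∷ []) (leafᴸ 0F & rel nodeᵗ 0F 1F 2F)) × Numeral ps I m v

    eval-params : ∀ {s} x (ps : Params) (rest : Vec (Subset ℝ) s) j →
                  lookup (x ∷ ps ++ rest) (paramVars j) ≡ lookup ps j
    eval-params x ps rest j = Vec.lookup-++ˡ ps rest j

    ↔-copy : ∀ ρ v (qs : Params) {s} x (ps : Params) (rest : Vec (Subset ℝ) s) →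
             Sat {2} ρ (v ∷ qs ++ (x ∷ ps ++ rest))
               (conj 6 λ j → equalSets (suc (j ↑ˡ (8 ℕ.+ s))) (8 ↑ʳ (paramVars {s} j))) ↔ (qs ≡ ps)
    ↔-copy ρ v qs {s} x ps rest =
      (λ p → vec-ext qs ps (proj₁ pointwise p)) , (λ eq → proj₂ pointwise λ j → cong (λ xs → lookup xs j) eq)
      where
      σ = v ∷ qs ++ (x ∷ ps ++ rest)
      new old : Fin 7 → Fin (8 ℕ.+ (8 ℕ.+ s))
      new j = suc (j ↑ˡ (8 ℕ.+ s))
      old j = 8 ↑ʳ paramVars {s} j
      old≡ : ∀ j → lookup σ (old j) ≡ lookup ps j
      old≡ j = trans (Vec.lookup-++ʳ (v ∷ qs) (x ∷ ps ++ rest) (paramVars j)) (eval-params x ps rest j)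
      new≡ : ∀ j → lookup σ (new j) ≡ lookup qs j
      new≡ j = eval-params v qs (x ∷ ps ++ rest) j
      pointwise = ↔-product 6 (λ j → Sat ρ σ (equalSets (new j) (old j))) {λ j → lookup qs j ≡ lookup ps j} λ j →
        (λ (p , q) → trans (sym (new≡ j)) (trans
          (⊆-antisym {X = lookup σ (new j)} {lookup σ (old j)}
            (λ {x} → proj₁ (↔-subset ρ σ (new j) (old j)) p {x})
            (λ {x} → proj₁ (↔-subset ρ σ (old j) (new j)) q {x})) (old≡ j))) ,
        (λ eq → let same = trans (new≡ j) (trans eq (sym (old≡ j))) in
          proj₂ (↔-subset ρ σ (new j) (old j)) (λ {x} → subst (x ∈_) same) ,
          proj₂ (↔-subset ρ σ (old j) (new j)) (λ {x} → subst (x ∈_) (sym same)))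

    ↔-isSuccessor : ∀ a b v ps {s} x (rest : Vec (Subset ℝ) s) →
      Sat (b ∷ a ∷ []) (v ∷ ps ++ (x ∷ ps ++ rest)) isSuccessor ↔
      (∃ λ u → F.Named ps (a , b) u × F.Force ps (a , b) (u ∷ v ∷ x ∷ []) (leafᴸ 0F & rel nodeᵗ 0F 1F 2F))
    ↔-isSuccessor a b v ps {s} x rest =
      (λ (u , u∈ , p) → let q , r = proj₁ (at u) p in u , (u∈ , q) , r) ,
      (λ (u , (u∈ , q) , r) → u , u∈ , proj₂ (at u) (q , r))
      where
      σ = v ∷ ps ++ (x ∷ ps ++ rest)
      eval : ∀ j → lookup σ (paramVars j) ≡ lookup ps j
      eval = eval-params v ps (x ∷ ps ++ rest)
      ν : Fin 3 → Fin (9 ℕ.+ (8 ℕ.+ s))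
      ν = lookup (0F ∷ 1F ∷ suc (8 ↑ʳ (zero {7 ℕ.+ s})) ∷ [])
      at : ∀ u → Sat (b ∷ a ∷ []) (u ∷ σ) (and (nameF (λ j → suc (paramVars j)) last 0F)
                   (forceF (λ j → suc (paramVars j)) ν last (leafᴸ 0F & rel nodeᵗ 0F 1F 2F))) ↔
                 F.Name ps (a , b) u × F.Force ps (a , b) (u ∷ v ∷ x ∷ []) (leafᴸ 0F & rel nodeᵗ 0F 1F 2F)
      at u = ↔-and (↔-name ps (u ∷ σ) (λ j → suc (paramVars j)) eval (b ∷ a ∷ []) last 0F)
        (↔-force ps (b ∷ a ∷ []) (u ∷ σ) (λ j → suc (paramVars j)) eval ν (u ∷ v ∷ x ∷ [])
          (λ { 0F → refl ; 1F → refl ; 2F → Vec.lookup-++ʳ (v ∷ ps) (x ∷ ps ++ rest) zero }) last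
          (leafᴸ 0F & rel nodeᵗ 0F 1F 2F))

    -- The parameters quantified anew at a step are equated with the old ones, so that the meaning
    -- involves a single ps throughout.
    ↔-numeral : ∀ m a b ps (ps∈ : ∀ j → 𝓕 (lookup ps j)) {s} x (rest : Vec (Subset ℝ) s) →
                Sat (b ∷ a ∷ []) (x ∷ ps ++ rest) (numeral m) ↔ Numeral ps (a , b) m x
    ↔-numeral zero a b ps ps∈ x rest =
      ↔-force ps (b ∷ a ∷ []) (x ∷ ps ++ rest) paramVars (eval-params x ps rest) (λ _ → 0F) (x ∷ [])
        (λ { 0F → refl }) last (leafᴸ 0F)
    ↔-numeral (suc m) a b ps ps∈ {s} x rest = forward , backward
      where
      ρ = b ∷ a ∷ []
      σ = x ∷ ps ++ rest
      forward : Sat ρ σ (numeral (suc m)) → Numeral ps (a , b) (suc m) x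
      forward p = go (proj₁ (↔-exSets ρ σ 8 (and step (numeral m))) p)
        where
        go : (∃ λ (Xs : Vec (Subset ℝ) 8) → (∀ i → 𝓕 (lookup Xs i)) × Sat ρ (Xs ++ σ) (and step (numeral m))) →
             Numeral ps (a , b) (suc m) x
        go (v ∷ qs , Xs∈ , (copied , named , successor) , rest-numeral)
          with refl ← proj₁ (↔-copy ρ v qs x ps rest) copied =
          v , (Xs∈ zero , proj₁ (↔-name ps (v ∷ ps ++ σ) paramVars (eval-params v ps σ) ρ last 0F) named) ,
          proj₁ (↔-isSuccessor a b v ps x rest) successor , proj₁ (↔-numeral m a b ps ps∈ v σ) rest-numeral
      backward : Numeral ps (a , b) (suc m) x → Sat ρ σ (numeral (suc m))
      backward (v , (v∈ , named) , successor , rest-numeral) =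
        proj₂ (↔-exSets ρ σ 8 (and step (numeral m)))
          (v ∷ ps , (λ { zero → v∈ ; (suc i) → ps∈ i }) ,
           (proj₂ (↔-copy ρ v ps x ps rest) refl ,
            proj₂ (↔-name ps (v ∷ ps ++ σ) paramVars (eval-params v ps σ) ρ last 0F) named ,
            proj₂ (↔-isSuccessor a b v ps x rest) successor) ,
           proj₂ (↔-numeral m a b ps ps∈ v σ) rest-numeral)

    record Counterexample (τ : L 0) (m : ℕ) (ψ : L 1) : Set where
      field
        I         : Itv
        proper    : Proper I
        ps        : Params
        ps∈       : ∀ j → 𝓕 (lookup ps j)
        forced    : F.Force ps I [] τ
        x         : Subset ℝ
        named     : F.Named ps I x
        is-number : Numeral ps I m x
        fails     : ¬ F.Force ps I (x ∷ []) ψ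

    ↔-sentence : ∀ τ m ψ → True (sentence τ m (failing ψ)) ↔ ¬ Counterexample τ m ψ
    ↔-sentence τ m ψ = ↔-neg (forward , backward)
      where
      Body : Formula (suc n) 2 7
      Body = and (setting τ) (exSet (and (nameF (paramVars {0}) last 0F) (and (numeral m {0}) (failing ψ))))
      ↔-setting : ∀ a b (ps : Params) → Sat (b ∷ a ∷ []) ps (setting τ) ↔ a < b × F.Force ps (a , b) [] τ
      ↔-setting a b ps = ↔-and (<ᴿ⇒< , <⇒<ᴿ)
        (↔-force ps (b ∷ a ∷ []) ps id (λ _ → refl) (λ ()) [] (λ ()) last τ)
      ↔-failing : ∀ a b x ps → Sat (b ∷ a ∷ []) (x ∷ ps ++ []) (failing ψ) ↔ ¬ F.Force ps (a , b) (x ∷ []) ψ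
      ↔-failing a b x ps = ↔-neg (↔-force ps (b ∷ a ∷ []) (x ∷ ps ++ []) (paramVars {0}) (eval-params x ps [])
        (λ _ → 0F) (x ∷ []) (λ { 0F → refl }) last ψ)
      ↔-x : ∀ a b x ps → Sat (b ∷ a ∷ []) (x ∷ ps ++ []) (nameF (paramVars {0}) last 0F) ↔ F.Name ps (a , b) x
      ↔-x a b x ps = ↔-name ps (x ∷ ps ++ []) (paramVars {0}) (eval-params x ps []) (b ∷ a ∷ []) last 0F
      forward : (∃₂ λ a b → Sat (b ∷ a ∷ []) [] (exSets 7 Body)) → Counterexample τ m ψ
      forward (a , b , p) = go (proj₁ (↔-exSets (b ∷ a ∷ []) [] 7 Body) p)
        where
        go : (∃ λ (ps : Params) → (∀ j → 𝓕 (lookup ps j)) × Sat (b ∷ a ∷ []) (ps ++ []) Body) → Counterexample τ m ψ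
        go (ps@(_ ∷ _ ∷ _ ∷ _ ∷ _ ∷ _ ∷ _ ∷ []) , ps∈ , set , x , x∈ , named , number , fails) = record
          { I = a , b ; proper = proj₁ (proj₁ (↔-setting a b ps) set) ; ps = ps ; ps∈ = ps∈
          ; forced = proj₂ (proj₁ (↔-setting a b ps) set)
          ; x = x ; named = x∈ , proj₁ (↔-x a b x ps) named
          ; is-number = proj₁ (↔-numeral m a b ps ps∈ x []) number
          ; fails = proj₁ (↔-failing a b x ps) fails }
      backward : Counterexample τ m ψ → ∃₂ λ a b → Sat (b ∷ a ∷ []) [] (exSets 7 Body)
      backward record { I = a , b ; proper = proper ; ps = ps@(_ ∷ _ ∷ _ ∷ _ ∷ _ ∷ _ ∷ _ ∷ []) ; ps∈ = ps∈
                      ; forced = forced ; x = x ; named = x∈ , named ; is-number = number ; fails = fails } =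
        a , b , proj₂ (↔-exSets (b ∷ a ∷ []) [] 7 Body)
          (ps , ps∈ , proj₂ (↔-setting a b ps) (proper , forced) ,
           x , x∈ , proj₂ (↔-x a b x ps) named , proj₂ (↔-numeral m a b ps ps∈ x []) number ,
           proj₂ (↔-failing a b x ps) fails)

  -- Undecidability

  module Diagonal {n : ℕ} (Th : Sentence n → Set) (S : ℕ → Formula n 2 8 → Sentence n) (h : Rec 1)
    (h-computes : ∀ χ → h [ number χ ∷ [] ]⇓ number (S (number χ) χ))
    (claim : Rec 1 → Formula n 2 8)
    (halting⇒Th : ∀ g m → g [ m ∷ [] ]⇓ 0 → Th (S m (claim g)))
    (Th⇒halting : ∀ g m → Th (S m (claim g)) → g [ m ∷ [] ]⇓ 0) where

    -- On the number of a formula χ, the function g answers as f does about the sentence made from χ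
    -- and its own number. For χ the claim about g, this sentence s is in `Th` exactly if g returns
    -- 0 on m, that is, exactly if f rejects s.
    undecidable : Undecidable Th
    undecidable (f , decides) = ¬th (halting⇒Th g m (comp⇓ (number s ∷ []) (λ { 0F → h-computes χ })
        (subst (λ c → f [ c ∷ [] ]⇓ 0) (code≡number s) (proj₂ (decides s) ¬th))))
      where
      g : Rec 1
      g = comp f (h ∷ [])
      χ : Formula n 2 8
      χ = claim g
      m : ℕ
      m = number χ
      s : Sentence n
      s = S m χ

      f-halts : g [ m ∷ [] ]⇓ 0 → f [ number s ∷ [] ]⇓ 0
      f-halts (comp⇓ (y ∷ []) ds d) =
        subst (λ c → f [ c ∷ [] ]⇓ 0) (⇓-deterministic (ds 0F) (h-computes χ)) d

      ¬th : ¬ Th s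
      ¬th th = case ⇓-deterministic (f-halts (Th⇒halting g m th))
                      (subst (λ c → f [ c ∷ [] ]⇓ 1) (code≡number s) (proj₁ (decides s) th)) of λ ()

  -- The tree of g is written into the pattern as a constant, whereas the argument stays a variable,
  -- to be named by `numeral m`.
  haltingᵖ : Rec 1 → Pattern 1
  haltingᵖ g = judgementᵖ (embed (recᵗ g)) (nodeᵖ (var 0F) leafᵖ) leafᵖ

  inst-haltingᵖ : ∀ g m → inst (numᵗ m ∷ []) (haltingᵖ g) ≡ judgement (recᵗ g) (vecᵗ (m ∷ [])) leaf
  inst-haltingᵖ g m = cong (λ p → judgement p (node (numᵗ m) leaf) leaf) (inst-embed (numᵗ m ∷ []) (recᵗ g))

  halts⇒derivable : ∀ g m → g [ m ∷ [] ]⇓ 0 → Derivable evaluation (inst (numᵗ m ∷ []) (haltingᵖ g))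
  halts⇒derivable g m d = subst (Derivable evaluation) (sym (inst-haltingᵖ g m)) (⇓-derivable d)

  derivable⇒halts : ∀ g m → Derivable evaluation (inst (numᵗ m ∷ []) (haltingᵖ g)) → g [ m ∷ [] ]⇓ 0
  derivable⇒halts g m d =
    evaluates (ev-sound g (m ∷ []) (derivable-valid (subst (Derivable evaluation) (inst-haltingᵖ g m) d)))
    where
    evaluates : (∃ λ y → leaf ≡ numᵗ y × g [ m ∷ [] ]⇓ y) → g [ m ∷ [] ]⇓ 0
    evaluates (zero , _ , d) = d

  -- Derivable instances and theorems of the monadic theory

  module Reduction {n : ℕ} (𝓕 : Subset ℝ → Set) {r : ℕ} (program : Vec Rule r) where

    open SentenceFormula {n}

    Theorem : ℕ → Pattern 1 → Set
    Theorem m p = MonadicTheory (suc n) 𝓕 (sentence (theory program) m (failing (instance-holds id p)))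

    -- A counterexample in any structure forces τ, and its x denotes the numeral of m; hence the
    -- derivation is forced there, against the assumption.
    derivable⇒theorem : ∀ m p → Derivable program (inst (numᵗ m ∷ []) p) → Theorem m p
    derivable⇒theorem m p d Q = proj₂ (↔-sentence (theory program) m (instance-holds id p)) refute
      where
      open SentenceTruth Q 𝓕

      refute : ¬ Counterexample (theory program) m (instance-holds id p)
      -- The consequences of τ are available strictly inside I, from where locality extends them to
      -- I.
      refute c = fails (F.force-local ps (x ∷ []) (instance-holds id p) λ J J⊏I →
        let K , K⊏J = ⊏-below J⊏I ; K⊏I = ⊏-trans K⊏J J⊏I in
        K , K⊏J , instance-forced p {numᵗ m ∷ []} {x ∷ []} K⊏I
          (λ { 0F → denotes-persistent (numᵗ m) {x} K⊏I (named , denotes-numeral m is-number) }) d)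
        where
        open Counterexample c
        open ForcedTheory.Consequences program (Q 0F) 𝓕 ps forced

        denotes-numeral : ∀ m {x} → Numeral ps I m x → Den I (numᵗ m) x
        denotes-numeral zero    number = number
        denotes-numeral (suc m) {x} (v , nv , (u , nu , zero-u , successor) , number) J J⊏I =
          let K , K⊏J = ⊏-below J⊏I ; K⊏I = ⊏-trans K⊏J J⊏I in
          K , K⊏J , u , v , F.named-persistent ps K⊏I nu , F.named-persistent ps K⊏I nv ,
          den-persistent leaf {u} K⊏I zero-u , den-persistent (numᵗ m) {v} K⊏I (denotes-numeral m number) ,
          F.good-persistent ps K⊏I successor

    module _ (ch : ContinuumHypothesis) (𝓕-image : ∀ S → 𝓕 (image S)) (some : ∃ (Derivable program)) where

      open StandardTruth ch 𝓕 𝓕-image (Derivable program) some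

      standard : Fin (suc n) → Subset ℝ
      standard zero    = Sep.avoider
      standard (suc _) = λ _ → false

      open SentenceTruth {n} standard 𝓕 using (Numeral; Counterexample; ↔-sentence)

      one : Itv
      one = real 0ℚ , real 1ℚ

      one-proper : Proper one
      one-proper = real-mono (ℚ.positive⁻¹ 1ℚ)

      canonical-interprets : ∀ {k} (os : Vec Tree k) → Interprets one (Vec.map canonical os) os
      canonical-interprets []       = interprets (λ ()) (λ ())
      canonical-interprets (o ∷ os) = extend (canonical-named o) (canonical-represents o) (canonical-interprets os)

      canonical-numeral : ∀ m → Numeral params one m (canonical (numᵗ m))
      canonical-numeral zero    =
        models⇒forced {xs = canonical leaf ∷ []} {leaf ∷ []} (leafᴸ 0F) one-proper (canonical-interprets (leaf ∷ [])) refl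
      canonical-numeral (suc m) = canonical (numᵗ m) , canonical-named (numᵗ m) ,
        (canonical leaf , canonical-named leaf ,
         models⇒forced {os = os} (leafᴸ 0F & rel nodeᵗ 0F 1F 2F) one-proper (canonical-interprets os) (refl , refl)) ,
        canonical-numeral m
        where
        os = leaf ∷ numᵗ m ∷ numᵗ (suc m) ∷ []

      -- In the structure built from CH, τ is forced because it is true of the trees, and an
      -- underivable instance is not forced because it is false of them; together they make a
      -- counterexample.
      theorem⇒derivable : ∀ m p → Theorem m p → Derivable program (inst (numᵗ m ∷ []) p)
      theorem⇒derivable m p true-everywhere = stable λ underivable →
        proj₁ (↔-sentence (theory program) m (instance-holds id p)) (true-everywhere standard) record
          { I = one ; proper = one-proper ; ps = params ; ps∈ = params-∈
          ; forced = models⇒forced (theory program) one-proper (canonical-interprets []) (theory-models program)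
          ; x = canonical (numᵗ m) ; named = canonical-named (numᵗ m) ; is-number = canonical-numeral m
          ; fails = λ forced → underivable (derivable (forced⇒models (instance-holds id p) one-proper
                      (canonical-interprets (numᵗ m ∷ [])) forced)) }
        where
        derivable : Models (numᵗ m ∷ []) (instance-holds id p) → Derivable program (inst (numᵗ m ∷ []) p)
        derivable (t , matched , d) =
          subst (Derivable program) (match-models program (t ∷ numᵗ m ∷ []) p (λ _ → refl) matched) d

  image-countable : ∀ S → Countable (image S)
  image-countable S = record
    { to = index ℚ-enumerable ∘ rational
    ; cong = λ { refl → refl }
    ; injective = λ {a} {b} eq → Element-≡ (trans (rational-≡ a)
        (trans (cong real (injective ℚ-enumerable eq)) (sym (rational-≡ b)))) }
    where
    rational : Element (image S) → ℚ
    rational (_ , x∈) = proj₁ (image⁻ {S} x∈)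
    rational-≡ : ∀ a → proj₁ a ≡ real (rational a)
    rational-≡ (_ , x∈) = proj₁ (proj₂ (image⁻ {S} x∈))

  image-rational : ∀ S → OfRationals (image S)
  image-rational S x x∈ = let q , eq , _ = image⁻ {S} x∈ in q , trans eq (real≡fromℚ q)

  theory-undecidable : ContinuumHypothesis → (𝓕 : Subset ℝ → Set) → (∀ S → 𝓕 (image S)) →
    ∀ {r} (program : Vec Rule r) → ∃ (Derivable program) → (halting : Rec 1 → Pattern 1) →
    (∀ g m → g [ m ∷ [] ]⇓ 0 → Derivable program (inst (numᵗ m ∷ []) (halting g))) →
    (∀ g m → Derivable program (inst (numᵗ m ∷ []) (halting g)) → g [ m ∷ [] ]⇓ 0) →
    ∀ n → Undecidable (MonadicTheory (suc n) 𝓕)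
  theory-undecidable ch 𝓕 𝓕-image program some halting complete sound n =
    Diagonal.undecidable (MonadicTheory (suc n) 𝓕) (sentence (theory program))
      (proj₁ diagonal-code) (proj₂ diagonal-code) (λ g → failing (instance-holds id (halting g)))
      (λ g m d → derivable⇒theorem m (halting g) (complete g m d))
      (λ g m t → sound g m (theorem⇒derivable ch 𝓕-image some m (halting g) t))
    where
    open SentenceFormula {n}
    open SentenceCode {n} (theory program)
    open Reduction {n} 𝓕 program

  undecidable : ContinuumHypothesis → (𝓕 : Subset ℝ → Set) → (∀ S → 𝓕 (image S)) →
                ∀ n → Undecidable (MonadicTheory (suc n) 𝓕)
  undecidable ch 𝓕 𝓕-image = theory-undecidable ch 𝓕 𝓕-image evaluation
    (_ , ⇓-derivable zero⇓) haltingᵖ halts⇒derivable derivable⇒halts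

theorem8p2 : ExcludedMiddle 0ℓ → Extensionality 0ℓ 0ℓ →
    ContinuumHypothesis →
    (n : ℕ) → 1 ≤ n →
    Undecidable (MonadicTheory n Countable) × Undecidable (MonadicTheory n OfRationals)
theorem8p2 em ext ch (suc n) _ =
  undecidable ch Countable image-countable n , undecidable ch OfRationals image-rational n
  where open Proof em ext
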